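{- Let $a,b,s,t$ be positive integers with $r=a+b$, $b<a<r-1$ and $t\le s$. Let $T$ be a tree with bipartition $(U,V)$, $|U|=s$, $|V|=t$, and $\mathcal T=T(a,b)$. Suppose $T$ has a critical leaf, i.e. a vertex $x\in V$ with $\deg_T(x)=1$. Let $(H_n)$ be a sequence where $H_n$ is a $\mathcal T$-free $r$-graph on $n$ vertices and $|H_n|=(1+o(1))(t-1)\binom{n}{r-1}$ as $n\to\infty$. Then there exist sets $S_n$ of $t-1$ vertices of $H_n$ such that the number of edges of $H_n$ disjoint from $S_n$ is $o(n^{r-1})$.
   Context: An $r$-graph is a family of $r$-subsets of a finite vertex set. For a bipartite graph $T$ with parts $U=\{u_1,\dots,u_s\}$, $V=\{v_1,\dots,v_t\}$, the $(a,b)$-blowup $T(a,b)$ is the $(a+b)$-graph obtained by taking pairwise disjoint sets $U_1,\dots,U_s,V_1,\dots,V_t$ with $|U_i|=a$, $|V_j|=b$ and edge set $\{U_i\cup V_j:u_iv_j\in E(T)\}$; $H$ is $\mathcal T$-free if it contains no copy of $\mathcal T$. -}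

module Defs where

open import Data.Nat using (ℕ; zero; suc; _+_; _*_; _∸_; _^_; _≤_; _<_; ∣_-_∣)
open import Data.Nat.Combinatorics using (_C_)
open import Data.Bool using (Bool; true; false)
open import Data.Fin using (Fin)
open import Data.Fin.Subset using (Subset; _∩_; _∪_; ∣_∣; Empty)
open import Data.List using (List; length; filter; map; allFin)
open import Data.Nat.ListAction using (sum)
open import Relation.Nullary using (¬_)
open import Data.List.Membership.Propositional using (_∈_)
open import Data.List.Relation.Unary.All using (All)
open import Data.List.Relation.Unary.Unique.Propositional using (Unique)
open import Data.Sum using (_⊎_; inj₁; inj₂)
open import Data.Product using (Σ; _×_; ∃-syntax)
open import Relation.Binary.PropositionalEquality using (_≡_; _≢_)
open import Data.Bool.Properties using () renaming (_≟_ to _≟ᵇ_)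
import Data.Nat.Properties as ℕP

record RGraph (r n : ℕ) : Set where
  field
    edges    : List (Subset n)
    unique   : Unique edges
    uniform  : All (λ e → ∣ e ∣ ≡ r) edges
open RGraph public

size : ∀ {r n} → RGraph r n → ℕ
size H = length (edges H)

disjointEdges : ∀ {r n} → RGraph r n → Subset n → ℕ
disjointEdges H S = length (filter (λ e → ∣ e ∩ S ∣ ℕP.≟ 0) (edges H))

record BipGraph (s t : ℕ) : Set where
  field
    adj : Fin s → Fin t → Bool
open BipGraph public

Vert : ℕ → ℕ → Set
Vert s t = Fin s ⊎ Fin t

data Adjacent {s t} (T : BipGraph s t) : Vert s t → Vert s t → Set where
  uv : ∀ i j → adj T i j ≡ true → Adjacent T (inj₁ i) (inj₂ j)
  vu : ∀ i j → adj T i j ≡ true → Adjacent T (inj₂ j) (inj₁ i)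

data Reach {s t} (T : BipGraph s t) : Vert s t → Vert s t → Set where
  here : ∀ {x} → Reach T x x
  step : ∀ {x y z} → Adjacent T x y → Reach T y z → Reach T x z

Connected : ∀ {s t} → BipGraph s t → Set
Connected T = ∀ x y → Reach T x y

countTrue : ∀ {m} → (Fin m → Bool) → ℕ
countTrue f = length (filter (λ i → f i ≟ᵇ true) (allFin _))

edgeCount : ∀ {s t} → BipGraph s t → ℕ
edgeCount {s} T = sum (map (λ i → countTrue (adj T i)) (allFin s))

degV : ∀ {s t} → BipGraph s t → Fin t → ℕ
degV T j = countTrue (λ i → adj T i j)

IsTree : ∀ {s t} → BipGraph s t → Set
IsTree {s} {t} T = Connected T × edgeCount T ≡ s + t ∸ 1

HasCriticalLeaf : ∀ {s t} → BipGraph s t → Set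
HasCriticalLeaf T = ∃[ x ] degV T x ≡ 1

record BlowupCopy {s t} (T : BipGraph s t) (a b : ℕ) {n} (H : RGraph (a + b) n) : Set where
  field
    Us      : Fin s → Subset n
    Vs      : Fin t → Subset n
    Us-size : ∀ i → ∣ Us i ∣ ≡ a
    Vs-size : ∀ j → ∣ Vs j ∣ ≡ b
    UU-disj : ∀ i i' → i ≢ i' → Empty (Us i ∩ Us i')
    VV-disj : ∀ j j' → j ≢ j' → Empty (Vs j ∩ Vs j')
    UV-disj : ∀ i j → Empty (Us i ∩ Vs j)
    edge    : ∀ i j → adj T i j ≡ true → (Us i ∪ Vs j) ∈ edges H

BlowupFree : ∀ {s t} (T : BipGraph s t) (a b : ℕ) {n} → RGraph (a + b) n → Set
BlowupFree T a b H = ¬ BlowupCopy T a b H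

AsympEq : (ℕ → ℕ) → (ℕ → ℕ) → Set
AsympEq f g = ∀ k → 1 ≤ k → ∃[ N ] (∀ n → N ≤ n → k * ∣ f n - g n ∣ ≤ g n)

LittleO : (ℕ → ℕ) → (ℕ → ℕ) → Set
LittleO f g = ∀ k → 1 ≤ k → ∃[ N ] (∀ n → N ≤ n → k * f n ≤ g n)

{-# OPTIONS --safe #-}
module Submission where

-- Edges are counted through words, i.e. orderings of vertex sets.  A Füredi-type lemma extracts from any
-- family of words a positive proportion in which the set J of agreement sets of pairs is closed under
-- intersection and every I ∈ J is "flexible": the letters off I can be replaced by fresh ones inside the
-- family.  If a set of a positions and its complement both lie in J, the tree blowup embeds greedily.
-- Otherwise b ≥ 2 and b < a force a single central position z: words that differ in only one further
-- position agree at z.  A dense family of this kind has a vertex of degree proportional to n^(r-1).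
-- Hence all but o(n^(r-1)) edges meet a bounded set L of vertices of large degree, mostly in one vertex.
-- For an (r-1)-word D let c(D) ⊆ L be the set of v ∉ D with D ∪ {v} an edge.  Applying the same lemma to
-- words (y, y', W) shows that |c(yW) ∪ c(y'W)| ≥ t is rare, for otherwise the blowup embeds with one
-- vertex of L in each V_j.  Since the number of edges forces |c(D)| ≥ t - 1 for almost all D, the function
-- c is almost invariant under changing one letter, hence almost constant, and its value is S_n.

open import Defs
open import Data.Nat using (ℕ; zero; suc; _+_; _*_; _∸_; _^_; _/_; _%_; _!; _≤_; _<_; z≤n; s≤s; NonZero; >-nonZero) renaming (∣_-_∣ to dist)
open import Data.Nat.Properties
open import Data.Nat.Combinatorics using (_C_; k>n⇒nCk≡0; nCk+nC[k+1]≡[n+1]C[k+1]; nC1≡n)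
open import Data.Nat.DivMod using (m/n*n≤m; m≡m%n+[m/n]*n; m%n<n; m≥n⇒m/n>0)
open import Data.Nat.Induction using (<-wellFounded)
import Data.Nat.ListAction
open import Data.Nat.Tactic.RingSolver using (solve-∀)
open import Data.Bool using (Bool; true; false; _∧_; _∨_; not)
import Data.Bool.Properties as Bool
open import Data.Empty using (⊥-elim)
open import Data.Fin using (Fin; zero; suc; punchIn; punchOut)
import Data.Fin.Properties as Fin
open import Data.Fin.Subset using (Subset; _∈_; _∉_; _⊆_; _∩_; _∪_; ∣_∣; ⊤; ⊥; ⁅_⁆; ∁; _-_; Empty)
open import Data.Fin.Subset.Properties
open import Data.List using (List; []; _∷_; length; map; concatMap; allFin; _++_; filter; cartesianProduct)
open import Data.List.Extrema.Nat using (argmin; argmin-all; f[argmin]≤v⁺)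
import Data.List.Membership.DecPropositional as DecMem
import Data.List.Membership.Propositional as Mem
open import Data.List.Membership.Propositional using () renaming (_∈_ to _∈ˡ_; _∉_ to _∉ˡ_)
open import Data.List.Membership.Propositional.Properties using (∈-allFin; ∈-map⁺; ∈-map⁻; ∈-concatMap⁺; ∈-concatMap⁻; ∈-filter⁺; ∈-filter⁻; ∈-cartesianProduct⁺; ∈-++⁺ˡ; ∈-++⁺ʳ; ∈-++⁻; ∈-∃++)
open import Data.List.Properties using (length-++; length-map; length-tabulate; filter-notAll)
open import Data.List.Relation.Unary.All as All using (All; []; _∷_)
open import Data.List.Relation.Unary.AllPairs using ([]; _∷_)
open import Data.List.Relation.Unary.Any using (Any; here; there; any?)
open import Data.List.Relation.Unary.Unique.Propositional using (Unique)
import Data.List.Relation.Unary.Unique.Propositional.Properties as Unique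
open import Data.Product using (Σ; ∃; ∃-syntax; _×_; _,_; proj₁; proj₂)
import Data.Product.Properties
open import Data.Sum using (_⊎_; inj₁; inj₂)
import Data.Sum.Properties as Sum
open import Data.Vec using (Vec; []; _∷_; lookup; zipWith; toList; tabulate; insertAt)
open import Data.Vec.Properties using (lookup-zipWith; []=⇒lookup; lookup⇒[]=; ≡-dec; length-toList; lookup∘tabulate; insertAt-lookup; insertAt-punchIn)
open import Function using (_∘_; id)
open import Induction.WellFounded using (Acc; acc)
open import Relation.Binary.PropositionalEquality hiding (J)
open import Relation.Nullary using (¬_; Dec; yes; no; does; ¬?)
open import Relation.Nullary.Decidable using (_×-dec_; _→-dec_; decidable-stable)

-- Sums over lists and words

-- Positions of a word replace the parts of an r-partite subfamily, so kernels are subsets of a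
-- fixed index set and the extraction loses a factor independent of n. Put k = r - 2. More than n^k
-- words of length r are not determined by any k positions. This yields only kernels that miss one
-- or both of two given positions and nothing else, and b < a allows a split into a and b positions
-- all the same, unless exactly one position can never be missed alone. The words (y, y', W) also
-- have r letters, but there the scale is n^(k+1): beyond it every set of positions is a kernel, so
-- the bad words are fewer than all n^(k+2) by a factor of order n. The degree threshold is about
-- (n/K)^(r-1). The edges that avoid L then number O(n^(r-1)/K) with a constant independent of K,
-- whereas |L| is bounded only in terms of K. Every other term that involves |L| must therefore be
-- smaller by a power of n. The bound |c| ≤ t - 1 holds for almost all words by embedding, and the
-- mean of |c| is at least about t - 1 by counting edges; together they leave few words below t - 1.

∑ : {A : Set} → List A → (A → ℕ) → ℕ
∑ []       f = 0
∑ (x ∷ xs) f = f x + ∑ xs f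

module _ {A : Set} where

  ∑-mono-∈ : ∀ (xs : List A) {f g : A → ℕ} → (∀ x → x ∈ˡ xs → f x ≤ g x) → ∑ xs f ≤ ∑ xs g
  ∑-mono-∈ []       f≤g = z≤n
  ∑-mono-∈ (x ∷ xs) f≤g = +-mono-≤ (f≤g x (here refl)) (∑-mono-∈ xs (λ y y∈ → f≤g y (there y∈)))

  ∑-mono : ∀ (xs : List A) {f g : A → ℕ} → (∀ x → f x ≤ g x) → ∑ xs f ≤ ∑ xs g
  ∑-mono xs f≤g = ∑-mono-∈ xs (λ x _ → f≤g x)

  ∑-cong : ∀ (xs : List A) {f g : A → ℕ} → (∀ x → f x ≡ g x) → ∑ xs f ≡ ∑ xs g
  ∑-cong []       f≗g = refl
  ∑-cong (x ∷ xs) f≗g = cong₂ _+_ (f≗g x) (∑-cong xs f≗g)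

  ∑-+ : ∀ (xs : List A) (f g : A → ℕ) → ∑ xs (λ x → f x + g x) ≡ ∑ xs f + ∑ xs g
  ∑-+ []       f g = refl
  ∑-+ (x ∷ xs) f g rewrite ∑-+ xs f g = lemma (f x) (g x) (∑ xs f) (∑ xs g)
    where
    lemma : ∀ a b c d → a + b + (c + d) ≡ a + c + (b + d)
    lemma = solve-∀

  ∑-*ˡ : ∀ (xs : List A) c (f : A → ℕ) → ∑ xs (λ x → c * f x) ≡ c * ∑ xs f
  ∑-*ˡ []       c f = sym (*-zeroʳ c)
  ∑-*ˡ (x ∷ xs) c f = trans (cong (c * f x +_) (∑-*ˡ xs c f)) (sym (*-distribˡ-+ c (f x) (∑ xs f)))

  ∑-const : ∀ (xs : List A) c → ∑ xs (λ _ → c) ≡ length xs * c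
  ∑-const []       c = refl
  ∑-const (x ∷ xs) c = cong (c +_) (∑-const xs c)

  ∑-bound : ∀ (xs : List A) {f : A → ℕ} {c} → (∀ x → x ∈ˡ xs → f x ≤ c) → ∑ xs f ≤ length xs * c
  ∑-bound xs {c = c} f≤c = subst (_ ≤_) (∑-const xs c) (∑-mono-∈ xs f≤c)

  ∑-zero : ∀ (xs : List A) {f : A → ℕ} → (∀ x → f x ≡ 0) → ∑ xs f ≡ 0
  ∑-zero xs f≗0 = trans (∑-cong xs f≗0) (trans (∑-const xs 0) (*-zeroʳ (length xs)))

  ∑-term : ∀ {xs : List A} {f : A → ℕ} {x} → x ∈ˡ xs → f x ≤ ∑ xs f
  ∑-term (here refl) = m≤m+n _ _
  ∑-term (there x∈)  = ≤-trans (∑-term x∈) (m≤n+m _ _)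

  ∑-++ : ∀ (xs ys : List A) (f : A → ℕ) → ∑ (xs ++ ys) f ≡ ∑ xs f + ∑ ys f
  ∑-++ []       ys f = refl
  ∑-++ (x ∷ xs) ys f = trans (cong (f x +_) (∑-++ xs ys f)) (sym (+-assoc (f x) _ _))

  ∑-maximal : ∀ (xs : List A) (f : A → ℕ) →
    ∑ xs f ≡ 0 ⊎ ∃[ x ] x ∈ˡ xs × ∑ xs f ≤ length xs * f x
  ∑-maximal []       f = inj₁ refl
  ∑-maximal (x ∷ xs) f with ∑-maximal xs f
  ... | inj₁ eq = inj₂ (x , here refl , ≤-trans (≤-reflexive (cong (f x +_) eq)) (+-monoʳ-≤ (f x) z≤n))
  ... | inj₂ (y , y∈ , le) with f x ≤? f y
  ... | yes p = inj₂ (y , there y∈ , +-mono-≤ p le)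
  ... | no ¬p = inj₂ (x , here refl , +-monoʳ-≤ (f x) (≤-trans le (*-monoʳ-≤ (length xs) (<⇒≤ (≰⇒> ¬p)))))

  ∑-minimal : ∀ x₀ (xs : List A) (f : A → ℕ) → ∃[ x ] length (x₀ ∷ xs) * f x ≤ ∑ (x₀ ∷ xs) f
  ∑-minimal x []       f = x , ≤-refl
  ∑-minimal x (x₁ ∷ xs) f with ∑-minimal x₁ xs f
  ... | y , le with f x ≤? f y
  ... | yes p = x , +-monoʳ-≤ (f x) (≤-trans (*-monoʳ-≤ (suc (length xs)) p) le)
  ... | no ¬p = y , +-mono-≤ (<⇒≤ (≰⇒> ¬p)) le

  ∃-dec : ∀ (xs : List A) {P : A → Set} → (∀ x → x ∈ˡ xs) → (∀ x → Dec (P x)) → Dec (∃ P)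
  ∃-dec xs all P? with any? P? xs
  ... | yes p = yes (_ , proj₂ (proj₂ (Mem.find p)))
  ... | no ¬p = no λ (x , px) → ¬p (Mem.lose (all x) px)

∑-swap : ∀ {A B : Set} (xs : List A) (ys : List B) (f : A → B → ℕ) →
  ∑ xs (λ x → ∑ ys (f x)) ≡ ∑ ys (λ y → ∑ xs (λ x → f x y))
∑-swap []       ys f = sym (∑-zero ys (λ _ → refl))
∑-swap (x ∷ xs) ys f = trans (cong (∑ ys (f x) +_) (∑-swap xs ys f)) (sym (∑-+ ys (f x) _))

∑-map : ∀ {A B : Set} (h : A → B) (xs : List A) (f : B → ℕ) → ∑ (map h xs) f ≡ ∑ xs (f ∘ h)
∑-map h []       f = refl
∑-map h (x ∷ xs) f = cong (f (h x) +_) (∑-map h xs f)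

∑-concatMap : ∀ {A B : Set} (h : A → List B) (xs : List A) (f : B → ℕ) →
  ∑ (concatMap h xs) f ≡ ∑ xs (λ x → ∑ (h x) f)
∑-concatMap h []       f = refl
∑-concatMap h (x ∷ xs) f = trans (∑-++ (h x) _ f) (cong (∑ (h x) f +_) (∑-concatMap h xs f))

length≡∑ : ∀ {A : Set} (xs : List A) → length xs ≡ ∑ xs (λ _ → 1)
length≡∑ xs = sym (trans (∑-const xs 1) (*-identityʳ _))

tuples : {A : Set} → List A → (m : ℕ) → List (Vec A m)
tuples xs zero    = [] ∷ []
tuples xs (suc m) = concatMap (λ x → map (x ∷_) (tuples xs m)) xs

∑-tuples-suc : ∀ {A : Set} (xs : List A) m (f : Vec A (suc m) → ℕ) →
  ∑ (tuples xs (suc m)) f ≡ ∑ xs (λ x → ∑ (tuples xs m) (λ w → f (x ∷ w)))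
∑-tuples-suc xs m f = trans (∑-concatMap _ xs f) (∑-cong xs (λ x → ∑-map (x ∷_) (tuples xs m) f))

length-tuples : ∀ {A : Set} (xs : List A) m → length (tuples xs m) ≡ length xs ^ m
length-tuples xs zero    = refl
length-tuples xs (suc m) = begin
  length (tuples xs (suc m))                   ≡⟨ length≡∑ (tuples xs (suc m)) ⟩
  ∑ (tuples xs (suc m)) (λ _ → 1)              ≡⟨ ∑-tuples-suc xs m _ ⟩
  ∑ xs (λ _ → ∑ (tuples xs m) (λ _ → 1))       ≡⟨ ∑-const xs _ ⟩
  length xs * ∑ (tuples xs m) (λ _ → 1)        ≡⟨ cong (length xs *_) (sym (length≡∑ (tuples xs m))) ⟩
  length xs * length (tuples xs m)             ≡⟨ cong (length xs *_) (length-tuples xs m) ⟩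
  length xs ^ suc m                            ∎
  where open ≡-Reasoning

∈-tuples : ∀ {A : Set} {xs : List A} {m} (w : Vec A m) → (∀ i → lookup w i ∈ˡ xs) → w ∈ˡ tuples xs m
∈-tuples []      _   = here refl
∈-tuples {xs = xs} {suc m} (x ∷ w) w∈ =
  ∈-concatMap⁺ (λ x → map (x ∷_) (tuples xs m)) (Mem.lose (w∈ zero) (∈-map⁺ (x ∷_) (∈-tuples w (w∈ ∘ suc))))

∈-bools : ∀ b → b ∈ˡ (true ∷ false ∷ [])
∈-bools true  = here refl
∈-bools false = there (here refl)

Word : ℕ → ℕ → Set
Word n m = Vec (Fin n) m

words : ∀ n m → List (Word n m)
words n m = tuples (allFin n) m

length-allFin : ∀ n → length (allFin n) ≡ n
length-allFin n = length-tabulate id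

length-words : ∀ n m → length (words n m) ≡ n ^ m
length-words n m = trans (length-tuples (allFin n) m) (cong (_^ m) (length-allFin n))

∈-words : ∀ {n m} (w : Word n m) → w ∈ˡ words n m
∈-words w = ∈-tuples w (λ i → ∈-allFin _)

-- Indicators and the counting of families of words.

𝟙 : Bool → ℕ
𝟙 true  = 1
𝟙 false = 0

𝟙≤1 : ∀ b → 𝟙 b ≤ 1
𝟙≤1 true  = ≤-refl
𝟙≤1 false = z≤n

𝟙-mono : ∀ {b c} → (b ≡ true → c ≡ true) → 𝟙 b ≤ 𝟙 c
𝟙-mono {false} _   = z≤n
𝟙-mono {true}  b⇒c rewrite b⇒c refl = ≤-refl

𝟙-true : ∀ {b} → b ≡ true → 1 ≤ 𝟙 b
𝟙-true refl = ≤-refl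

𝟙-not : ∀ b c → 𝟙 b ≡ 𝟙 (b ∧ c) + 𝟙 (b ∧ not c)
𝟙-not false c     = refl
𝟙-not true  true  = refl
𝟙-not true  false = refl

does-true : ∀ {P : Set} (p? : Dec P) → P → does p? ≡ true
does-true (yes _) _ = refl
does-true (no ¬p) p = ⊥-elim (¬p p)

does-true⁻ : ∀ {P : Set} (p? : Dec P) → does p? ≡ true → P
does-true⁻ (yes p) _ = p

does-false⁻ : ∀ {P : Set} (p? : Dec P) → not (does p?) ≡ true → ¬ P
does-false⁻ (no ¬p) _ = ¬p

not-true : ∀ {P : Set} (p? : Dec P) → ¬ P → not (does p?) ≡ true
not-true (yes p) ¬p = ⊥-elim (¬p p)
not-true (no _)  _  = refl

∧-true : ∀ {b c} → b ≡ true → c ≡ true → b ∧ c ≡ true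
∧-true refl refl = refl

∧-true⁻ : ∀ {b c} → b ∧ c ≡ true → b ≡ true × c ≡ true
∧-true⁻ {true} {true} _ = refl , refl

∨-true⁻ : ∀ {b c} → b ∨ c ≡ true → b ≡ true ⊎ c ≡ true
∨-true⁻ {true}  _  = inj₁ refl
∨-true⁻ {false} eq = inj₂ eq

Family : ℕ → ℕ → Set
Family n m = Word n m → Bool

count : ∀ {n m} → Family n m → ℕ
count {n} {m} X = ∑ (words n m) (𝟙 ∘ X)

count-suc : ∀ {n m} (X : Family n (suc m)) →
  count X ≡ ∑ (allFin n) (λ x → count (λ w → X (x ∷ w)))
count-suc {n} {m} X = ∑-tuples-suc (allFin n) m (𝟙 ∘ X)

count-mono : ∀ {n m} {X Y : Family n m} → (∀ w → X w ≡ true → Y w ≡ true) → count X ≤ count Y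
count-mono {n} {m} X⊆Y = ∑-mono (words n m) (λ w → 𝟙-mono (X⊆Y w))

count-≤ : ∀ {n m} (X : Family n m) → count X ≤ n ^ m
count-≤ {n} {m} X = ≤-trans (∑-bound (words n m) {c = 1} (λ w _ → 𝟙≤1 (X w)))
  (≤-reflexive (trans (*-identityʳ _) (length-words n m)))

count-split : ∀ {n m} (X Y : Family n m) →
  count X ≡ count (λ w → X w ∧ Y w) + count (λ w → X w ∧ not (Y w))
count-split {n} {m} X Y = trans (∑-cong (words n m) (λ w → 𝟙-not (X w) (Y w))) (∑-+ (words n m) _ _)

count-pos : ∀ {n m} {X : Family n m} {w} → X w ≡ true → 1 ≤ count X
count-pos {w = w} Xw = ≤-trans (𝟙-true Xw) (∑-term (∈-words w))

-- Homogeneous families of words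

infix 4 _≟ˢ_

_≟ˢ_ : ∀ {n} (p q : Subset n) → Dec (p ≡ q)
_≟ˢ_ = ≡-dec Bool._≟_

_≈[_]_ : ∀ {n m} → Word n m → Subset m → Word n m → Set
w ≈[ I ] w' = ∀ i → i ∈ I → lookup w i ≡ lookup w' i

≈-dec : ∀ {n m} (w : Word n m) I w' → Dec (w ≈[ I ] w')
≈-dec w I w' = Fin.all? (λ i → (i ∈? I) →-dec (lookup w i Fin.≟ lookup w' i))

agree : ∀ {n m} → Word n m → Word n m → Subset m
agree = zipWith (λ x y → does (x Fin.≟ y))

∈-agree⁺ : ∀ {n m} (w w' : Word n m) {i} → lookup w i ≡ lookup w' i → i ∈ agree w w'
∈-agree⁺ w w' {i} eq = lookup⇒[]= i _
  (trans (lookup-zipWith _ i w w') (does-true (lookup w i Fin.≟ lookup w' i) eq))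

∈-agree⁻ : ∀ {n m} (w w' : Word n m) {i} → i ∈ agree w w' → lookup w i ≡ lookup w' i
∈-agree⁻ w w' {i} i∈ = does-true⁻ (lookup w i Fin.≟ lookup w' i)
  (trans (sym (lookup-zipWith _ i w w')) ([]=⇒lookup i∈))

agree-refl : ∀ {n m} (w : Word n m) → agree w w ≡ ⊤
agree-refl w = ⊆-antisym (λ _ → ∈⊤) (λ _ → ∈-agree⁺ w w refl)

-- This plays the role of "I is the kernel of a large sunflower".
Flexible : ∀ {n m} → ℕ → Subset m → Family n m → Set
Flexible {n} {m} q I X = ∀ w → X w ≡ true → (F : List (Fin n)) → length F ≤ q →
  ∃[ w' ] X w' ≡ true × w' ≈[ I ] w × (∀ i → i ∉ I → lookup w' i ∉ˡ F)

-- Enumerating the possible forbidden lists makes `Flexible` decidable, so that its failure yields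
-- an explicit kernel, word and list.
lists≤ : ∀ n → ℕ → List (List (Fin n))
lists≤ n zero    = [] ∷ []
lists≤ n (suc q) = [] ∷ concatMap (λ x → map (x ∷_) (lists≤ n q)) (allFin n)

∈-lists≤ : ∀ {n} q (F : List (Fin n)) → length F ≤ q → F ∈ˡ lists≤ n q
∈-lists≤ zero    []      _ = here refl
∈-lists≤ (suc q) []      _ = here refl
∈-lists≤ {n} (suc q) (x ∷ F) (s≤s le) = there
  (∈-concatMap⁺ (λ x → map (x ∷_) (lists≤ n q)) (Mem.lose (∈-allFin x) (∈-map⁺ (x ∷_) (∈-lists≤ q F le))))

lists≤-length : ∀ {n} q (F : List (Fin n)) → F ∈ˡ lists≤ n q → length F ≤ q
lists≤-length zero    _ (here refl) = z≤n
lists≤-length (suc q) _ (here refl) = z≤n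
lists≤-length {n} (suc q) F (there F∈) with Mem.find (∈-concatMap⁻ (λ x → map (x ∷_) (lists≤ n q)) {xs = allFin n} F∈)
... | x , _ , F∈' with ∈-map⁻ (x ∷_) F∈'
... | F' , F'∈ , refl = s≤s (lists≤-length q F' F'∈)

length-cartesianProduct : ∀ {A B : Set} (xs : List A) (ys : List B) →
  length (cartesianProduct xs ys) ≡ length xs * length ys
length-cartesianProduct []       ys = refl
length-cartesianProduct (x ∷ xs) ys = trans (length-++ (map (x ,_) ys))
  (cong₂ _+_ (length-map (x ,_) ys) (length-cartesianProduct xs ys))

module _ {n m : ℕ} where

  open DecMem (Fin._≟_ {n}) using () renaming (_∈?_ to _∈ˡ?_)

  Blocked : Subset m → Family n m → Word n m → List (Fin n) → Set
  Blocked I X w F = ∀ w' → X w' ≡ true → w' ≈[ I ] w → ∃[ i ] i ∉ I × lookup w' i ∈ˡ F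

  Escape : Subset m → Family n m → Word n m → List (Fin n) → Word n m → Set
  Escape I X w F w' = X w' ≡ true × w' ≈[ I ] w × (∀ i → i ∉ I → lookup w' i ∉ˡ F)

  escape? : ∀ I X w F → Dec (∃ (Escape I X w F))
  escape? I X w F = ∃-dec (words n m) ∈-words (λ w' → (X w' Bool.≟ true) ×-dec (≈-dec w' I w ×-dec
    Fin.all? (λ i → ¬? (i ∈? I) →-dec ¬? (lookup w' i ∈ˡ? F))))

  ¬escape⇒blocked : ∀ {I X w F} → ¬ ∃ (Escape I X w F) → Blocked I X w F
  ¬escape⇒blocked {I} {X} {w} {F} ¬esc w' Xw' eq
    with Fin.any? (λ i → ¬? (i ∈? I) ×-dec (lookup w' i ∈ˡ? F))
  ... | yes hit = hit
  ... | no ¬hit = ⊥-elim (¬esc (w' , Xw' , eq , λ i i∉ ∈F → ¬hit (i , i∉ , ∈F)))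

  flexible-or-blocked : ∀ q (J : List (Subset m)) (X : Family n m) →
    (∀ I → I ∈ˡ J → Flexible q I X) ⊎
    (∃[ I ] ∃[ w ] ∃[ F ] I ∈ˡ J × X w ≡ true × length F ≤ q × Blocked I X w F)
  flexible-or-blocked q J X
    with any? (λ I → any? (λ w → (X w Bool.≟ true) ×-dec any? (λ F → ¬? (escape? I X w F)) (lists≤ n q))
                          (words n m)) J
  ... | yes found =
        let I , I∈ , found₁ = Mem.find found
            w , _ , Xw , found₂ = Mem.find found₁
            F , F∈ , ¬esc = Mem.find found₂
        in inj₂ (I , w , F , I∈ , Xw , lists≤-length q F F∈ , ¬escape⇒blocked {I} {X} {w} {F} ¬esc)
  ... | no ¬found = inj₁ λ I I∈ w Xw F F≤ → decidable-stable (escape? I X w F) λ ¬esc →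
        ¬found (Mem.lose I∈ (Mem.lose (∈-words w) (Xw , Mem.lose (∈-lists≤ q F F≤) ¬esc)))

  -- Fixing the most popular position and letter leaves words that pairwise agree somewhere off I.
  hit-class : ∀ q {I} {F : List (Fin n)} (K : Family n m) → length F ≤ q →
    (∀ w → K w ≡ true → ∃[ i ] i ∉ I × lookup w i ∈ˡ F) →
    ∃[ Y ] (∀ w → Y w ≡ true → K w ≡ true) ×
           (∀ w w' → Y w ≡ true → Y w' ≡ true → agree w w' ≢ I) × count K ≤ m * q * count Y
  hit-class q {I} {F} K F≤ hit = finish (∑-maximal pairs (λ (i , f) → count (sub i f)))
    where
    pairs = cartesianProduct (allFin m) F
    sub : Fin m → Fin n → Family n m
    sub i f w = K w ∧ (not (does (i ∈? I)) ∧ does (lookup w i Fin.≟ f))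
    cover : count K ≤ ∑ pairs (λ (i , f) → count (sub i f))
    cover = ≤-trans
      (∑-mono (words n m) {𝟙 ∘ K} {λ w → ∑ pairs (λ (i , f) → 𝟙 (sub i f w))} pointwise)
      (≤-reflexive (∑-swap (words n m) pairs _))
      where
      pointwise : ∀ w → 𝟙 (K w) ≤ ∑ pairs (λ (i , f) → 𝟙 (sub i f w))
      pointwise w with K w in Kw
      ... | false = z≤n
      ... | true with hit w Kw
      ... | i , i∉ , f∈ = ≤-trans
        (𝟙-true (∧-true (not-true (i ∈? I) i∉) (does-true (lookup w i Fin.≟ lookup w i) refl)))
        (∑-term {f = λ (i , f) → 𝟙 (not (does (i ∈? I)) ∧ does (lookup w i Fin.≟ f))}
                (∈-cartesianProduct⁺ (∈-allFin i) f∈))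
    finish : ∑ pairs (λ (i , f) → count (sub i f)) ≡ 0 ⊎
      (∃[ p ] p ∈ˡ pairs × ∑ pairs (λ (i , f) → count (sub i f)) ≤ length pairs * count (sub (proj₁ p) (proj₂ p))) → _
    finish (inj₁ eq) = (λ _ → false) , (λ _ ()) , (λ _ _ ()) , ≤-trans cover (≤-trans (≤-reflexive eq) z≤n)
    finish (inj₂ ((i , f) , _ , le)) = sub i f , (λ w Yw → proj₁ (∧-true⁻ Yw)) , distinct ,
      ≤-trans cover (≤-trans le (*-monoˡ-≤ (count (sub i f)) length≤))
      where
      distinct : ∀ w w' → sub i f w ≡ true → sub i f w' ≡ true → agree w w' ≢ I
      distinct w w' Yw Yw' refl with ∧-true⁻ {not (does (i ∈? I))} (proj₂ (∧-true⁻ {K w} Yw)) | ∧-true⁻ {not (does (i ∈? I))} (proj₂ (∧-true⁻ {K w'} Yw'))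
      ... | i∉ , e | _ , e' = does-false⁻ (i ∈? I) i∉
        (∈-agree⁺ w w' (trans (does-true⁻ (_ Fin.≟ _) e) (sym (does-true⁻ (_ Fin.≟ _) e'))))
      length≤ : length pairs ≤ m * q
      length≤ = ≤-trans (≤-reflexive (trans (length-cartesianProduct (allFin m) F)
        (cong (_* length F) (length-allFin m)))) (*-monoʳ-≤ m F≤)

  -- Deleting the words that obstruct flexibility leaves `core`. From each class deleted on account
  -- of `I`, the family `sel I` keeps at least a 1/(m q) part in which `I` has ceased to be an
  -- agreement set.
  record Cleaned (q : ℕ) (J : List (Subset m)) (X : Family n m) : Set where
    field
      core      : Family n m
      core⊆     : ∀ w → core w ≡ true → X w ≡ true
      flexible  : ∀ I → I ∈ˡ J → Flexible q I core
      sel       : Subset m → Family n m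
      sel⊆      : ∀ I w → sel I w ≡ true → X w ≡ true
      sel-agree : ∀ I w w' → sel I w ≡ true → sel I w' ≡ true → agree w w' ≢ I
      bound     : count X ≤ count core + m * q * ∑ J (λ I → count (sel I))

  -- A failure of flexibility at `I` removes every word that agrees with `w₀` on `I`. Two words of
  -- `sel I` from different rounds therefore differ somewhere on `I`, and two from the same round
  -- agree somewhere off `I`; in neither case is `I` the agreement set. Each round removes `w₀`
  -- itself, so the process ends.
  clean : ∀ q J (X : Family n m) → Acc _<_ (count X) → Cleaned q J X
  clean q J X (acc rs) with flexible-or-blocked q J X
  ... | inj₁ flex = record
    { core = X ; core⊆ = λ _ p → p ; flexible = flex
    ; sel = λ _ _ → false ; sel⊆ = λ _ _ () ; sel-agree = λ _ _ _ ()
    ; bound = m≤m+n _ _ }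
  ... | inj₂ (I , w₀ , F , I∈ , Xw₀ , F≤ , blocked) = record
    { core = core ; core⊆ = λ w p → proj₁ (∧-true⁻ (core⊆ w p)) ; flexible = flexible
    ; sel = sel' ; sel⊆ = sel'⊆ ; sel-agree = sel'-agree ; bound = bound' }
    where
    near : Family n m
    near w = does (≈-dec w I w₀)
    K X' : Family n m
    K w  = X w ∧ near w
    X' w = X w ∧ not (near w)
    Kw₀ : K w₀ ≡ true
    Kw₀ = ∧-true Xw₀ (does-true (≈-dec w₀ I w₀) (λ _ _ → refl))
    smaller : count X' < count X
    smaller = ≤-trans (+-monoˡ-≤ (count X') (count-pos {X = K} Kw₀)) (≤-reflexive (sym (count-split X near)))
    open Cleaned (clean q J X' (rs smaller))
    best = hit-class q {I} {F} K F≤ (λ w Kw → blocked w (proj₁ (∧-true⁻ Kw)) (does-true⁻ (≈-dec w I w₀) (proj₂ (∧-true⁻ {X w} Kw))))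
    Y = proj₁ best
    Y⊆ = proj₁ (proj₂ best)
    Y-agree = proj₁ (proj₂ (proj₂ best))
    Y-bound = proj₂ (proj₂ (proj₂ best))
    sel' : Subset m → Family n m
    sel' I' w = sel I' w ∨ (does (I' ≟ˢ I) ∧ Y w)
    sel'⊆ : ∀ I' w → sel' I' w ≡ true → X w ≡ true
    sel'⊆ I' w p with ∨-true⁻ p
    ... | inj₁ s = proj₁ (∧-true⁻ (sel⊆ I' w s))
    ... | inj₂ s = proj₁ (∧-true⁻ (Y⊆ w (proj₂ (∧-true⁻ {does (I' ≟ˢ I)} s))))
    cross : ∀ w w' → sel I w ≡ true → Y w' ≡ true → ¬ (w ≈[ I ] w')
    cross w w' s y eq = does-false⁻ (≈-dec w I w₀) (proj₂ (∧-true⁻ {X w} (sel⊆ I w s)))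
      (λ i i∈ → trans (eq i i∈) (does-true⁻ (≈-dec w' I w₀) (proj₂ (∧-true⁻ {X w'} (Y⊆ w' y))) i i∈))
    sel'-agree : ∀ I' w w' → sel' I' w ≡ true → sel' I' w' ≡ true → agree w w' ≢ I'
    sel'-agree I' w w' p p' eq with ∨-true⁻ p | ∨-true⁻ p'
    ... | inj₁ s | inj₁ s' = sel-agree I' w w' s s' eq
    ... | inj₁ s | inj₂ y with ∧-true⁻ {does (I' ≟ˢ I)} y
    ...   | e , y' with does-true⁻ (I' ≟ˢ I) e
    ...   | refl = cross w w' s y' (λ i i∈ → ∈-agree⁻ w w' (subst (i ∈_) (sym eq) i∈))
    sel'-agree I' w w' p p' eq | inj₂ y | inj₁ s with ∧-true⁻ {does (I' ≟ˢ I)} y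
    ...   | e , y' with does-true⁻ (I' ≟ˢ I) e
    ...   | refl = cross w' w s y' (λ i i∈ → sym (∈-agree⁻ w w' (subst (i ∈_) (sym eq) i∈)))
    sel'-agree I' w w' p p' eq | inj₂ y | inj₂ y' with ∧-true⁻ {does (I' ≟ˢ I)} y | ∧-true⁻ {does (I' ≟ˢ I)} y'
    ...   | e , z | _ , z' = Y-agree w w' z z' (trans eq (does-true⁻ (I' ≟ˢ I) e))
    sel'-count : ∀ I' → count (sel I') + 𝟙 (does (I' ≟ˢ I)) * count Y ≤ count (sel' I')
    sel'-count I' with I' ≟ˢ I
    ... | no _ = ≤-trans (≤-reflexive (+-identityʳ _)) (count-mono {X = sel I'} {Y = λ w → sel I' w ∨ false} (λ w p → cong (_∨ false) p))
    ... | yes refl = ≤-trans (≤-reflexive (cong (count (sel I') +_) (*-identityˡ (count Y))))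
      (≤-trans (≤-reflexive (sym (∑-+ (words n m) _ _))) (∑-mono (words n m) pt))
      where
      pt : ∀ w → 𝟙 (sel I' w) + 𝟙 (Y w) ≤ 𝟙 (sel I' w ∨ Y w)
      pt w with sel I' w in s | Y w in y
      ... | false | false = z≤n
      ... | false | true  = ≤-refl
      ... | true  | false = ≤-refl
      ... | true  | true  = ⊥-elim (cross w w s y (λ _ _ → refl))
    total : count Y + ∑ J (λ I' → count (sel I')) ≤ ∑ J (λ I' → count (sel' I'))
    total = ≤-trans (≤-reflexive (+-comm (count Y) _)) (≤-trans
      (+-monoʳ-≤ _ (≤-trans (≤-reflexive (sym (trans (cong (λ b → 𝟙 b * count Y) (does-true (I ≟ˢ I) refl)) (*-identityˡ (count Y)))))
        (∑-term {f = λ I' → 𝟙 (does (I' ≟ˢ I)) * count Y} I∈)))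
      (≤-trans (≤-reflexive (sym (∑-+ J _ _))) (∑-mono J sel'-count)))
    bound' : count X ≤ count core + m * q * ∑ J (λ I' → count (sel' I'))
    bound' = begin
      count X                                              ≡⟨ count-split X near ⟩
      count K + count X'                                   ≤⟨ +-mono-≤ Y-bound bound ⟩
      m * q * count Y + (count core + m * q * ∑ J (λ I' → count (sel I')))
                                                           ≡⟨ rearr (m * q) (count Y) (count core) (∑ J (λ I' → count (sel I'))) ⟩
      count core + m * q * (count Y + ∑ J (λ I' → count (sel I')))
                                                           ≤⟨ +-monoʳ-≤ (count core) (*-monoʳ-≤ (m * q) total) ⟩
      count core + m * q * ∑ J (λ I' → count (sel' I'))    ∎
      where
      open ≤-Reasoning
      rearr : ∀ k y c s → k * y + (c + k * s) ≡ c + k * (y + s)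
      rearr = solve-∀

  record Homogeneous (q : ℕ) (X : Family n m) (C : ℕ) : Set where
    field
      J        : List (Subset m)
      core     : Family n m
      core⊆    : ∀ w → core w ≡ true → X w ≡ true
      agree∈   : ∀ w w' → core w ≡ true → core w' ≡ true → agree w w' ∈ˡ J
      flexible : ∀ I → I ∈ˡ J → Flexible q I core
      bound    : count X ≤ C * count core

-- The summand 2 covers the case that `core` keeps half of the family. Otherwise the deleted half is
-- charged, with loss m q, to at most `suc ℓ` families `sel I`, and the largest of them enters the
-- recursion.
furedi : ℕ → ℕ → ℕ → ℕ
furedi m q zero    = 1
furedi m q (suc ℓ) = 2 + 2 * (m * q * suc ℓ * furedi m q ℓ)

-- Induction on the number of agreement sets still possible: `I` does not occur in `sel I` and is
-- struck off the list. With an empty list the family is empty, since every word has an agreement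
-- set with itself.
homogeneous-within : ∀ {n m} q ℓ (J : List (Subset m)) (X : Family n m) → length J ≤ ℓ →
  (∀ w w' → X w ≡ true → X w' ≡ true → agree w w' ∈ˡ J) → Homogeneous q X (furedi m q ℓ)
homogeneous-within q zero [] X _ agr = record
  { J = [] ; core = X ; core⊆ = λ _ p → p ; agree∈ = agr ; flexible = λ _ () ; bound = ≤-reflexive (sym (*-identityˡ _)) }
homogeneous-within {n} {m} q (suc ℓ) J X J≤ agr = result
  where
  cl : Cleaned q J X
  cl = clean q J X (<-wellFounded _)
  module C = Cleaned cl
  total : ℕ
  total = ∑ J (λ I → count (C.sel I))
  keep : count X ≤ 2 * count C.core → Homogeneous q X (furedi m q (suc ℓ))
  keep le = record
    { J = J ; core = C.core ; core⊆ = C.core⊆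
    ; agree∈ = λ w w' p p' → agr w w' (C.core⊆ w p) (C.core⊆ w' p')
    ; flexible = C.flexible
    ; bound = ≤-trans le (*-monoˡ-≤ (count C.core) {2} {furedi m q (suc ℓ)} (m≤m+n 2 _)) }
  descend : ∀ I → I ∈ˡ J → count X ≤ 2 * (m * q * (suc ℓ * count (C.sel I))) → Homogeneous q X (furedi m q (suc ℓ))
  descend I I∈ le = record
    { J = J* ; core = core* ; core⊆ = λ w p → C.sel⊆ I w (core*⊆ w p)
    ; agree∈ = agree* ; flexible = flexible*
    ; bound = ≤-trans le (≤-trans (*-monoʳ-≤ 2 (*-monoʳ-≤ (m * q) (*-monoʳ-≤ (suc ℓ) bound*)))
        (≤-trans (≤-reflexive (rearr (m * q) (suc ℓ) (furedi m q ℓ) (count core*)))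
          (*-monoˡ-≤ (count core*) {2 * (m * q * suc ℓ * furedi m q ℓ)} {furedi m q (suc ℓ)} (m≤n+m _ 2)))) }
    where
    J' : List (Subset m)
    J' = filter (λ I' → ¬? (I' ≟ˢ I)) J
    J'≤ : length J' ≤ ℓ
    J'≤ = ≤-pred (≤-trans (filter-notAll (λ I' → ¬? (I' ≟ˢ I)) J (Mem.lose I∈ (λ ne → ne refl))) J≤)
    open Homogeneous (homogeneous-within q ℓ J' (C.sel I) J'≤
      (λ w w' p p' → ∈-filter⁺ (λ I' → ¬? (I' ≟ˢ I)) (agr w w' (C.sel⊆ I w p) (C.sel⊆ I w' p')) (C.sel-agree I w w' p p')))
      renaming (J to J*; core to core*; core⊆ to core*⊆; agree∈ to agree*; flexible to flexible*; bound to bound*)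
    rearr : ∀ k l f c → 2 * (k * (l * (f * c))) ≡ 2 * (k * l * f) * c
    rearr = solve-∀
  double : ∀ {x y z} → x ≤ y + z → z ≤ y → x ≤ 2 * y
  double {y = y} le le' = ≤-trans le (+-monoʳ-≤ y (≤-trans le' (≤-reflexive (sym (+-identityʳ y)))))
  result : Homogeneous q X (furedi m q (suc ℓ))
  result with m * q * total ≤? count C.core
  ... | yes le = keep (double C.bound le)
  ... | no ¬le with ∑-maximal J (λ I → count (C.sel I))
  ...   | inj₁ eq = ⊥-elim (¬le (≤-trans (≤-reflexive (trans (cong (m * q *_) eq) (*-zeroʳ (m * q)))) z≤n))
  ...   | inj₂ (I , I∈ , le) = descend I I∈ (≤-trans
            (double (≤-trans C.bound (≤-reflexive (+-comm (count C.core) _))) (<⇒≤ (≰⇒> ¬le)))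
            (*-monoʳ-≤ 2 (*-monoʳ-≤ (m * q) (≤-trans le (*-monoˡ-≤ (count (C.sel I)) J≤)))))

homogeneous : ∀ {n m} q (X : Family n m) → Homogeneous q X (furedi m q (2 ^ m))
homogeneous {n} {m} q X = homogeneous-within q (2 ^ m) (tuples (true ∷ false ∷ []) m) X
  (≤-reflexive (length-tuples (true ∷ false ∷ []) m))
  (λ w w' _ _ → ∈-tuples (agree w w') (λ i → ∈-bools (lookup (agree w w') i)))

-- Families determined by few positions, and the algebra of kernels.

∑-at-most-one : ∀ {A : Set} {xs : List A} → Unique xs → (f : A → Bool) (b : Bool) →
  (∀ x y → f x ≡ true → f y ≡ true → x ≡ y) → (∀ x → f x ≡ true → b ≡ true) → ∑ xs (𝟙 ∘ f) ≤ 𝟙 b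
∑-at-most-one []            f b _   _  = z≤n
∑-at-most-one {xs = x ∷ xs} (x∉ ∷ u) f b one ∃b with f x in fx
... | false = ∑-at-most-one u f b one ∃b
... | true = ≤-trans (≤-reflexive (cong suc ∑0)) (𝟙-true (∃b x fx))
  where
  none : ∀ y → y ∈ˡ xs → 𝟙 (f y) ≤ 0
  none y y∈ with f y in fy
  ... | false = z≤n
  ... | true  = ⊥-elim (All.lookup x∉ y∈ (one x y fx fy))
  ∑0 : ∑ xs (𝟙 ∘ f) ≡ 0
  ∑0 = n≤0⇒n≡0 (≤-trans (∑-bound xs none) (≤-reflexive (*-zeroʳ (length xs))))

count-determined : ∀ {n m} (I : Subset m) (X : Family n m) →
  (∀ w w' → X w ≡ true → X w' ≡ true → w ≈[ I ] w' → w ≡ w') → count X ≤ n ^ ∣ I ∣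
count-determined []          X det = count-≤ X
count-determined {n} (true ∷ I) X det = begin
  count X                                           ≡⟨ count-suc X ⟩
  ∑ (allFin n) (λ x → count (λ w → X (x ∷ w)))       ≤⟨ ∑-bound (allFin n) (λ x _ → count-determined I (λ w → X (x ∷ w)) (det' x)) ⟩
  length (allFin n) * n ^ ∣ I ∣                     ≡⟨ cong (_* n ^ ∣ I ∣) (length-allFin n) ⟩
  n * n ^ ∣ I ∣                                     ∎
  where
  open ≤-Reasoning
  det' : ∀ x w w' → X (x ∷ w) ≡ true → X (x ∷ w') ≡ true → w ≈[ I ] w' → w ≡ w'
  det' x w w' p p' eq with det (x ∷ w) (x ∷ w') p p' (λ { zero _ → refl ; (suc i) i∈ → eq i (drop-there i∈) })
  ... | refl = refl
count-determined {n} {suc m} (false ∷ I) X det = begin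
  count X                                                   ≡⟨ count-suc X ⟩
  ∑ (allFin n) (λ x → ∑ (words n m) (λ w → 𝟙 (X (x ∷ w))))   ≡⟨ ∑-swap (allFin n) (words n m) _ ⟩
  ∑ (words n m) (λ w → ∑ (allFin n) (λ x → 𝟙 (X (x ∷ w))))   ≤⟨ ∑-mono (words n m) pointwise ⟩
  count X'                                                  ≤⟨ count-determined I X' det' ⟩
  n ^ ∣ I ∣                                                 ∎
  where
  open ≤-Reasoning
  extends? : ∀ w → Dec (∃ λ x → X (x ∷ w) ≡ true)
  extends? w = Fin.any? (λ x → X (x ∷ w) Bool.≟ true)
  X' : Family n m
  X' w = does (extends? w)
  det-cons : ∀ {x x' w w'} → X (x ∷ w) ≡ true → X (x' ∷ w') ≡ true → w ≈[ I ] w' → x ∷ w ≡ x' ∷ w'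
  det-cons p p' eq = det _ _ p p' (λ { zero () ; (suc i) i∈ → eq i (drop-there i∈) })
  pointwise : ∀ w → ∑ (allFin n) (λ x → 𝟙 (X (x ∷ w))) ≤ 𝟙 (X' w)
  pointwise w = ∑-at-most-one (Unique.allFin⁺ n) (λ x → X (x ∷ w)) (X' w)
    (λ x y p p' → cong Data.Vec.head (det-cons p p' (λ _ _ → refl)))
    (λ x p → does-true (extends? w) (x , p))
  det' : ∀ w w' → X' w ≡ true → X' w' ≡ true → w ≈[ I ] w' → w ≡ w'
  det' w w' p p' eq = cong Data.Vec.tail
    (det-cons (proj₂ (does-true⁻ (extends? w) p)) (proj₂ (does-true⁻ (extends? w') p')) eq)

not-determined : ∀ {n m} (I : Subset m) (X : Family n m) → n ^ ∣ I ∣ < count X →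
  ∃[ w ] ∃[ w' ] X w ≡ true × X w' ≡ true × w ≈[ I ] w' × w ≢ w'
not-determined {n} {m} I X large = decidable-stable pair? λ ¬pair →
  <⇒≱ large (count-determined I X (λ w w' p p' eq → decidable-stable (≡-dec Fin._≟_ w w')
    (λ ne → ¬pair (w , w' , p , p' , eq , ne))))
  where
  pair? = ∃-dec (words n m) ∈-words (λ w → ∃-dec (words n m) ∈-words (λ w' →
    (X w Bool.≟ true) ×-dec ((X w' Bool.≟ true) ×-dec (≈-dec w I w' ×-dec ¬? (≡-dec Fin._≟_ w w')))))

inhabited⇒nonZero : ∀ {n} → Fin n → NonZero n
inhabited⇒nonZero {suc _} _ = _

lookup-ext : ∀ {n m} {w w' : Word n m} → (∀ i → lookup w i ≡ lookup w' i) → w ≡ w'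
lookup-ext {w = []}    {[]}      eq = refl
lookup-ext {w = x ∷ w} {y ∷ w'} eq = cong₂ _∷_ (eq zero) (lookup-ext (eq ∘ suc))

lookup∈toList : ∀ {n m} (w : Word n m) i → lookup w i ∈ˡ toList w
lookup∈toList (x ∷ w) zero    = here refl
lookup∈toList (x ∷ w) (suc i) = there (lookup∈toList w i)

module Kernels {n m q C : ℕ} {X : Family n m} (hom : Homogeneous q X C)
               (m≤q : m ≤ q) (w₀ : Word n m) (w₀∈ : Homogeneous.core hom w₀ ≡ true) where

  open Homogeneous hom

  ⊤∈J : ⊤ ∈ˡ J
  ⊤∈J = subst (_∈ˡ J) (agree-refl w₀) (agree∈ w₀ w₀ w₀∈ w₀∈)

  -- Replace the letters of `w₀` off `I₁`, then those of the result off `I₂`, both times avoiding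
  -- all letters of `w₀`. The final word agrees with `w₀` exactly on the intersection.
  ∩∈J : ∀ {I₁ I₂} → I₁ ∈ˡ J → I₂ ∈ˡ J → I₁ ∩ I₂ ∈ˡ J
  ∩∈J {I₁} {I₂} I₁∈ I₂∈
    with flexible I₁ I₁∈ w₀ w₀∈ (toList w₀) (≤-trans (≤-reflexive (length-toList w₀)) m≤q)
  ... | w₁ , w₁∈ , eq₁ , off₁
    with flexible I₂ I₂∈ w₁ w₁∈ (toList w₀) (≤-trans (≤-reflexive (length-toList w₀)) m≤q)
  ... | w₂ , w₂∈ , eq₂ , off₂ = subst (_∈ˡ J) (⊆-antisym fwd bwd) (agree∈ w₀ w₂ w₀∈ w₂∈)
    where
    fwd : agree w₀ w₂ ⊆ I₁ ∩ I₂
    fwd {i} i∈ with i ∈? I₂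
    ... | no i∉ = ⊥-elim (off₂ i i∉ (subst (_∈ˡ toList w₀) (∈-agree⁻ w₀ w₂ i∈) (lookup∈toList w₀ i)))
    ... | yes i∈₂ with i ∈? I₁
    ...   | yes i∈₁ = x∈p∩q⁺ (i∈₁ , i∈₂)
    ...   | no i∉ = ⊥-elim (off₁ i i∉ (subst (_∈ˡ toList w₀) (trans (∈-agree⁻ w₀ w₂ i∈) (eq₂ i i∈₂)) (lookup∈toList w₀ i)))
    bwd : I₁ ∩ I₂ ⊆ agree w₀ w₂
    bwd {i} i∈ with x∈p∩q⁻ I₁ I₂ i∈
    ... | i∈₁ , i∈₂ = ∈-agree⁺ w₀ w₂ (sym (trans (eq₂ i i∈₂) (eq₁ i i∈₁)))

  -- The separating kernels, one for each position off `I`, intersect in exactly `I`. The empty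
  -- intersection is `⊤`, a kernel because a word agrees with itself.
  meet∈J : ∀ I → (∀ x → x ∉ I → ∃[ K ] K ∈ˡ J × I ⊆ K × x ∉ K) → I ∈ˡ J
  meet∈J I sep with go (allFin m)
    where
    go : ∀ xs → ∃[ K ] K ∈ˡ J × I ⊆ K × (∀ x → x ∈ˡ xs → x ∉ I → x ∉ K)
    go [] = ⊤ , ⊤∈J , (λ _ → ∈⊤) , (λ _ ())
    go (x ∷ xs) with go xs | x ∈? I
    ... | K , K∈ , I⊆K , out | yes x∈ = K , K∈ , I⊆K ,
          (λ { y (here refl) y∉ → ⊥-elim (y∉ x∈) ; y (there y∈) → out y y∈ })
    ... | K , K∈ , I⊆K , out | no x∉ with sep x x∉
    ... | K' , K'∈ , I⊆K' , x∉K' = K ∩ K' , ∩∈J K∈ K'∈ , (λ i∈ → x∈p∩q⁺ (I⊆K i∈ , I⊆K' i∈)) ,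
          (λ { y (here refl) _ y∈ → x∉K' (proj₂ (x∈p∩q⁻ K K' y∈))
             ; y (there y∈xs) y∉ y∈ → out y y∈xs y∉ (proj₁ (x∈p∩q⁻ K K' y∈)) })
  ... | K , K∈ , I⊆K , out = subst (_∈ˡ J) (⊆-antisym (λ {x} x∈K → decidable-stable (x ∈? I)
          (λ x∉ → out x (∈-allFin x) x∉ x∈K)) I⊆K) K∈

  -- By counting, two distinct words of the core agree on `I`; `K` is their agreement set.
  cover : ∀ I → n ^ ∣ I ∣ < count core → ∃[ K ] K ∈ˡ J × I ⊆ K × ∃[ x ] x ∉ K
  cover I large with not-determined I core large
  ... | w , w' , p , p' , eq , ne = agree w w' , agree∈ w w' p p' , (λ {i} i∈ → ∈-agree⁺ w w' (eq i i∈)) , missing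
    where
    missing : ∃[ x ] x ∉ agree w w'
    missing = decidable-stable (Fin.any? (λ x → ¬? (x ∈? agree w w'))) λ none →
      ne (lookup-ext (λ i → decidable-stable (_ Fin.≟ _) (λ ne' → none (i , ne' ∘ ∈-agree⁻ w w'))))

-- Embedding blowups of trees

∣p∪q∣+∣p∩q∣ : ∀ {n} (p q : Subset n) → ∣ p ∪ q ∣ + ∣ p ∩ q ∣ ≡ ∣ p ∣ + ∣ q ∣
∣p∪q∣+∣p∩q∣ []          []          = refl
∣p∪q∣+∣p∩q∣ (true ∷ p)  (true ∷ q)  = cong suc (trans (+-suc _ _) (trans (cong suc (∣p∪q∣+∣p∩q∣ p q)) (sym (+-suc _ _))))
∣p∪q∣+∣p∩q∣ (true ∷ p)  (false ∷ q) = cong suc (∣p∪q∣+∣p∩q∣ p q)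
∣p∪q∣+∣p∩q∣ (false ∷ p) (true ∷ q)  = trans (cong suc (∣p∪q∣+∣p∩q∣ p q)) (sym (+-suc _ _))
∣p∪q∣+∣p∩q∣ (false ∷ p) (false ∷ q) = ∣p∪q∣+∣p∩q∣ p q

∣p∪q∣≤ : ∀ {n} (p q : Subset n) → ∣ p ∪ q ∣ ≤ ∣ p ∣ + ∣ q ∣
∣p∪q∣≤ p q = ≤-trans (m≤m+n _ ∣ p ∩ q ∣) (≤-reflexive (∣p∪q∣+∣p∩q∣ p q))

∣p∣≡0⇒Empty : ∀ {n} {p : Subset n} → ∣ p ∣ ≡ 0 → Empty p
∣p∣≡0⇒Empty {p = p} p≡0 (x , x∈) = <⇒≢ (≤-<-trans z≤n (x∈p⇒∣p-x∣<∣p∣ x∈)) (sym p≡0)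

-- Words with repeated letters never have to be excluded by hand: the uniformity of `E` turns the
-- trivial upper bounds for images into exact sizes and disjointness.
tight-union : ∀ {n} (p q : Subset n) {a b} → ∣ p ∪ q ∣ ≡ a + b → ∣ p ∣ ≤ a → ∣ q ∣ ≤ b →
  ∣ p ∣ ≡ a × ∣ q ∣ ≡ b × Empty (p ∩ q)
tight-union p q {a} {b} size p≤ q≤ = p≡ , q≡ , ∣p∣≡0⇒Empty empty
  where
  sum≥ : a + b ≤ ∣ p ∣ + ∣ q ∣
  sum≥ = ≤-trans (≤-reflexive (sym size)) (∣p∪q∣≤ p q)
  p≡ : ∣ p ∣ ≡ a
  p≡ = ≤-antisym p≤ (+-cancelʳ-≤ b a ∣ p ∣ (≤-trans sum≥ (+-monoʳ-≤ ∣ p ∣ q≤)))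
  q≡ : ∣ q ∣ ≡ b
  q≡ = ≤-antisym q≤ (+-cancelˡ-≤ a b ∣ q ∣ (≤-trans sum≥ (+-monoˡ-≤ ∣ q ∣ p≤)))
  empty : ∣ p ∩ q ∣ ≡ 0
  empty = +-cancelˡ-≡ (a + b) _ 0 (trans (cong (_+ ∣ p ∩ q ∣) (sym size))
    (trans (∣p∪q∣+∣p∩q∣ p q) (trans (cong₂ _+_ p≡ q≡) (sym (+-identityʳ (a + b))))))

image : ∀ {n m} → Word n m → Subset m → Subset n
image []      []          = ⊥
image (x ∷ w) (true ∷ I)  = ⁅ x ⁆ ∪ image w I
image (x ∷ w) (false ∷ I) = image w I

∈-image⁺ : ∀ {n m} (w : Word n m) {I i} → i ∈ I → lookup w i ∈ image w I
∈-image⁺ (x ∷ w) {true ∷ I}  Data.Vec.here      = x∈p∪q⁺ (inj₁ (x∈⁅x⁆ x))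
∈-image⁺ (x ∷ w) {true ∷ I}  (Data.Vec.there i∈) = x∈p∪q⁺ (inj₂ (∈-image⁺ w i∈))
∈-image⁺ (x ∷ w) {false ∷ I} (Data.Vec.there i∈) = ∈-image⁺ w i∈

∈-image⁻ : ∀ {n m} (w : Word n m) I {v} → v ∈ image w I → ∃[ i ] i ∈ I × lookup w i ≡ v
∈-image⁻ []      []          v∈ = ⊥-elim (∉⊥ v∈)
∈-image⁻ (x ∷ w) (true ∷ I)  v∈ with x∈p∪q⁻ ⁅ x ⁆ (image w I) v∈
... | inj₁ v∈x = zero , Data.Vec.here , sym (x∈⁅y⁆⇒x≡y x v∈x)
... | inj₂ v∈' with ∈-image⁻ w I v∈'
...   | i , i∈ , eq = suc i , Data.Vec.there i∈ , eq
∈-image⁻ (x ∷ w) (false ∷ I) v∈ with ∈-image⁻ w I v∈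
... | i , i∈ , eq = suc i , Data.Vec.there i∈ , eq

image-cong : ∀ {n m} (w w' : Word n m) I → w ≈[ I ] w' → image w I ≡ image w' I
image-cong w w' I eq = ⊆-antisym
  (λ v∈ → let i , i∈ , e = ∈-image⁻ w I v∈ in subst (_∈ image w' I) (trans (sym (eq i i∈)) e) (∈-image⁺ w' i∈))
  (λ v∈ → let i , i∈ , e = ∈-image⁻ w' I v∈ in subst (_∈ image w I) (trans (eq i i∈) e) (∈-image⁺ w i∈))

∣image∣≤ : ∀ {n m} (w : Word n m) I → ∣ image w I ∣ ≤ ∣ I ∣
∣image∣≤ {n} []  []      = ≤-reflexive (∣⊥∣≡0 n)
∣image∣≤ (x ∷ w) (true ∷ I)  = ≤-trans (∣p∪q∣≤ ⁅ x ⁆ (image w I))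
  (+-mono-≤ (≤-reflexive (∣⁅x⁆∣≡1 x)) (∣image∣≤ w I))
∣image∣≤ (x ∷ w) (false ∷ I) = ∣image∣≤ w I

unique-length : ∀ {A : Set} {xs ys : List A} → Unique xs → (∀ x → x ∈ˡ xs → x ∈ˡ ys) → length xs ≤ length ys
unique-length []       _  = z≤n
unique-length {xs = x ∷ xs} (x∉ ∷ u) sub with ∈-∃++ (sub x (here refl))
... | ys₁ , ys₂ , refl = ≤-trans (s≤s (unique-length {ys = ys₁ ++ ys₂} u sub'))
        (≤-reflexive (trans (cong suc (length-++ ys₁)) (trans (sym (+-suc (length ys₁) _)) (sym (length-++ ys₁)))))
  where
  sub' : ∀ y → y ∈ˡ xs → y ∈ˡ ys₁ ++ ys₂
  sub' y y∈ with ∈-++⁻ ys₁ (sub y (there y∈))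
  ... | inj₁ y∈₁         = ∈-++⁺ˡ y∈₁
  ... | inj₂ (here refl) = ⊥-elim (All.lookup x∉ y∈ refl)
  ... | inj₂ (there y∈₂) = ∈-++⁺ʳ ys₁ y∈₂

∉⇒All≢ : ∀ {A : Set} {x : A} {xs} → x ∉ˡ xs → All (x ≢_) xs
∉⇒All≢ {xs = xs} x∉ = All.tabulate (λ {y} y∈ eq → x∉ (subst (_∈ˡ xs) (sym eq) y∈))

module Tree {s t : ℕ} (T : BipGraph s t) (tree : IsTree T) where

  _≟ᵛ_ : (x y : Vert s t) → Dec (x ≡ y)
  _≟ᵛ_ = Sum.≡-dec Fin._≟_ Fin._≟_

  open DecMem _≟ᵛ_ public using () renaming (_∈?_ to _∈ᵛ?_)

  vertices : List (Vert s t)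
  vertices = map inj₁ (allFin s) ++ map inj₂ (allFin t)

  ∈-vertices : ∀ x → x ∈ˡ vertices
  ∈-vertices (inj₁ i) = ∈-++⁺ˡ (∈-map⁺ inj₁ (∈-allFin i))
  ∈-vertices (inj₂ j) = ∈-++⁺ʳ (map inj₁ (allFin s)) (∈-map⁺ inj₂ (∈-allFin j))

  length-vertices : length vertices ≡ s + t
  length-vertices = trans (length-++ (map inj₁ (allFin s))) (cong₂ _+_
    (trans (length-map inj₁ (allFin s)) (length-allFin s)) (trans (length-map inj₂ (allFin t)) (length-allFin t)))

  edgeList : List (Fin s × Fin t)
  edgeList = concatMap (λ i → map (i ,_) (filter (λ j → adj T i j Bool.≟ true) (allFin t))) (allFin s)

  length-edgeList : length edgeList ≡ edgeCount T
  length-edgeList = go (allFin s)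
    where
    go : ∀ is → length (concatMap (λ i → map (i ,_) (filter (λ j → adj T i j Bool.≟ true) (allFin t))) is)
              ≡ Data.Nat.ListAction.sum (map (λ i → countTrue (adj T i)) is)
    go []       = refl
    go (i ∷ is) = trans (length-++ (map (i ,_) (filter (λ j → adj T i j Bool.≟ true) (allFin t))))
      (cong₂ _+_ (length-map (i ,_) (filter (λ j → adj T i j Bool.≟ true) (allFin t))) (go is))

  ∈-edgeList : ∀ i j → adj T i j ≡ true → (i , j) ∈ˡ edgeList
  ∈-edgeList i j ij = ∈-concatMap⁺ (λ i → map (i ,_) (filter (λ j → adj T i j Bool.≟ true) (allFin t)))
    (Mem.lose (∈-allFin i) (∈-map⁺ (i ,_) (∈-filter⁺ (λ j → adj T i j Bool.≟ true) (∈-allFin j) ij)))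

  frontier : ∀ (P : List (Vert s t)) {x y} → Reach T x y → x ∈ˡ P → y ∉ˡ P →
    ∃[ p ] ∃[ z ] p ∈ˡ P × z ∉ˡ P × Adjacent T p z
  frontier P here x∈ y∉ = ⊥-elim (y∉ x∈)
  frontier P (step {y = z} xz zy) x∈ y∉ with z ∈ᵛ? P
  ... | yes z∈ = frontier P zy z∈ y∉
  ... | no z∉  = _ , z , x∈ , z∉ , xz

  module Embedding {n m} (W : Family n m) (A : Subset m) (B : Fin t → Subset m)
    (A∩B : ∀ j {i} → i ∈ A → i ∉ B j)
    (flexA : Flexible ((s + t) * m) A W) (flexB : ∀ j → Flexible ((s + t) * m) (B j) W) where

    pos : Vert s t → Subset m
    pos (inj₁ i) = A
    pos (inj₂ j) = B j

    flex : ∀ x → Flexible ((s + t) * m) (pos x) W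
    flex (inj₁ i) = flexA
    flex (inj₂ j) = flexB j

    pos-disjoint : ∀ {p z} → Adjacent T p z → ∀ {i} → i ∈ pos z → i ∉ pos p
    pos-disjoint (uv _ j _) i∈ i∈' = A∩B j i∈' i∈
    pos-disjoint (vu _ j _) i∈ i∈' = A∩B j i∈ i∈'

    -- The edge is carried by a single word that spells U_i at `A` and V_j at `B j`. In the
    -- construction it is the word of the end embedded later, which copies the letters of the
    -- earlier end on that end's kernel.
    Realised : (Vert s t → Word n m) → Fin s → Fin t → Set
    Realised emb i j = ∃[ w ] W w ≡ true × w ≈[ A ] emb (inj₁ i) × w ≈[ B j ] emb (inj₂ j)

    -- `P` lists the embedded vertices and `D` the tree edges along which the embedding grew. The
    -- invariant `sizes` lets the edge count of the tree show at the end that `D` contains every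
    -- edge.
    record State (P : List (Vert s t)) (D : List (Fin s × Fin t)) : Set where
      field
        emb    : Vert s t → Word n m
        emb∈   : ∀ x → x ∈ˡ P → W (emb x) ≡ true
        apart  : ∀ x y → x ∈ˡ P → y ∈ˡ P → x ≢ y → ∀ {i k} → i ∈ pos x → k ∈ pos y →
                 lookup (emb x) i ≢ lookup (emb y) k
        real   : ∀ i j → (i , j) ∈ˡ D → Realised emb i j
        within : ∀ i j → (i , j) ∈ˡ D → inj₁ i ∈ˡ P × inj₂ j ∈ˡ P × adj T i j ≡ true
        uniqP  : Unique P
        uniqD  : Unique D
        sizes  : length P ≡ suc (length D)

    pair : ∀ {p z} → Adjacent T p z → Fin s × Fin t
    pair (uv i j _) = i , j
    pair (vu i j _) = i , j

    -- Flexibility at the kernel of `p` gives a word that keeps the letters of `p` there and is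
    -- fresh elsewhere. The kernel of `z` is disjoint from that of `p`, so all letters it assigns to
    -- `z` are fresh, and the same word realises the edge.
    extend : ∀ {P D p z} → State P D → p ∈ˡ P → z ∉ˡ P → (pz : Adjacent T p z) → length P ≤ s + t →
      State (z ∷ P) (pair pz ∷ D)
    extend {P} {D} {p} {z} st p∈ z∉ pz P≤ = record
      { emb = emb' ; emb∈ = emb'∈ ; apart = apart' ; real = real' ; within = within'
      ; uniqP = ∉⇒All≢ z∉ ∷ uniqP
      ; uniqD = ∉⇒All≢ pair∉ ∷ uniqD
      ; sizes = cong suc sizes }
      where
      open State st
      -- All letters of all words placed so far, including those outside the kernels. Their number
      -- is the origin of the budget `(s + t) * m`.
      F : List (Fin n)
      F = concatMap (toList ∘ emb) P
      F≤ : length F ≤ (s + t) * m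
      F≤ = ≤-trans (≤-reflexive (length-F P)) (*-monoˡ-≤ m P≤)
        where
        length-F : ∀ Q → length (concatMap (toList ∘ emb) Q) ≡ length Q * m
        length-F []      = refl
        length-F (x ∷ Q) = trans (length-++ (toList (emb x))) (cong₂ _+_ (length-toList (emb x)) (length-F Q))
      new = flex p (emb p) (emb∈ p p∈) F F≤
      w = proj₁ new
      w∈ = proj₁ (proj₂ new)
      w≈ = proj₁ (proj₂ (proj₂ new))
      w-off = proj₂ (proj₂ (proj₂ new))
      emb' : Vert s t → Word n m
      emb' x with x ≟ᵛ z
      ... | yes _ = w
      ... | no _  = emb x
      emb'-new : emb' z ≡ w
      emb'-new with z ≟ᵛ z
      ... | yes _ = refl
      ... | no ne = ⊥-elim (ne refl)
      emb'-old : ∀ x → x ∈ˡ P → emb' x ≡ emb x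
      emb'-old x x∈ with x ≟ᵛ z
      ... | yes refl = ⊥-elim (z∉ x∈)
      ... | no _     = refl
      emb'∈ : ∀ x → x ∈ˡ (z ∷ P) → W (emb' x) ≡ true
      emb'∈ x (here refl) rewrite emb'-new = w∈
      emb'∈ x (there x∈) rewrite emb'-old x x∈ = emb∈ x x∈
      fresh : ∀ y → y ∈ˡ P → ∀ {i k} → i ∈ pos z → lookup w i ≢ lookup (emb y) k
      fresh y y∈ {i} {k} i∈ eq = w-off i (pos-disjoint pz i∈)
        (subst (_∈ˡ F) (sym eq) (∈-concatMap⁺ (toList ∘ emb) (Mem.lose y∈ (lookup∈toList (emb y) k))))
      apart' : ∀ x y → x ∈ˡ (z ∷ P) → y ∈ˡ (z ∷ P) → x ≢ y → ∀ {i k} → i ∈ pos x → k ∈ pos y →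
               lookup (emb' x) i ≢ lookup (emb' y) k
      apart' x y (here refl) (here refl) x≢y _ _ = ⊥-elim (x≢y refl)
      apart' x y (here refl) (there y∈) x≢y i∈ k∈ rewrite emb'-new | emb'-old y y∈ = fresh y y∈ i∈
      apart' x y (there x∈) (here refl) x≢y i∈ k∈ rewrite emb'-new | emb'-old x x∈ = fresh x x∈ k∈ ∘ sym
      apart' x y (there x∈) (there y∈) x≢y i∈ k∈ rewrite emb'-old x x∈ | emb'-old y y∈ = apart x y x∈ y∈ x≢y i∈ k∈
      real-old : ∀ i j → (i , j) ∈ˡ D → Realised emb' i j
      real-old i j ij rewrite emb'-old (inj₁ i) (proj₁ (within i j ij)) | emb'-old (inj₂ j) (proj₁ (proj₂ (within i j ij))) = real i j ij
      real' : ∀ i j → (i , j) ∈ˡ (pair pz ∷ D) → Realised emb' i j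
      real' i j (there ij) = real-old i j ij
      real' i j (here eq) = new-edge pz refl i j eq
        where
        new-edge : (pz' : Adjacent T p z) → pair pz' ≡ pair pz → ∀ i j → (i , j) ≡ pair pz → Realised emb' i j
        new-edge (uv i' j' _) e i j eq with trans eq (sym e)
        ... | refl rewrite emb'-new | emb'-old p p∈ = w , w∈ , w≈ , (λ _ _ → refl)
        new-edge (vu i' j' _) e i j eq with trans eq (sym e)
        ... | refl rewrite emb'-new | emb'-old p p∈ = w , w∈ , (λ _ _ → refl) , w≈
      ends : (pz' : Adjacent T p z) → ∀ i j → (i , j) ≡ pair pz' →
        inj₁ i ∈ˡ (z ∷ P) × inj₂ j ∈ˡ (z ∷ P) × adj T i j ≡ true
      ends (uv i' j' ij) i j refl = there p∈ , here refl , ij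
      ends (vu i' j' ij) i j refl = here refl , there p∈ , ij
      within' : ∀ i j → (i , j) ∈ˡ (pair pz ∷ D) → inj₁ i ∈ˡ (z ∷ P) × inj₂ j ∈ˡ (z ∷ P) × adj T i j ≡ true
      within' i j (here eq)  = ends pz i j eq
      within' i j (there ij) = let i∈ , j∈ , a = within i j ij in there i∈ , there j∈ , a
      pair∉ : pair pz ∉ˡ D
      pair∉ = go pz
        where
        go : (pz' : Adjacent T p z) → pair pz' ∉ˡ D
        go (uv i' j' _) ∈D = z∉ (proj₁ (proj₂ (within i' j' ∈D)))
        go (vu i' j' _) ∈D = z∉ (proj₁ (within i' j' ∈D))

    unique≤ : ∀ {P} → Unique P → length P ≤ s + t
    unique≤ u = ≤-trans (unique-length u (λ x _ → ∈-vertices x)) (≤-reflexive length-vertices)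

    grow : ∀ k {P D x} → State P D → x ∈ˡ P → length P + k ≡ s + t →
      ∃[ P' ] ∃[ D' ] State P' D' × length P' ≡ s + t
    grow zero {P} {D} st x∈ eq = P , D , st , trans (sym (+-identityʳ _)) eq
    grow (suc k) {P} {D} {x} st x∈ eq with any? (λ y → ¬? (y ∈ᵛ? P)) vertices
    ... | no all = ⊥-elim (<⇒≱ (≤-trans (m<m+n (length P) (s≤s z≤n)) (≤-reflexive eq))
          (≤-trans (≤-reflexive (sym length-vertices)) (unique-length vertices-unique
            (λ y y∈ → decidable-stable (y ∈ᵛ? P) (λ y∉ → all (Mem.lose y∈ y∉))))))
      where
      vertices-unique : Unique vertices
      vertices-unique = Unique.++⁺ (Unique.map⁺ Sum.inj₁-injective (Unique.allFin⁺ s))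
        (Unique.map⁺ Sum.inj₂-injective (Unique.allFin⁺ t)) clash
        where
        clash : ∀ {v} → ¬ (v ∈ˡ map inj₁ (allFin s) × v ∈ˡ map inj₂ (allFin t))
        clash (l , r) with ∈-map⁻ inj₁ l | ∈-map⁻ inj₂ r
        ... | _ , _ , refl | _ , _ , ()
    ... | yes found with Mem.find found
    ... | y , _ , y∉ with frontier P (proj₁ tree x y) x∈ y∉
    ... | p , z , p∈ , z∉ , pz = grow k (extend st p∈ z∉ pz (unique≤ (State.uniqP st))) (there x∈)
          (trans (sym (+-suc (length P) k)) eq)

    -- The s + t - 1 edges along which the embedding grew are all the edges of the tree.
    embedding : Vert s t → ∀ w₀ → W w₀ ≡ true → ∃[ emb ]
      (∀ x → W (emb x) ≡ true) ×
      (∀ x y → x ≢ y → ∀ {i k} → i ∈ pos x → k ∈ pos y → lookup (emb x) i ≢ lookup (emb y) k) ×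
      (∀ i j → adj T i j ≡ true → Realised emb i j)
    embedding x₀ w₀ w₀∈ with grow (s + t ∸ 1) {x₀ ∷ []} {[]} {x₀} start (here refl)
          (m+[n∸m]≡n (≤-trans (unique≤ {x₀ ∷ []} ([] ∷ [])) ≤-refl))
      where
      start : State (x₀ ∷ []) []
      start = record
        { emb = λ _ → w₀ ; emb∈ = λ _ _ → w₀∈
        ; apart = λ { x y (here refl) (here refl) x≢y → ⊥-elim (x≢y refl) }
        ; real = λ _ _ () ; within = λ _ _ () ; uniqP = [] ∷ [] ; uniqD = [] ; sizes = refl }
    ... | P , D , st , full = emb , (λ x → emb∈ x (covers x)) ,
          (λ x y → apart x y (covers x) (covers y)) , (λ i j ij → real i j (listed i j ij))
      where
      open State st
      covers : ∀ x → x ∈ˡ P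
      covers x = decidable-stable (x ∈ᵛ? P) λ x∉ →
        <⇒≱ (≤-reflexive (cong suc (sym full))) (unique≤ {x ∷ P} (∉⇒All≢ x∉ ∷ uniqP))
      open DecMem (Data.Product.Properties.≡-dec (Fin._≟_ {s}) (Fin._≟_ {t})) using () renaming (_∈?_ to _∈ᵉ?_)
      listed : ∀ i j → adj T i j ≡ true → (i , j) ∈ˡ D
      listed i j ij = decidable-stable ((i , j) ∈ᵉ? D) λ ij∉ →
        <⇒≱ (≤-reflexive (trans (cong (λ k → suc (k ∸ 1)) (trans (sym full) sizes)) refl))
          (≤-trans (unique-length {xs = (i , j) ∷ D} (∉⇒All≢ ij∉ ∷ uniqD) sub)
            (≤-reflexive (trans length-edgeList (proj₂ tree))))
        where
        sub : ∀ e → e ∈ˡ ((i , j) ∷ D) → e ∈ˡ edgeList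
        sub _ (here refl) = ∈-edgeList i j ij
        sub (i' , j') (there e∈) = ∈-edgeList i' j' (proj₂ (proj₂ (within i' j' e∈)))

-- `BlowupCopy` with a Boolean edge predicate, so that it also applies to subfamilies such as the
-- edges that avoid `L`.
record Copy {s t} (T : BipGraph s t) (a b : ℕ) {n} (E : Subset n → Bool) : Set where
  field
    Us      : Fin s → Subset n
    Vs      : Fin t → Subset n
    Us-size : ∀ i → ∣ Us i ∣ ≡ a
    Vs-size : ∀ j → ∣ Vs j ∣ ≡ b
    UU-disj : ∀ i i' → i ≢ i' → Empty (Us i ∩ Us i')
    VV-disj : ∀ j j' → j ≢ j' → Empty (Vs j ∩ Vs j')
    UV-disj : ∀ i j → Empty (Us i ∩ Vs j)
    edge    : ∀ i j → adj T i j ≡ true → E (Us i ∪ Vs j) ≡ true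

Uniform : ∀ {n} → ℕ → (Subset n → Bool) → Set
Uniform r E = ∀ e → E e ≡ true → ∣ e ∣ ≡ r

-- U_i is the set of letters of a word at the positions A, and V_j consists of the letters of a word at
-- the positions B j together with the fixed set X j.
flexible⇒copy : ∀ {s t a b n m} (T : BipGraph s t) → IsTree T → Fin s → Fin t →
  (E : Subset n → Bool) → Uniform (a + b) E →
  (W : Family n m) (A : Subset m) (B : Fin t → Subset m) (X : Fin t → Subset n) →
  (∀ j {i} → i ∈ A → i ∉ B j) → ∣ A ∣ ≤ a → (∀ j → ∣ B j ∣ + ∣ X j ∣ ≤ b) →
  Flexible ((s + t) * m) A W → (∀ j → Flexible ((s + t) * m) (B j) W) →
  (∀ w → W w ≡ true → ∀ j → E (image w A ∪ (image w (B j) ∪ X j)) ≡ true) →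
  (∀ j j' → j ≢ j' → Empty (X j ∩ X j')) →
  (∀ w → W w ≡ true → ∀ j → Empty (image w A ∩ X j)) →
  (∀ w → W w ≡ true → ∀ j j' → Empty (image w (B j) ∩ X j')) →
  ∀ w₀ → W w₀ ≡ true → Copy T a b E
flexible⇒copy {s} {t} {a} {b} T tree i₀ j₀ E uni W A B X A∩B A≤ B≤ flexA flexB E∈ X-disj AX BX w₀ w₀∈ = copy
  where
  open Tree T tree
  open Embedding W A B A∩B flexA flexB
  found = embedding (inj₁ i₀) w₀ w₀∈
  emb = proj₁ found
  emb∈ = proj₁ (proj₂ found)
  apart = proj₁ (proj₂ (proj₂ found))
  real = proj₂ (proj₂ (proj₂ found))
  U : Fin s → Subset _
  U i = image (emb (inj₁ i)) A
  V₀ V : Fin t → Subset _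
  V₀ j = image (emb (inj₂ j)) (B j)
  V j = V₀ j ∪ X j
  tight : ∀ w → W w ≡ true → ∀ j → ∣ image w A ∣ ≡ a × ∣ image w (B j) ∪ X j ∣ ≡ b × Empty (image w A ∩ (image w (B j) ∪ X j))
  tight w w∈ j = tight-union (image w A) (image w (B j) ∪ X j) (uni _ (E∈ w w∈ j))
    (≤-trans (∣image∣≤ w A) A≤)
    (≤-trans (∣p∪q∣≤ (image w (B j)) (X j)) (≤-trans (+-monoˡ-≤ ∣ X j ∣ (∣image∣≤ w (B j))) (B≤ j)))
  images-apart : ∀ x y → x ≢ y → Empty (image (emb x) (pos x) ∩ image (emb y) (pos y))
  images-apart x y x≢y (v , v∈) with x∈p∩q⁻ (image (emb x) (pos x)) (image (emb y) (pos y)) v∈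
  ... | v∈x , v∈y with ∈-image⁻ (emb x) (pos x) v∈x | ∈-image⁻ (emb y) (pos y) v∈y
  ... | i , i∈ , e | k , k∈ , e' = apart x y x≢y i∈ k∈ (trans e (sym e'))
  copy : Copy T a b E
  copy = record
    { Us = U ; Vs = V
    ; Us-size = λ i → proj₁ (tight _ (emb∈ (inj₁ i)) j₀)
    ; Vs-size = λ j → proj₁ (proj₂ (tight _ (emb∈ (inj₂ j)) j))
    ; UU-disj = λ i i' i≢ → images-apart (inj₁ i) (inj₁ i') (i≢ ∘ Sum.inj₁-injective)
    ; VV-disj = VV
    ; UV-disj = UV
    ; edge = edge' }
    where
    VV : ∀ j j' → j ≢ j' → Empty (V j ∩ V j')
    VV j j' j≢ (v , v∈) with x∈p∩q⁻ (V j) (V j') v∈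
    ... | l , r with x∈p∪q⁻ (V₀ j) (X j) l | x∈p∪q⁻ (V₀ j') (X j') r
    ... | inj₁ l' | inj₁ r' = images-apart (inj₂ j) (inj₂ j') (j≢ ∘ Sum.inj₂-injective) (v , x∈p∩q⁺ (l' , r'))
    ... | inj₁ l' | inj₂ r' = BX _ (emb∈ (inj₂ j)) j j' (v , x∈p∩q⁺ (l' , r'))
    ... | inj₂ l' | inj₁ r' = BX _ (emb∈ (inj₂ j')) j' j (v , x∈p∩q⁺ (r' , l'))
    ... | inj₂ l' | inj₂ r' = X-disj j j' j≢ (v , x∈p∩q⁺ (l' , r'))
    UV : ∀ i j → Empty (U i ∩ V j)
    UV i j (v , v∈) with x∈p∩q⁻ (U i) (V j) v∈
    ... | l , r with x∈p∪q⁻ (V₀ j) (X j) r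
    ... | inj₁ r' = images-apart (inj₁ i) (inj₂ j) (λ ()) (v , x∈p∩q⁺ (l , r'))
    ... | inj₂ r' = AX _ (emb∈ (inj₁ i)) j (v , x∈p∩q⁺ (l , r'))
    edge' : ∀ i j → adj T i j ≡ true → E (U i ∪ V j) ≡ true
    edge' i j ij with real i j ij
    ... | w , w∈ , eqA , eqB = subst (λ e → E e ≡ true)
      (cong₂ (λ p q → p ∪ (q ∪ X j)) (image-cong w (emb (inj₁ i)) A eqA) (image-cong w (emb (inj₂ j)) (B j) eqB)) (E∈ w w∈ j)

-- Kernel types

∈-tabulate⁺ : ∀ {n} (f : Fin n → Bool) {x} → f x ≡ true → x ∈ tabulate f
∈-tabulate⁺ f {x} fx = lookup⇒[]= x _ (trans (lookup∘tabulate f x) fx)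

∈-tabulate⁻ : ∀ {n} (f : Fin n → Bool) {x} → x ∈ tabulate f → f x ≡ true
∈-tabulate⁻ f {x} x∈ = trans (sym (lookup∘tabulate f x)) ([]=⇒lookup x∈)

∣p∣≥1⇒∃ : ∀ {n} {p : Subset n} → 1 ≤ ∣ p ∣ → ∃[ x ] x ∈ p
∣p∣≥1⇒∃ {n} {p} 1≤ = decidable-stable (nonempty? p) λ empty →
  <⇒≢ 1≤ (sym (trans (cong ∣_∣ (Empty-unique empty)) (∣⊥∣≡0 n)))

∣p∣≤1+∣p-x∣ : ∀ {n} (p : Subset n) x → ∣ p ∣ ≤ suc ∣ p - x ∣
∣p∣≤1+∣p-x∣ p x = ≤-trans (p⊆q⇒∣p∣≤∣q∣ {p = p} {q = ⁅ x ⁆ ∪ (p - x)} sub)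
  (≤-trans (∣p∪q∣≤ ⁅ x ⁆ (p - x)) (≤-reflexive (cong (_+ ∣ p - x ∣) (∣⁅x⁆∣≡1 x))))
  where
  sub : p ⊆ ⁅ x ⁆ ∪ (p - x)
  sub {y} y∈ with y Fin.≟ x
  ... | yes refl = x∈p∪q⁺ (inj₁ (x∈⁅x⁆ x))
  ... | no y≢x   = x∈p∪q⁺ (inj₂ (x∈p∧x≢y⇒x∈p-y y∈ y≢x))

x∉p-x : ∀ {n} (p : Subset n) x → x ∉ p - x
x∉p-x (_ ∷ p) zero    ()
x∉p-x (_ ∷ p) (suc x) (Data.Vec.there x∈) = x∉p-x p x x∈

another : ∀ {n} (p : Subset n) x → 2 ≤ ∣ p ∣ → ∃[ y ] y ∈ p × y ≢ x
another p x 2≤ with ∣p∣≥1⇒∃ {p = p - x} (≤-pred (≤-trans 2≤ (∣p∣≤1+∣p-x∣ p x)))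
... | y , y∈ = y , p─q⊆p p ⁅ x ⁆ y∈ , λ { refl → x∉p-x p x y∈ }

subset-of-size : ∀ {n} (p : Subset n) k → k ≤ ∣ p ∣ → ∃[ q ] q ⊆ p × ∣ q ∣ ≡ k
subset-of-size {n} p zero    _ = ⊥ , (λ x∈ → ⊥-elim (∉⊥ x∈)) , ∣⊥∣≡0 n
subset-of-size (true ∷ p) (suc k) (s≤s k≤) with subset-of-size p k k≤
... | q , q⊆ , eq = true ∷ q , (λ { Data.Vec.here → Data.Vec.here ; (Data.Vec.there x∈) → Data.Vec.there (q⊆ x∈) }) , cong suc eq
subset-of-size (false ∷ p) (suc k) k≤ with subset-of-size p (suc k) k≤
... | q , q⊆ , eq = false ∷ q , (λ { (Data.Vec.there x∈) → Data.Vec.there (q⊆ x∈) }) , eq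

superset-of-size : ∀ {n} (p : Subset n) k → ∣ p ∣ ≤ k → k ≤ n → ∃[ q ] p ⊆ q × ∣ q ∣ ≡ k
superset-of-size {n} p k p≤ k≤ with subset-of-size (∁ p) (n ∸ k)
  (≤-trans (∸-monoʳ-≤ n p≤) (≤-reflexive (sym (∣∁p∣≡n∸∣p∣ p))))
... | q , q⊆ , eq = ∁ q , (λ x∈ → x∉p⇒x∈∁p (λ x∈q → x∈p⇒x∉∁p x∈ (q⊆ x∈q))) ,
      trans (∣∁p∣≡n∸∣p∣ q) (trans (cong (n ∸_) eq) (m∸[m∸n]≡n k≤))

Centred : ∀ {n m} → Family n m → Fin m → Set
Centred X z = ∀ y w w' → X w ≡ true → X w' ≡ true →
  (∀ x → x ≢ y → x ≢ z → lookup w x ≡ lookup w' x) → lookup w z ≡ lookup w' z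

inhabited-of-large : ∀ {n m} (X : Family n m) → 0 < count X → ∃[ w ] X w ≡ true
inhabited-of-large {n} {m} X large =
  decidable-stable (∃-dec (words n m) ∈-words (λ w → X w Bool.≟ true)) λ none →
    <⇒≱ large (≤-reflexive (∑-zero (words n m) (zeroAt none)))
  where
  zeroAt : ¬ (∃[ w ] X w ≡ true) → ∀ w → 𝟙 (X w) ≡ 0
  zeroAt none w with X w in eq
  ... | true  = ⊥-elim (none (w , eq))
  ... | false = refl

-- Unless `Z` is a single position, there is a set of size a such that neither it nor its complement
-- meets `Z` in exactly one position; `kernel` then makes both of them kernels.
module KernelTypes {n r a b : ℕ} (J : List (Subset r)) (core : Family n r)
  (agree∈ : ∀ w w' → core w ≡ true → core w' ≡ true → agree w w' ∈ˡ J)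
  (∩∈J : ∀ {I₁ I₂} → I₁ ∈ˡ J → I₂ ∈ˡ J → I₁ ∩ I₂ ∈ˡ J)
  (a+b≡r : a + b ≡ r) (2≤b : 2 ≤ b) (b<a : b < a) (Z : Subset r)
  (kernel : ∀ I → (∀ x → x ∉ I → x ∈ Z → ∃[ x' ] x' ∉ I × x' ∈ Z × x' ≢ x) → I ∈ˡ J) where

  Split : Set
  Split = ∃[ A ] ∣ A ∣ ≡ a × A ∈ˡ J × ∁ A ∈ˡ J

  r∸b : r ∸ b ≡ a
  r∸b = trans (cong (_∸ b) (sym a+b≡r)) (m+n∸n≡m a b)

  -- Enlarge `Z` to a set `A` of size a: the complement of `A` misses `Z`, and `A` contains all of
  -- `Z`, which is not a single position.
  split-small : ∣ Z ∣ ≤ a → ∣ Z ∣ ≢ 1 → Split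
  split-small Z≤ Z≢1 with superset-of-size Z a Z≤ (≤-trans (m≤m+n a b) (≤-reflexive a+b≡r))
  ... | A , Z⊆A , A≡a = A , A≡a , kernel A (λ x x∉ x∈ → ⊥-elim (x∉ (Z⊆A x∈))) , kernel (∁ A) partner
    where
    partner : ∀ x → x ∉ ∁ A → x ∈ Z → ∃[ x' ] x' ∉ ∁ A × x' ∈ Z × x' ≢ x
    partner x _ x∈ with another Z x (≤∧≢⇒< (≤-<-trans z≤n (x∈p⇒∣p-x∣<∣p∣ x∈)) (Z≢1 ∘ sym))
    ... | x' , x'∈ , x'≢x = x' , x∈p⇒x∉∁p (Z⊆A x'∈) , x'∈ , x'≢x

  -- Take b positions inside `Z`. They are at least two, and since |Z| ≥ a + 1 ≥ b + 2 at least two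
  -- positions of `Z` remain outside.
  split-large : a < ∣ Z ∣ → Split
  split-large a<Z with subset-of-size Z b (≤-trans (<⇒≤ b<a) (<⇒≤ a<Z))
  ... | B , B⊆Z , B≡b = ∁ B , trans (∣∁p∣≡n∸∣p∣ B) (trans (cong (r ∸_) B≡b) r∸b) , kernel (∁ B) partner₁ ,
        subst (_∈ˡ J) (sym (∁∁ B)) (kernel B partner₂)
    where
    ∁∁ : ∀ {n} (p : Subset n) → ∁ (∁ p) ≡ p
    ∁∁ []      = refl
    ∁∁ (x ∷ p) = cong₂ _∷_ (Bool.not-involutive x) (∁∁ p)
    partner₁ : ∀ x → x ∉ ∁ B → x ∈ Z → ∃[ x' ] x' ∉ ∁ B × x' ∈ Z × x' ≢ x
    partner₁ x _ _ with another B x (≤-trans 2≤b (≤-reflexive (sym B≡b)))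
    ... | x' , x'∈ , x'≢x = x' , x∈p⇒x∉∁p x'∈ , B⊆Z x'∈ , x'≢x
    rest≥2 : 2 ≤ ∣ Z ∩ ∁ B ∣
    rest≥2 = +-cancelˡ-≤ b 2 _ (≤-trans (≤-reflexive (+-comm b 2)) (≤-trans (≤-trans (s≤s b<a) a<Z)
      (≤-trans (p⊆q⇒∣p∣≤∣q∣ {p = Z} {q = B ∪ (Z ∩ ∁ B)} sub) (≤-trans (∣p∪q∣≤ B (Z ∩ ∁ B)) (≤-reflexive (cong (_+ ∣ Z ∩ ∁ B ∣) B≡b))))))
      where
      sub : Z ⊆ B ∪ (Z ∩ ∁ B)
      sub {x} x∈ with x ∈? B
      ... | yes x∈B = x∈p∪q⁺ (inj₁ x∈B)
      ... | no x∉B  = x∈p∪q⁺ (inj₂ (x∈p∩q⁺ (x∈ , x∉p⇒x∈∁p x∉B)))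
    partner₂ : ∀ x → x ∉ B → x ∈ Z → ∃[ x' ] x' ∉ B × x' ∈ Z × x' ≢ x
    partner₂ x _ _ with another (Z ∩ ∁ B) x rest≥2
    ... | x' , x'∈ , x'≢x = x' , x∈∁p⇒x∉p (proj₂ (x∈p∩q⁻ Z (∁ B) x'∈)) , proj₁ (x∈p∩q⁻ Z (∁ B) x'∈) , x'≢x

  -- Every set through the only position `z` of `Z` is a kernel, so a kernel of size a that omits
  -- `z` splits with its complement. If two words agree off `y` and `z` but differ at `z`, there is
  -- such a kernel: choose `A` among the other positions, of which there are at least r - 2 ≥ a
  -- because b ≥ 2, and intersect the agreement set with the kernel `A ∪ ⁅ z ⁆`.
  centre : ∣ Z ∣ ≡ 1 → Split ⊎ (∃[ z ] Centred core z)
  centre Z≡1 with ∣p∣≥1⇒∃ {p = Z} (≤-reflexive (sym Z≡1))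
  ... | z , z∈Z = decide (any? (λ A → ¬? (z ∈? A) ×-dec (∣ A ∣ ≟ a)) J)
    where
    only : ∀ x → x ∈ Z → x ≡ z
    only x x∈ = decidable-stable (x Fin.≟ z) λ x≢z →
      ∣p∣≡0⇒Empty (n≤0⇒n≡0 (≤-pred (≤-trans (x∈p⇒∣p-x∣<∣p∣ z∈Z) (≤-reflexive Z≡1)))) (x , x∈p∧x≢y⇒x∈p-y x∈ x≢z)
    through : ∀ I → z ∈ I → I ∈ˡ J
    through I z∈ = kernel I (λ x x∉ x∈Z → ⊥-elim (x∉ (subst (_∈ I) (sym (only x x∈Z)) z∈)))
    decide : Dec (Any (λ A → z ∉ A × ∣ A ∣ ≡ a) J) → Split ⊎ (∃[ z ] Centred core z)
    decide (yes found) = let A , A∈ , z∉ , A≡a = Mem.find found in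
      inj₁ (A , A≡a , A∈ , through (∁ A) (x∉p⇒x∈∁p z∉))
    decide (no none) = inj₂ (z , centred)
      where
      centred : Centred core z
      centred y w w' p p' eq = decidable-stable (_ Fin.≟ _) λ w≢ → contra w≢
        where
        I = agree w w'
        a≤ : a ≤ ∣ ⊤ - y - z ∣
        a≤ = +-cancelˡ-≤ 2 a _ (≤-trans (≤-trans (≤-trans (+-monoˡ-≤ a 2≤b) (≤-reflexive (trans (+-comm b a) (trans a+b≡r (sym (∣⊤∣≡n r)))))) (∣p∣≤1+∣p-x∣ ⊤ y))
          (s≤s (∣p∣≤1+∣p-x∣ (⊤ - y) z)))
        contra : ¬ (lookup w z ≢ lookup w' z)
        contra w≢ with subset-of-size (⊤ - y - z) a a≤
        ... | A , A⊆ , A≡a = none (Mem.lose A∈ (z∉A , A≡a))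
          where
          A⊆I : A ⊆ I
          A⊆I {x} x∈ = ∈-agree⁺ w w' (eq x (λ { refl → x∉p-x ⊤ x (p─q⊆p (⊤ - x) ⁅ z ⁆ (A⊆ x∈)) })
                                          (λ { refl → x∉p-x (⊤ - y) x (A⊆ x∈) }))
          z∉I : z ∉ I
          z∉I z∈ = w≢ (∈-agree⁻ w w' z∈)
          z∉A : z ∉ A
          z∉A z∈ = z∉I (A⊆I z∈)
          A≡ : I ∩ (A ∪ ⁅ z ⁆) ≡ A
          A≡ = ⊆-antisym fwd (λ x∈ → x∈p∩q⁺ (A⊆I x∈ , x∈p∪q⁺ (inj₁ x∈)))
            where
            fwd : I ∩ (A ∪ ⁅ z ⁆) ⊆ A
            fwd {x} x∈ with x∈p∩q⁻ I (A ∪ ⁅ z ⁆) x∈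
            ... | x∈I , x∈' with x∈p∪q⁻ A ⁅ z ⁆ x∈'
            ... | inj₁ x∈A = x∈A
            ... | inj₂ x∈z = ⊥-elim (z∉I (subst (_∈ I) (x∈⁅y⁆⇒x≡y z x∈z) x∈I))
          A∈ : A ∈ˡ J
          A∈ = subst (_∈ˡ J) A≡ (∩∈J (agree∈ w w' p p') (through (A ∪ ⁅ z ⁆) (x∈p∪q⁺ (inj₂ (x∈⁅x⁆ z)))))

  dichotomy : Split ⊎ (∃[ z ] Centred core z)
  dichotomy with ∣ Z ∣ ≟ 1
  ... | yes Z≡1 = centre Z≡1
  ... | no Z≢1 with ∣ Z ∣ ≤? a
  ... | yes Z≤a = inj₁ (split-small Z≤a Z≢1)
  ... | no Z≰a  = inj₁ (split-large (≰⇒> Z≰a))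

-- Z is the set of positions x for which no kernel misses exactly x.  If the complement of I
-- meets Z in a number of positions other than one, kernels containing I exclude every position off I, so I
-- is an intersection of kernels.
kernel-types : ∀ {n r k q C a b} {X : Family n r} (hom : Homogeneous q X C) → r ≤ q → r ≡ 2 + k →
  a + b ≡ r → 2 ≤ b → b < a → n ^ k < count (Homogeneous.core hom) →
  (∃[ A ] ∣ A ∣ ≡ a × A ∈ˡ Homogeneous.J hom × ∁ A ∈ˡ Homogeneous.J hom) ⊎
  (∃[ z ] Centred (Homogeneous.core hom) z)
kernel-types {n} {r} {k} {q} {C} {a} {b} {X} hom r≤q r≡2+k a+b≡r 2≤b b<a large =
  KernelTypes.dichotomy J core agree∈ ∩∈J a+b≡r 2≤b b<a Z kernel
  where
  open Homogeneous hom
  inhabited = inhabited-of-large core (≤-<-trans z≤n large)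
  open Kernels hom r≤q (proj₁ inhabited) (proj₂ inhabited)
  Misses₁ : Fin r → Subset r → Set
  Misses₁ y K = y ∉ K × (∀ x → x ≢ y → x ∈ K)
  Misses₂ : Fin r → Fin r → Subset r → Set
  Misses₂ y z K = y ∉ K × z ∉ K × (∀ x → x ≢ y → x ≢ z → x ∈ K)
  Free : Fin r → Set
  Free y = ∃[ K ] K ∈ˡ J × Misses₁ y K
  free? : ∀ y → Dec (Free y)
  free? y with any? (λ K → ¬? (y ∈? K) ×-dec Fin.all? (λ x → ¬? (x Fin.≟ y) →-dec (x ∈? K))) J
  ... | yes p = yes (Mem.find p)
  ... | no ¬p = no λ (K , K∈ , ms) → ¬p (Mem.lose K∈ ms)

  size-pair : ∀ y z → y ≢ z → ∣ ⊤ - y - z ∣ ≤ k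
  size-pair y z y≢z = ≤-pred (≤-pred (≤-trans (s≤s (x∈p⇒∣p-x∣<∣p∣ {p = ⊤ - y} (x∈p∧x≢y⇒x∈p-y ∈⊤ (y≢z ∘ sym))))
    (≤-trans (x∈p⇒∣p-x∣<∣p∣ {p = ⊤ {r}} (∈⊤ {x = y})) (≤-reflexive (trans (∣⊤∣≡n r) r≡2+k)))))

  n≥1 : NonZero n
  n≥1 = inhabited⇒nonZero (lookup (proj₁ inhabited) (subst Fin (sym r≡2+k) zero))

  -- The k positions other than `y` and `z` cannot determine more than n^k words. Hence some kernel
  -- misses `y`, `z` or both, and nothing else.
  pairs : ∀ y z → y ≢ z → Free y ⊎ Free z ⊎ (∃[ K ] K ∈ˡ J × Misses₂ y z K)
  pairs y z y≢z with cover (⊤ - y - z) (≤-<-trans (^-monoʳ-≤ n {{n≥1}} (size-pair y z y≢z)) large)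
  ... | K , K∈ , ⊆K , x , x∉ with y ∈? K | z ∈? K
  ... | no y∉ | no z∉ = inj₂ (inj₂ (K , K∈ , y∉ , z∉ ,
        λ x x≢y x≢z → ⊆K (x∈p∧x≢y⇒x∈p-y (x∈p∧x≢y⇒x∈p-y ∈⊤ x≢y) x≢z)))
  ... | no y∉ | yes z∈ = inj₁ (K , K∈ , y∉ , rest)
    where
    rest : ∀ x → x ≢ y → x ∈ K
    rest x x≢y with x Fin.≟ z
    ... | yes refl = z∈
    ... | no x≢z   = ⊆K (x∈p∧x≢y⇒x∈p-y (x∈p∧x≢y⇒x∈p-y ∈⊤ x≢y) x≢z)
  ... | yes y∈ | no z∉ = inj₂ (inj₁ (K , K∈ , z∉ , rest))
    where
    rest : ∀ x → x ≢ z → x ∈ K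
    rest x x≢z with x Fin.≟ y
    ... | yes refl = y∈
    ... | no x≢y   = ⊆K (x∈p∧x≢y⇒x∈p-y (x∈p∧x≢y⇒x∈p-y ∈⊤ x≢y) x≢z)
  ... | yes y∈ | yes z∈ = ⊥-elim (x∉ (⊆K (x∈p∧x≢y⇒x∈p-y (x∈p∧x≢y⇒x∈p-y ∈⊤ (λ { refl → x∉ y∈ })) (λ { refl → x∉ z∈ }))))

  notFree : Fin r → Bool
  notFree x = not (does (free? x))
  Z : Subset r
  Z = tabulate notFree
  ∈Z⁻ : ∀ {x} → x ∈ Z → ¬ Free x
  ∈Z⁻ {x} x∈ = does-false⁻ (free? x) (∈-tabulate⁻ notFree x∈)
  ∈Z⁺ : ∀ {x} → ¬ Free x → x ∈ Z
  ∈Z⁺ {x} ¬f = ∈-tabulate⁺ notFree (not-true (free? x) ¬f)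

  kernel : ∀ I → (∀ x → x ∉ I → x ∈ Z → ∃[ x' ] x' ∉ I × x' ∈ Z × x' ≢ x) → I ∈ˡ J
  kernel I partner = meet∈J I separate
    where
    separate : ∀ x → x ∉ I → ∃[ K ] K ∈ˡ J × I ⊆ K × x ∉ K
    separate x x∉ with free? x
    ... | yes (K , K∈ , x∉K , rest) = K , K∈ , (λ {i} i∈ → rest i (λ { refl → x∉ i∈ })) , x∉K
    ... | no ¬f with partner x x∉ (∈Z⁺ ¬f)
    ... | x' , x'∉ , x'∈Z , x'≢x with pairs x x' (x'≢x ∘ sym)
    ... | inj₁ f = ⊥-elim (¬f f)
    ... | inj₂ (inj₁ f) = ⊥-elim (∈Z⁻ x'∈Z f)
    ... | inj₂ (inj₂ (K , K∈ , x∉K , _ , rest)) =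
          K , K∈ , (λ {i} i∈ → rest i (λ { refl → x∉ i∈ }) (λ { refl → x'∉ i∈ })) , x∉K

-- Vertices of large degree

∑-allFin-bound : ∀ {n} {f : Fin n → ℕ} {c} → (∀ x → f x ≤ c) → ∑ (allFin n) f ≤ n * c
∑-allFin-bound {n} {f} {c} le = ≤-trans (∑-bound (allFin n) (λ x _ → le x)) (≤-reflexive (cong (_* c) (length-allFin n)))

𝟙-cases : ∀ {P : Set} (Q : ℕ → Set) (p? : Dec P) → (P → Q 1) → (¬ P → Q 0) → Q (𝟙 (does p?))
𝟙-cases Q (yes p) Q1 Q0 = Q1 p
𝟙-cases Q (no ¬p) Q1 Q0 = Q0 ¬p

shadow? : ∀ {n m} (X : Family n (suc m)) w → Dec (∃ λ x → X (x ∷ w) ≡ true)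
shadow? X w = Fin.any? (λ x → X (x ∷ w) Bool.≟ true)

-- The number of axis-parallel lines that meet X, over all directions.
lines : ∀ {n m} → Family n m → ℕ
lines {n} {zero}  X = 0
lines {n} {suc m} X = count (λ w → does (shadow? X w)) + ∑ (allFin n) (λ x → lines (λ w → X (x ∷ w)))

-- Slices with at least h ^ m points are fewer than h, so a line in the first direction carries at most h
-- of their points; the other slices are handled inductively.
few-lines : ∀ {n m} h (X : Family n m) → h ^ m ≤ count X ⊎ count X ≤ h * lines X
few-lines {n} {zero} h X with 1 ≤? count X
... | yes le = inj₁ le
... | no ¬le = inj₂ (≤-trans (≤-pred (≰⇒> ¬le)) z≤n)
few-lines {n} {suc m} h X with h ^ suc m ≤? count X
... | yes le = inj₁ le
... | no ¬le = inj₂ bound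
  where
  open ≤-Reasoning
  slice : Fin n → Family n m
  slice x w = X (x ∷ w)
  big : Fin n → Bool
  big x = does (h ^ m ≤? count (slice x))
  big≤ : ∑ (allFin n) (𝟙 ∘ big) ≤ h
  big≤ = <⇒≤ (*-cancelˡ-< (h ^ m) _ _ (begin-strict
    h ^ m * ∑ (allFin n) (𝟙 ∘ big)                ≡⟨ sym (∑-*ˡ (allFin n) (h ^ m) (𝟙 ∘ big)) ⟩
    ∑ (allFin n) (λ x → h ^ m * 𝟙 (big x))        ≤⟨ ∑-mono (allFin n) pt ⟩
    ∑ (allFin n) (λ x → count (slice x))          ≡⟨ sym (count-suc X) ⟩
    count X                                       <⟨ ≰⇒> ¬le ⟩
    h * h ^ m                                     ≡⟨ *-comm h (h ^ m) ⟩
    h ^ m * h                                     ∎))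
    where
    pt : ∀ x → h ^ m * 𝟙 (big x) ≤ count (slice x)
    pt x = 𝟙-cases (λ i → h ^ m * i ≤ count (slice x)) (h ^ m ≤? count (slice x))
      (≤-trans (≤-reflexive (*-identityʳ (h ^ m)))) (λ _ → ≤-trans (≤-reflexive (*-zeroʳ (h ^ m))) z≤n)
  split : ∀ x → count (slice x) ≤ ∑ (words n m) (λ w → 𝟙 (big x) * 𝟙 (slice x w)) + h * lines (slice x)
  split x = 𝟙-cases (λ i → count (slice x) ≤ ∑ (words n m) (λ w → i * 𝟙 (slice x w)) + h * lines (slice x))
    (h ^ m ≤? count (slice x))
    (λ _ → ≤-trans (≤-reflexive (∑-cong (words n m) (λ w → sym (*-identityˡ _)))) (m≤m+n _ _)) smaller
    where
    smaller : ¬ (h ^ m ≤ count (slice x)) →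
      count (slice x) ≤ ∑ (words n m) (λ w → 0 * 𝟙 (slice x w)) + h * lines (slice x)
    smaller ¬p with few-lines h (slice x)
    ... | inj₁ p  = ⊥-elim (¬p p)
    ... | inj₂ le = ≤-trans le (m≤n+m _ _)
  line≤ : ∀ w → ∑ (allFin n) (λ x → 𝟙 (big x) * 𝟙 (slice x w)) ≤ h * 𝟙 (does (shadow? X w))
  line≤ w with shadow? X w
  ... | yes _ = begin
    ∑ (allFin n) (λ x → 𝟙 (big x) * 𝟙 (slice x w)) ≤⟨ ∑-mono (allFin n) (λ x → ≤-trans (*-monoʳ-≤ (𝟙 (big x)) (𝟙≤1 _)) (≤-reflexive (*-identityʳ _))) ⟩
    ∑ (allFin n) (𝟙 ∘ big)                         ≤⟨ big≤ ⟩
    h                                              ≡⟨ sym (*-identityʳ h) ⟩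
    h * 1                                          ∎
  ... | no none = begin
    ∑ (allFin n) (λ x → 𝟙 (big x) * 𝟙 (slice x w)) ≡⟨ ∑-zero (allFin n) (λ x → trans (cong (𝟙 (big x) *_) (off x)) (*-zeroʳ (𝟙 (big x)))) ⟩
    0                                              ≤⟨ z≤n ⟩
    h * 0                                          ∎
    where
    off : ∀ x → 𝟙 (slice x w) ≡ 0
    off x with X (x ∷ w) in eq
    ... | true  = ⊥-elim (none (x , eq))
    ... | false = refl
  bound : count X ≤ h * lines X
  bound = begin
    count X                                                                          ≡⟨ count-suc X ⟩
    ∑ (allFin n) (λ x → count (slice x))                                             ≤⟨ ∑-mono (allFin n) split ⟩
    ∑ (allFin n) (λ x → ∑ (words n m) (λ w → 𝟙 (big x) * 𝟙 (slice x w)) + h * lines (slice x))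
                                                                                     ≡⟨ ∑-+ (allFin n) _ _ ⟩
    ∑ (allFin n) (λ x → ∑ (words n m) (λ w → 𝟙 (big x) * 𝟙 (slice x w))) + ∑ (allFin n) (λ x → h * lines (slice x))
                                                                                     ≡⟨ cong₂ _+_ (∑-swap (allFin n) (words n m) _) (∑-*ˡ (allFin n) h _) ⟩
    ∑ (words n m) (λ w → ∑ (allFin n) (λ x → 𝟙 (big x) * 𝟙 (slice x w))) + h * ∑ (allFin n) (λ x → lines (slice x))
                                                                                     ≤⟨ +-monoˡ-≤ _ (∑-mono (words n m) line≤) ⟩
    ∑ (words n m) (λ w → h * 𝟙 (does (shadow? X w))) + h * ∑ (allFin n) (λ x → lines (slice x))
                                                                                     ≡⟨ cong (_+ h * ∑ (allFin n) (λ x → lines (slice x))) (∑-*ˡ (words n m) h _) ⟩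
    h * count (λ w → does (shadow? X w)) + h * ∑ (allFin n) (λ x → lines (slice x))  ≡⟨ sym (*-distribˡ-+ h _ _) ⟩
    h * lines X                                                                      ∎

LineDisjoint : ∀ {n m} → (Fin n → Family n m) → Set
LineDisjoint Y = ∀ v v' w w' y → Y v w ≡ true → Y v' w' ≡ true →
  (∀ x → x ≢ y → lookup w x ≡ lookup w' x) → v ≡ v'

-- By `LineDisjoint` each axis-parallel line meets at most one of the families, and there are only
-- `m * n ^ (m ∸ 1)` lines in all.
disjoint-lines : ∀ {n} m (Y : Fin n → Family n m) → LineDisjoint Y →
  ∑ (allFin n) (λ v → lines (Y v)) ≤ m * n ^ (m ∸ 1)
disjoint-lines {n} zero Y _ = ≤-reflexive (∑-zero (allFin n) (λ _ → refl))
disjoint-lines {n} (suc m) Y disj = begin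
  ∑ (allFin n) (λ v → lines (Y v))
    ≡⟨ ∑-+ (allFin n) (λ v → count (λ w → does (shadow? (Y v) w))) _ ⟩
  ∑ (allFin n) (λ v → count (λ w → does (shadow? (Y v) w))) + ∑ (allFin n) (λ v → ∑ (allFin n) (λ x → lines (λ w → Y v (x ∷ w))))
    ≡⟨ cong₂ _+_ (∑-swap (allFin n) (words n m) (λ v w → 𝟙 (does (shadow? (Y v) w)))) (∑-swap (allFin n) (allFin n) (λ v x → lines (λ w → Y v (x ∷ w)))) ⟩
  ∑ (words n m) (λ w → ∑ (allFin n) (λ v → 𝟙 (does (shadow? (Y v) w)))) + ∑ (allFin n) (λ x → ∑ (allFin n) (λ v → lines (λ w → Y v (x ∷ w))))
    ≤⟨ +-mono-≤ (∑-bound (words n m) (λ w _ → first w)) (∑-allFin-bound (λ x → disjoint-lines m (λ v w → Y v (x ∷ w)) (rest x))) ⟩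
  length (words n m) * 1 + n * (m * n ^ (m ∸ 1))
    ≤⟨ +-mono-≤ (≤-reflexive (trans (*-identityʳ _) (length-words n m))) (shift m) ⟩
  suc m * n ^ m ∎
  where
  open ≤-Reasoning
  first : ∀ w → ∑ (allFin n) (λ v → 𝟙 (does (shadow? (Y v) w))) ≤ 1
  first w = ∑-at-most-one (Unique.allFin⁺ n) (λ v → does (shadow? (Y v) w)) true
    (λ v v' p p' → let x , q = does-true⁻ (shadow? (Y v) w) p ; x' , q' = does-true⁻ (shadow? (Y v') w) p' in
      disj v v' (x ∷ w) (x' ∷ w) zero q q' (λ { zero z≢ → ⊥-elim (z≢ refl) ; (suc i) _ → refl }))
    (λ _ _ → refl)
  rest : ∀ x → LineDisjoint (λ v w → Y v (x ∷ w))
  rest x v v' w w' y p p' eq = disj v v' (x ∷ w) (x ∷ w') (suc y) p p'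
    (λ { zero _ → refl ; (suc i) i≢ → eq i (λ e → i≢ (cong suc e)) })
  shift : ∀ m → n * (m * n ^ (m ∸ 1)) ≤ m * n ^ m
  shift zero    = ≤-reflexive (*-zeroʳ n)
  shift (suc m) = ≤-reflexive (rearr n (suc m) (n ^ m))
    where
    rearr : ∀ x y z → x * (y * z) ≡ y * (x * z)
    rearr = solve-∀

∑-insertAt : ∀ {n} m (z : Fin (suc m)) (f : Word n (suc m) → ℕ) →
  ∑ (words n (suc m)) f ≡ ∑ (allFin n) (λ v → ∑ (words n m) (λ w → f (insertAt w z v)))
∑-insertAt {n} m zero f = ∑-tuples-suc (allFin n) m f
∑-insertAt {n} (suc m) (suc z) f = begin
  ∑ (words n (2 + m)) f
    ≡⟨ ∑-tuples-suc (allFin n) (suc m) f ⟩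
  ∑ (allFin n) (λ x → ∑ (words n (suc m)) (λ w → f (x ∷ w)))
    ≡⟨ ∑-cong (allFin n) (λ x → ∑-insertAt m z (λ w → f (x ∷ w))) ⟩
  ∑ (allFin n) (λ x → ∑ (allFin n) (λ v → ∑ (words n m) (λ w → f (x ∷ insertAt w z v))))
    ≡⟨ ∑-swap (allFin n) (allFin n) (λ x v → ∑ (words n m) (λ w → f (x ∷ insertAt w z v))) ⟩
  ∑ (allFin n) (λ v → ∑ (allFin n) (λ x → ∑ (words n m) (λ w → f (x ∷ insertAt w z v))))
    ≡⟨ ∑-cong (allFin n) (λ v → sym (∑-tuples-suc (allFin n) m (λ w → f (insertAt w (suc z) v)))) ⟩
  ∑ (allFin n) (λ v → ∑ (words n (suc m)) (λ w → f (insertAt w (suc z) v))) ∎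
  where open ≡-Reasoning

wordSet : ∀ {n m} → Word n m → Subset n
wordSet w = image w ⊤

wordSet-insertAt : ∀ {n m} (w : Word n m) z v → wordSet (insertAt w z v) ≡ ⁅ v ⁆ ∪ wordSet w
wordSet-insertAt w zero v = refl
wordSet-insertAt (x ∷ w) (suc z) v = begin
  ⁅ x ⁆ ∪ wordSet (insertAt w z v)   ≡⟨ cong (⁅ x ⁆ ∪_) (wordSet-insertAt w z v) ⟩
  ⁅ x ⁆ ∪ (⁅ v ⁆ ∪ wordSet w)        ≡⟨ sym (∪-assoc ⁅ x ⁆ ⁅ v ⁆ (wordSet w)) ⟩
  (⁅ x ⁆ ∪ ⁅ v ⁆) ∪ wordSet w        ≡⟨ cong (_∪ wordSet w) (∪-comm ⁅ x ⁆ ⁅ v ⁆) ⟩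
  (⁅ v ⁆ ∪ ⁅ x ⁆) ∪ wordSet w        ≡⟨ ∪-assoc ⁅ v ⁆ ⁅ x ⁆ (wordSet w) ⟩
  ⁅ v ⁆ ∪ (⁅ x ⁆ ∪ wordSet w)        ∎
  where open ≡-Reasoning

image-∪ : ∀ {n m} (w : Word n m) I I' → image w (I ∪ I') ≡ image w I ∪ image w I'
image-∪ w I I' = ⊆-antisym fwd bwd
  where
  fwd : image w (I ∪ I') ⊆ image w I ∪ image w I'
  fwd v∈ with ∈-image⁻ w (I ∪ I') v∈
  ... | i , i∈ , refl with x∈p∪q⁻ I I' i∈
  ... | inj₁ i∈I  = x∈p∪q⁺ (inj₁ (∈-image⁺ w i∈I))
  ... | inj₂ i∈I' = x∈p∪q⁺ (inj₂ (∈-image⁺ w i∈I'))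
  bwd : image w I ∪ image w I' ⊆ image w (I ∪ I')
  bwd v∈ with x∈p∪q⁻ (image w I) (image w I') v∈
  ... | inj₁ v∈I with ∈-image⁻ w I v∈I
  ...   | i , i∈ , refl = ∈-image⁺ w (x∈p∪q⁺ (inj₁ i∈))
  bwd v∈ | inj₂ v∈I' with ∈-image⁻ w I' v∈I'
  ...   | i , i∈ , refl = ∈-image⁺ w (x∈p∪q⁺ (inj₂ i∈))

wordSet-split : ∀ {n m} (w : Word n m) I → image w I ∪ image w (∁ I) ≡ wordSet w
wordSet-split w I = trans (sym (image-∪ w I (∁ I))) (cong (image w) (p∪∁p≡⊤ I))

-- Slice `X` by the letter at `z`. Centredness says that no line meets two slices, so the slices
-- have few lines altogether; a slice with fewer than `h ^ m` words has at most `h` words per line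
-- by `few-lines`.
centred-bound : ∀ {n m} h (X : Family n (suc m)) z → Centred X z →
  (∃[ v ] h ^ m ≤ count (λ w → X (insertAt w z v))) ⊎ count X ≤ h * (m * n ^ (m ∸ 1))
centred-bound {n} {m} h X z centred with Fin.any? (λ v → h ^ m ≤? count (λ w → X (insertAt w z v)))
... | yes found = inj₁ found
... | no none = inj₂ (begin
  count X                                    ≡⟨ ∑-insertAt m z (𝟙 ∘ X) ⟩
  ∑ (allFin n) (λ v → count (Y v))           ≤⟨ ∑-mono (allFin n) each ⟩
  ∑ (allFin n) (λ v → h * lines (Y v))       ≡⟨ ∑-*ˡ (allFin n) h _ ⟩
  h * ∑ (allFin n) (λ v → lines (Y v))       ≤⟨ *-monoʳ-≤ h (disjoint-lines m Y disj) ⟩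
  h * (m * n ^ (m ∸ 1))                      ∎)
  where
  open ≤-Reasoning
  Y : Fin n → Family n m
  Y v w = X (insertAt w z v)
  each : ∀ v → count (Y v) ≤ h * lines (Y v)
  each v with few-lines h (Y v)
  ... | inj₁ le = ⊥-elim (none (v , le))
  ... | inj₂ le = le
  disj : LineDisjoint Y
  disj v v' w w' y p p' eq = trans (sym (insertAt-lookup w z v))
    (trans (centred (punchIn z y) (insertAt w z v) (insertAt w' z v') p p' same) (insertAt-lookup w' z v'))
    where
    same : ∀ x → x ≢ punchIn z y → x ≢ z → lookup (insertAt w z v) x ≡ lookup (insertAt w' z v') x
    same x x≢y x≢z = subst (λ u → lookup (insertAt w z v) u ≡ lookup (insertAt w' z v') u) (Fin.punchIn-punchOut (x≢z ∘ sym))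
      (trans (insertAt-punchIn w z v x') (trans (eq x' (λ e → x≢y (trans (sym (Fin.punchIn-punchOut (x≢z ∘ sym))) (cong (punchIn z) e))))
        (sym (insertAt-punchIn w' z v' x'))))
      where
      x' = punchOut (x≢z ∘ sym)

length≤budget : ∀ {s} → Fin s → ∀ t m → m ≤ (s + t) * m
length≤budget {suc s} _ t m = m≤m+n m ((s + t) * m)

-- The loss in `homogeneous` for words of length `2 + k` when the budget allows all letters of the
-- words placed at `v` tree vertices to be forbidden.
furediConstant : ℕ → ℕ → ℕ
furediConstant v k = furedi (2 + k) (v * (2 + k)) (2 ^ (2 + k))

module _ {s t : ℕ} (T : BipGraph s t) (tree : IsTree T) (i₀ : Fin s) (j₀ : Fin t) (a b k : ℕ)
  (a+b≡r : a + b ≡ 2 + k) (2≤b : 2 ≤ b) (b<a : b < a) where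

  module _ {n} (E : Subset n → Bool) (uni : Uniform (a + b) E) {C : ℕ}
    (hom : Homogeneous ((s + t) * (2 + k)) (λ (w : Word n (2 + k)) → E (wordSet w)) C) where

    open Homogeneous hom

    split⇒copy : ∀ w₀ → core w₀ ≡ true → ∀ A → ∣ A ∣ ≡ a → A ∈ˡ J → ∁ A ∈ˡ J → Copy T a b E
    split⇒copy w₀ w₀∈ A A≡a A∈ ∁A∈ = flexible⇒copy T tree i₀ j₀ E uni core A (λ _ → ∁ A) (λ _ → ⊥)
      (λ _ → x∈p⇒x∉∁p) (≤-reflexive A≡a)
      (λ _ → ≤-reflexive (trans (cong₂ _+_ (∣∁p∣≡n∸∣p∣ A) (∣⊥∣≡0 n)) (trans (+-identityʳ _)
        (trans (cong₂ _∸_ (sym a+b≡r) A≡a) (m+n∸m≡n a b)))))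
      (flexible A A∈) (λ _ → flexible (∁ A) ∁A∈)
      (λ w w∈ _ → subst (λ e → E e ≡ true)
        (sym (trans (cong (image w A ∪_) (∪-identityʳ (image w (∁ A)))) (wordSet-split w A))) (core⊆ w w∈))
      (λ _ _ _ (v , v∈) → ∉⊥ (proj₁ (x∈p∩q⁻ ⊥ ⊥ v∈)))
      (λ w _ _ (v , v∈) → ∉⊥ (proj₂ (x∈p∩q⁻ (image w A) ⊥ v∈)))
      (λ w _ _ _ (v , v∈) → ∉⊥ (proj₂ (x∈p∩q⁻ (image w (∁ A)) ⊥ v∈)))
      w₀ w₀∈

    popular-letter : ∀ h → ¬ Copy T a b E →
      (∃[ v ] h ^ suc k ≤ count {n} {suc k} (λ w → E (⁅ v ⁆ ∪ wordSet w))) ⊎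
      count core ≤ n ^ k + h * (suc k * n ^ k)
    popular-letter h free with n ^ k <? count core
    ... | no ¬large = inj₂ (≤-trans (≮⇒≥ ¬large) (m≤m+n _ _))
    ... | yes large with kernel-types hom (length≤budget i₀ t (2 + k)) refl a+b≡r 2≤b b<a large
    ... | inj₁ (A , A≡a , A∈ , ∁A∈) =
          let w₀ , w₀∈ = inhabited-of-large core (≤-<-trans z≤n large) in
          ⊥-elim (free (split⇒copy w₀ w₀∈ A A≡a A∈ ∁A∈))
    ... | inj₂ (z , centred) with centred-bound h core z centred
    ... | inj₂ le = inj₂ (≤-trans le (m≤n+m _ _))
    ... | inj₁ (v , le) = inj₁ (v , ≤-trans le (count-mono {X = λ w → core (insertAt w z v)}
            (λ w p → subst (λ e → E e ≡ true) (wordSet-insertAt w z v) (core⊆ _ p))))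

  -- A core with more than `n ^ k` words that splits would give a copy, so it is centred and
  -- `centred-bound` applies at its centre. For `h` a small fraction of n the second alternative is
  -- a small fraction of `n ^ suc k`, up to lower order.
  popular-vertex : ∀ {n} h (E : Subset n → Bool) → Uniform (a + b) E → ¬ Copy T a b E →
    (∃[ v ] h ^ suc k ≤ count {n} {suc k} (λ w → E (⁅ v ⁆ ∪ wordSet w))) ⊎
    count {n} {2 + k} (λ w → E (wordSet w)) ≤ furediConstant (s + t) k * (n ^ k + h * (suc k * n ^ k))
  popular-vertex {n} h E uni free = finish (homogeneous ((s + t) * (2 + k)) (λ w → E (wordSet w)))
    where
    finish : Homogeneous ((s + t) * (2 + k)) (λ (w : Word n (2 + k)) → E (wordSet w)) (furediConstant (s + t) k) → _
    finish hom with popular-letter E uni hom h free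
    ... | inj₁ found = inj₁ found
    ... | inj₂ le    = inj₂ (≤-trans (Homogeneous.bound hom) (*-monoʳ-≤ (furediConstant (s + t) k) le))

-- Words with many centres

elements : ∀ {n} → Subset n → List (Fin n)
elements []          = []
elements (true ∷ p)  = zero ∷ map suc (elements p)
elements (false ∷ p) = map suc (elements p)

length-elements : ∀ {n} (p : Subset n) → length (elements p) ≡ ∣ p ∣
length-elements []          = refl
length-elements (true ∷ p)  = cong suc (trans (length-map suc (elements p)) (length-elements p))
length-elements (false ∷ p) = trans (length-map suc (elements p)) (length-elements p)

∈-elements : ∀ {n} {p : Subset n} {x} → x ∈ p → x ∈ˡ elements p
∈-elements {p = true ∷ p}  Data.Vec.here       = here refl
∈-elements {p = true ∷ p}  (Data.Vec.there x∈) = there (∈-map⁺ suc (∈-elements x∈))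
∈-elements {p = false ∷ p} (Data.Vec.there x∈) = ∈-map⁺ suc (∈-elements x∈)

distinct-tuple : ∀ {n} t (p : Subset n) → t ≤ ∣ p ∣ →
  ∃[ τ ] (∀ (j : Fin t) → lookup τ j ∈ p) × (∀ j j' → j ≢ j' → lookup τ j ≢ lookup τ j')
distinct-tuple zero    p _  = [] , (λ ()) , (λ ())
distinct-tuple (suc t) p t≤ with ∣p∣≥1⇒∃ {p = p} (≤-trans (s≤s z≤n) t≤)
... | x , x∈ with distinct-tuple t (p - x) (≤-pred (≤-trans t≤ (∣p∣≤1+∣p-x∣ p x)))
... | τ , τ∈ , dist = x ∷ τ , (λ { zero → x∈ ; (suc j) → p─q⊆p p ⁅ x ⁆ (τ∈ j) }) ,
      λ { zero zero ne _ → ne refl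
        ; zero (suc j) _ eq → x∉p-x p x (subst (_∈ p - x) (sym eq) (τ∈ j))
        ; (suc j) zero _ eq → x∉p-x p x (subst (_∈ p - x) eq (τ∈ j))
        ; (suc j) (suc j') ne eq → dist j j' (ne ∘ cong suc) eq }

∪-shuffle : ∀ {n} (p y q v : Subset n) → p ∪ ((y ∪ q) ∪ v) ≡ v ∪ (y ∪ (p ∪ q))
∪-shuffle []      []      []      []      = refl
∪-shuffle (a ∷ p) (b ∷ y) (c ∷ q) (d ∷ v) = cong₂ _∷_ (bool a b c d) (∪-shuffle p y q v)
  where
  bool : ∀ a b c d → a ∨ ((b ∨ c) ∨ d) ≡ d ∨ (b ∨ (a ∨ c))
  bool true  true  _     true  = refl
  bool true  true  _     false = refl
  bool true  false _     true  = refl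
  bool true  false _     false = refl
  bool false true  _     true  = refl
  bool false true  _     false = refl
  bool false false true  true  = refl
  bool false false true  false = refl
  bool false false false true  = refl
  bool false false false false = refl

-- Beyond n^m words, two words differ in the position `x` alone, for every `x`. So all complements
-- of single positions are kernels, and every set is an intersection of these.
dense⇒kernels : ∀ {n m q C} {X : Family n (suc m)} (hom : Homogeneous q X C) → suc m ≤ q →
  n ^ m < count (Homogeneous.core hom) → ∀ I → I ∈ˡ Homogeneous.J hom
dense⇒kernels {n} {m} hom r≤q large I = meet∈J I separate
  where
  open Homogeneous hom
  inhabited = inhabited-of-large core (≤-<-trans z≤n large)
  open Kernels hom r≤q (proj₁ inhabited) (proj₂ inhabited)
  instance
    n≥1 : NonZero n
    n≥1 = inhabited⇒nonZero (lookup (proj₁ inhabited) zero)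
  separate : ∀ x → x ∉ I → ∃[ K ] K ∈ˡ J × I ⊆ K × x ∉ K
  separate x x∉ with cover (⊤ - x) (≤-<-trans (^-monoʳ-≤ n off≤) large)
    where
    off≤ : ∣ ⊤ {suc m} - x ∣ ≤ m
    off≤ = ≤-pred (≤-trans (x∈p⇒∣p-x∣<∣p∣ {p = ⊤ {suc m}} (∈⊤ {x = x})) (≤-reflexive (∣⊤∣≡n (suc m))))
  ... | K , K∈ , ⊆K , y , y∉ = K , K∈ ,
        (λ {i} i∈ → ⊆K (x∈p∧x≢y⇒x∈p-y ∈⊤ (λ { refl → x∉ i∈ }))) ,
        λ x∈ → y∉ (⊆K (x∈p∧x≢y⇒x∈p-y ∈⊤ (λ { refl → y∉ x∈ })))

-- Requiring `D` to miss all of `L`, and not only `v`, keeps the vertices of `L` placed in different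
-- V_j apart from every other letter of the blowup. It costs only the edges that meet `L` at least
-- twice.
isCentre : ∀ {n} → (Subset n → Bool) → Subset n → Subset n → Fin n → Bool
isCentre E L D v = does (v ∈? L) ∧ (E (⁅ v ⁆ ∪ D) ∧ not (does (nonempty? (D ∩ L))))

centres : ∀ {n} → (Subset n → Bool) → Subset n → Subset n → Subset n
centres E L D = tabulate (isCentre E L D)

∈-centres⁻ : ∀ {n} (E : Subset n → Bool) L D {v} → v ∈ centres E L D →
  v ∈ L × E (⁅ v ⁆ ∪ D) ≡ true × Empty (D ∩ L)
∈-centres⁻ E L D {v} v∈ with ∧-true⁻ {does (v ∈? L)} (∈-tabulate⁻ (isCentre E L D) v∈)
... | v∈L , rest with ∧-true⁻ {E (⁅ v ⁆ ∪ D)} rest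
... | e , off = does-true⁻ (v ∈? L) v∈L , e , does-false⁻ (nonempty? (D ∩ L)) off

-- The word (y, y', W) stands for the two words (y, W) and (y', W).
choose : ∀ {n k} → Bool → Word n (2 + k) → Word n (1 + k)
choose true  (y ∷ y' ∷ w) = y ∷ w
choose false (y ∷ y' ∷ w) = y' ∷ w

chosen : ∀ {k} → Bool → Subset k → Subset (2 + k)
chosen true  R = true ∷ false ∷ R
chosen false R = false ∷ true ∷ R

∣chosen∣ : ∀ {k} b (R : Subset k) → ∣ chosen b R ∣ ≡ suc ∣ R ∣
∣chosen∣ true  R = refl
∣chosen∣ false R = refl

chosen-disjoint : ∀ {k} b (A : Subset k) {i} → i ∈ (false ∷ false ∷ A) → i ∉ chosen b (∁ A)
chosen-disjoint true  A (Data.Vec.there (Data.Vec.there i∈)) (Data.Vec.there (Data.Vec.there i∈')) = x∈p⇒x∉∁p i∈ i∈'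
chosen-disjoint false A (Data.Vec.there (Data.Vec.there i∈)) (Data.Vec.there (Data.Vec.there i∈')) = x∈p⇒x∉∁p i∈ i∈'

wordSet-choose : ∀ {n k} b (w : Word n (2 + k)) (A : Subset k) v →
  image w (false ∷ false ∷ A) ∪ (image w (chosen b (∁ A)) ∪ ⁅ v ⁆) ≡ ⁅ v ⁆ ∪ wordSet (choose b w)
wordSet-choose true  (y ∷ y' ∷ w) A v = trans (∪-shuffle (image w A) ⁅ y ⁆ (image w (∁ A)) ⁅ v ⁆)
  (cong (λ e → ⁅ v ⁆ ∪ (⁅ y ⁆ ∪ e)) (wordSet-split w A))
wordSet-choose false (y ∷ y' ∷ w) A v = trans (∪-shuffle (image w A) ⁅ y' ⁆ (image w (∁ A)) ⁅ v ⁆)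
  (cong (λ e → ⁅ v ⁆ ∪ (⁅ y' ⁆ ∪ e)) (wordSet-split w A))

image⊆choose : ∀ {n k} b (w : Word n (2 + k)) (A : Subset k) {v} → v ∈ image w (false ∷ false ∷ A) → v ∈ wordSet (choose b w)
image⊆choose b (y ∷ y' ∷ w) A v∈ with ∈-image⁻ w A v∈
image⊆choose true  (y ∷ y' ∷ w) A v∈ | i , i∈ , refl = x∈p∪q⁺ (inj₂ (∈-image⁺ w (∈⊤ {x = i})))
image⊆choose false (y ∷ y' ∷ w) A v∈ | i , i∈ , refl = x∈p∪q⁺ (inj₂ (∈-image⁺ w (∈⊤ {x = i})))

chosen⊆choose : ∀ {n k} b (w : Word n (2 + k)) (R : Subset k) {v} → v ∈ image w (chosen b R) → v ∈ wordSet (choose b w)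
chosen⊆choose true (y ∷ y' ∷ w) R v∈ with x∈p∪q⁻ ⁅ y ⁆ (image w R) v∈
... | inj₁ v∈y = x∈p∪q⁺ (inj₁ v∈y)
... | inj₂ v∈' with ∈-image⁻ w R v∈'
...   | i , _ , refl = x∈p∪q⁺ (inj₂ (∈-image⁺ w (∈⊤ {x = i})))
chosen⊆choose false (y ∷ y' ∷ w) R v∈ with x∈p∪q⁻ ⁅ y' ⁆ (image w R) v∈
... | inj₁ v∈y = x∈p∪q⁺ (inj₁ v∈y)
... | inj₂ v∈' with ∈-image⁻ w R v∈'
...   | i , _ , refl = x∈p∪q⁺ (inj₂ (∈-image⁺ w (∈⊤ {x = i})))

module _ {s t : ℕ} (T : BipGraph s t) (tree : IsTree T) (i₀ : Fin s) (j₀ : Fin t) (a b k : ℕ)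
  (a+b≡r : a + b ≡ 2 + k) (a≤k : a ≤ k)
  {n} (E : Subset n → Bool) (uni : Uniform (a + b) E) (L : Subset n) where

  -- A pattern prescribes for each V_j a vertex of `L` and which of the words (y, W) and (y', W) has
  -- this vertex as a centre.
  Pattern : Set
  Pattern = Vec (Fin n × Bool) t

  vertex : Pattern → Fin t → Fin n
  vertex σ j = proj₁ (lookup σ j)

  side : Pattern → Fin t → Bool
  side σ j = proj₂ (lookup σ j)

  Distinct : Pattern → Set
  Distinct σ = ∀ j j' → j ≢ j' → vertex σ j ≢ vertex σ j'

  distinct? : ∀ σ → Dec (Distinct σ)
  distinct? σ = Fin.all? (λ j → Fin.all? (λ j' → ¬? (j Fin.≟ j') →-dec ¬? (vertex σ j Fin.≟ vertex σ j')))

  Fits : Pattern → Word n (2 + k) → Set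
  Fits σ w = ∀ j → vertex σ j ∈ centres E L (wordSet (choose (side σ j) w))

  fits? : ∀ σ w → Dec (Fits σ w)
  fits? σ w = Fin.all? (λ j → vertex σ j ∈? centres E L (wordSet (choose (side σ j) w)))

  fitting : Pattern → Family n (2 + k)
  fitting σ w = does (distinct? σ) ∧ does (fits? σ w)

  fitting⁻ : ∀ σ w → fitting σ w ≡ true → Distinct σ × Fits σ w
  fitting⁻ σ w p with ∧-true⁻ {does (distinct? σ)} p
  ... | d , f = does-true⁻ (distinct? σ) d , does-true⁻ (fits? σ w) f

  -- All sets of positions are kernels here. Each U_i takes a positions of W. Each V_j takes the
  -- other k - a = b - 2 positions of W, the letter y or y' according to the side of j, and its
  -- fixed vertex of `L`. Thus `A` is common to both sides, and every edge is a chosen word plus a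
  -- centre of it.
  pattern⇒copy : ∀ σ {C} (hom : Homogeneous ((s + t) * (2 + k)) (fitting σ) C) →
    n ^ (1 + k) < count (Homogeneous.core hom) → Copy T a b E
  pattern⇒copy σ hom large = flexible⇒copy T tree i₀ j₀ E uni core A B X
    (λ j → chosen-disjoint (side σ j) A₀) (≤-reflexive A₀≡a) B≤
    (flexible A (kernels A)) (λ j → flexible (B j) (kernels (B j)))
    E∈ X-disj AX BX w₀ w₀∈
    where
    open Homogeneous hom
    kernels : ∀ I → I ∈ˡ J
    kernels = dense⇒kernels hom (length≤budget i₀ t (2 + k)) large
    inhabited = inhabited-of-large core (≤-<-trans z≤n large)
    w₀ = proj₁ inhabited
    w₀∈ = proj₂ inhabited
    pick = subset-of-size (⊤ {k}) a (≤-trans a≤k (≤-reflexive (sym (∣⊤∣≡n k))))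
    A₀ : Subset k
    A₀ = proj₁ pick
    A₀≡a : ∣ A₀ ∣ ≡ a
    A₀≡a = proj₂ (proj₂ pick)
    A : Subset (2 + k)
    A = false ∷ false ∷ A₀
    B : Fin t → Subset (2 + k)
    B j = chosen (side σ j) (∁ A₀)
    X : Fin t → Subset n
    X j = ⁅ vertex σ j ⁆
    b≡ : b ≡ 2 + (k ∸ a)
    b≡ = +-cancelˡ-≡ a b _ (trans a+b≡r (trans (cong (2 +_) (sym (m+[n∸m]≡n a≤k))) (rearr a (k ∸ a))))
      where
      rearr : ∀ x y → 2 + (x + y) ≡ x + (2 + y)
      rearr = solve-∀
    B≤ : ∀ j → ∣ B j ∣ + ∣ X j ∣ ≤ b
    B≤ j = ≤-reflexive (trans (cong₂ _+_ (trans (∣chosen∣ (side σ j) (∁ A₀))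
      (cong suc (trans (∣∁p∣≡n∸∣p∣ A₀) (cong (k ∸_) A₀≡a)))) (∣⁅x⁆∣≡1 (vertex σ j)))
      (trans (+-comm (suc (k ∸ a)) 1) (sym b≡)))
    good : ∀ w → core w ≡ true → Distinct σ × Fits σ w
    good w w∈ = fitting⁻ σ w (core⊆ w w∈)
    centre : ∀ w → core w ≡ true → ∀ j → vertex σ j ∈ L ×
      E (⁅ vertex σ j ⁆ ∪ wordSet (choose (side σ j) w)) ≡ true × Empty (wordSet (choose (side σ j) w) ∩ L)
    centre w w∈ j = ∈-centres⁻ E L _ (proj₂ (good w w∈) j)
    E∈ : ∀ w → core w ≡ true → ∀ j → E (image w A ∪ (image w (B j) ∪ X j)) ≡ true
    E∈ w w∈ j = subst (λ e → E e ≡ true) (sym (wordSet-choose (side σ j) w A₀ (vertex σ j)))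
      (proj₁ (proj₂ (centre w w∈ j)))
    X-disj : ∀ j j' → j ≢ j' → Empty (X j ∩ X j')
    X-disj j j' j≢ (v , v∈) with x∈p∩q⁻ (X j) (X j') v∈
    ... | v∈j , v∈j' = proj₁ (good w₀ w₀∈) j j' j≢ (trans (sym (x∈⁅y⁆⇒x≡y _ v∈j)) (x∈⁅y⁆⇒x≡y _ v∈j'))
    outside-L : ∀ w → core w ≡ true → ∀ j j' {v} → v ∈ wordSet (choose (side σ j) w) → v ∉ X j'
    outside-L w w∈ j j' v∈ v∈X with x∈⁅y⁆⇒x≡y (vertex σ j') v∈X
    ... | refl = proj₂ (proj₂ (centre w w∈ j)) (_ , x∈p∩q⁺ (v∈ , proj₁ (centre w w∈ j')))
    AX : ∀ w → core w ≡ true → ∀ j → Empty (image w A ∩ X j)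
    AX w w∈ j (v , v∈) with x∈p∩q⁻ (image w A) (X j) v∈
    ... | v∈A , v∈X = outside-L w w∈ j j (image⊆choose (side σ j) w A₀ v∈A) v∈X
    BX : ∀ w → core w ≡ true → ∀ j j' → Empty (image w (B j) ∩ X j')
    BX w w∈ j j' (v , v∈) with x∈p∩q⁻ (image w (B j)) (X j') v∈
    ... | v∈B , v∈X = outside-L w w∈ j j' (chosen⊆choose (side σ j) w (∁ A₀) v∈B) v∈X

  module _ (free : ¬ Copy T a b E) where

    few-fitting : ∀ σ → count (fitting σ) ≤ furediConstant (s + t) k * n ^ (1 + k)
    few-fitting σ = finish (homogeneous ((s + t) * (2 + k)) (fitting σ))
      where
      finish : Homogeneous ((s + t) * (2 + k)) (fitting σ) (furediConstant (s + t) k) → _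
      finish hom with n ^ (1 + k) <? count (Homogeneous.core hom)
      ... | yes large = ⊥-elim (free (pattern⇒copy σ hom large))
      ... | no ¬large = ≤-trans (Homogeneous.bound hom) (*-monoʳ-≤ (furediConstant (s + t) k) (≮⇒≥ ¬large))

    bothCentres : Word n (2 + k) → Subset n
    bothCentres w = centres E L (wordSet (choose true w)) ∪ centres E L (wordSet (choose false w))

    crowded : Family n (2 + k)
    crowded w = does (t ≤? ∣ bothCentres w ∣)

    marked : List (Fin n × Bool)
    marked = cartesianProduct (elements L) (true ∷ false ∷ [])

    crowded⇒fits : ∀ w → t ≤ ∣ bothCentres w ∣ → ∃[ σ ] σ ∈ˡ tuples marked t × fitting σ w ≡ true
    crowded⇒fits w t≤ with distinct-tuple t (bothCentres w) t≤
    ... | τ , τ∈ , dist = σ , ∈-tuples σ σ∈ , ∧-true (does-true (distinct? σ) σ-dist) (does-true (fits? σ w) σ-fits)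
      where
      located : ∀ j → ∃[ b ] lookup τ j ∈ centres E L (wordSet (choose b w))
      located j with x∈p∪q⁻ (centres E L (wordSet (choose true w))) _ (τ∈ j)
      ... | inj₁ p = true , p
      ... | inj₂ p = false , p
      entry : Fin t → Fin n × Bool
      entry j = lookup τ j , proj₁ (located j)
      σ : Pattern
      σ = tabulate entry
      σ≡ : ∀ j → lookup σ j ≡ entry j
      σ≡ = lookup∘tabulate entry
      σ∈ : ∀ j → lookup σ j ∈ˡ marked
      σ∈ j = subst (_∈ˡ marked) (sym (σ≡ j)) (∈-cartesianProduct⁺
        (∈-elements (proj₁ (∈-centres⁻ E L _ (proj₂ (located j))))) (∈-bools _))
      σ-dist : Distinct σ
      σ-dist j j' j≢ eq = dist j j' j≢ (trans (sym (cong proj₁ (σ≡ j))) (trans eq (cong proj₁ (σ≡ j'))))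
      σ-fits : Fits σ w
      σ-fits j = subst (λ e → proj₁ e ∈ centres E L (wordSet (choose (proj₂ e) w))) (sym (σ≡ j)) (proj₂ (located j))

    -- A crowded word fits some pattern with entries from `L`, and there are at most (2|L|)^t of
    -- these.
    few-crowded : count crowded ≤ (∣ L ∣ * 2) ^ t * (furediConstant (s + t) k * n ^ (1 + k))
    few-crowded = begin
      count crowded
        ≤⟨ ∑-mono (words n (2 + k)) pointwise ⟩
      ∑ (words n (2 + k)) (λ w → ∑ (tuples marked t) (λ σ → 𝟙 (fitting σ w)))
        ≡⟨ ∑-swap (words n (2 + k)) (tuples marked t) (λ w σ → 𝟙 (fitting σ w)) ⟩
      ∑ (tuples marked t) (λ σ → count (fitting σ))
        ≤⟨ ∑-bound (tuples marked t) (λ σ _ → few-fitting σ) ⟩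
      length (tuples marked t) * (furediConstant (s + t) k * n ^ (1 + k))
        ≡⟨ cong (_* (furediConstant (s + t) k * n ^ (1 + k))) (trans (length-tuples marked t) (cong (_^ t)
             (trans (length-cartesianProduct (elements L) (true ∷ false ∷ [])) (cong (_* 2) (length-elements L))))) ⟩
      (∣ L ∣ * 2) ^ t * (furediConstant (s + t) k * n ^ (1 + k)) ∎
      where
      open ≤-Reasoning
      pointwise : ∀ w → 𝟙 (crowded w) ≤ ∑ (tuples marked t) (λ σ → 𝟙 (fitting σ w))
      pointwise w = 𝟙-cases (λ i → i ≤ ∑ (tuples marked t) (λ σ → 𝟙 (fitting σ w))) (t ≤? ∣ bothCentres w ∣)
        (λ t≤ → let σ , σ∈ , fit = crowded⇒fits w t≤ in
          ≤-trans (𝟙-true fit) (∑-term {xs = tuples marked t} {f = λ σ → 𝟙 (fitting σ w)} σ∈))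
        (λ _ → z≤n)

-- Orderings of edges and almost constant functions

∑-tabulate : ∀ {A : Set} {n} (g : Fin n → A) (f : A → ℕ) → ∑ (Data.List.tabulate g) f ≡ ∑ (allFin n) (f ∘ g)
∑-tabulate {n = zero}  g f = refl
∑-tabulate {n = suc n} g f = cong (f (g zero) +_)
  (trans (∑-tabulate (g ∘ suc) f) (sym (∑-tabulate suc (f ∘ g))))

∑-lookup : ∀ {n} (p : Subset n) → ∑ (allFin n) (λ x → 𝟙 (lookup p x)) ≡ ∣ p ∣
∑-lookup []          = refl
∑-lookup (true ∷ p)  = cong suc (trans (∑-tabulate suc (λ x → 𝟙 (lookup (true ∷ p) x))) (∑-lookup p))
∑-lookup (false ∷ p) = trans (∑-tabulate suc (λ x → 𝟙 (lookup (false ∷ p) x))) (∑-lookup p)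

∣tabulate∣ : ∀ {n} (f : Fin n → Bool) → ∣ tabulate f ∣ ≡ ∑ (allFin n) (𝟙 ∘ f)
∣tabulate∣ {n} f = trans (sym (∑-lookup (tabulate f))) (∑-cong (allFin n) (λ x → cong 𝟙 (lookup∘tabulate f x)))

∣p-x∣ : ∀ {n} {p : Subset n} {x} → x ∈ p → ∣ p ∣ ≡ suc ∣ p - x ∣
∣p-x∣ {p = p} {x} x∈ = ≤-antisym (∣p∣≤1+∣p-x∣ p x) (x∈p⇒∣p-x∣<∣p∣ x∈)

⁅x⁆∪p-x : ∀ {n} {p : Subset n} {x} → x ∈ p → ⁅ x ⁆ ∪ (p - x) ≡ p
⁅x⁆∪p-x {p = p} {x} x∈ = ⊆-antisym fwd bwd
  where
  fwd : ⁅ x ⁆ ∪ (p - x) ⊆ p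
  fwd y∈ with x∈p∪q⁻ ⁅ x ⁆ (p - x) y∈
  ... | inj₁ y∈x = subst (_∈ p) (sym (x∈⁅y⁆⇒x≡y x y∈x)) x∈
  ... | inj₂ y∈' = p─q⊆p p ⁅ x ⁆ y∈'
  bwd : p ⊆ ⁅ x ⁆ ∪ (p - x)
  bwd {y} y∈ with y Fin.≟ x
  ... | yes refl = x∈p∪q⁺ (inj₁ (x∈⁅x⁆ x))
  ... | no y≢x   = x∈p∪q⁺ (inj₂ (x∈p∧x≢y⇒x∈p-y y∈ y≢x))

∣wordSet∣≤ : ∀ {n m} (w : Word n m) → ∣ wordSet w ∣ ≤ m
∣wordSet∣≤ {m = m} w = ≤-trans (∣image∣≤ w ⊤) (≤-reflexive (∣⊤∣≡n m))

spelling : ∀ {n m} → Subset n → Family n m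
spelling X w = does (wordSet w ≟ˢ X)

-- The letter `x` cannot recur in `w`, for then the m letters of `w` would already cover the m + 1
-- elements of `X`.
spelling-cons : ∀ {n m} {X : Subset n} {x} → ∣ X ∣ ≡ suc m → x ∈ X → (w : Word n m) →
  spelling X (x ∷ w) ≡ spelling (X - x) w
spelling-cons {m = m} {X} {x} X≡ x∈ w with wordSet w ≟ˢ (X - x)
... | yes eq = does-true (⁅ x ⁆ ∪ wordSet w ≟ˢ X) (trans (cong (⁅ x ⁆ ∪_) eq) (⁅x⁆∪p-x x∈))
... | no ne with ⁅ x ⁆ ∪ wordSet w ≟ˢ X
...   | no _ = refl
...   | yes eq = ⊥-elim (ne (⊆-antisym fwd bwd))
  where
  x∉ : x ∉ wordSet w
  x∉ x∈w = <⇒≱ (≤-reflexive (sym X≡)) (≤-trans (p⊆q⇒∣p∣≤∣q∣ {p = X} {q = wordSet w} sub) (∣wordSet∣≤ w))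
    where
    sub : X ⊆ wordSet w
    sub {y} y∈ with x∈p∪q⁻ ⁅ x ⁆ (wordSet w) (subst (y ∈_) (sym eq) y∈)
    ... | inj₁ y∈x = subst (_∈ wordSet w) (sym (x∈⁅y⁆⇒x≡y x y∈x)) x∈w
    ... | inj₂ y∈w = y∈w
  fwd : wordSet w ⊆ X - x
  fwd {y} y∈ = x∈p∧x≢y⇒x∈p-y (subst (y ∈_) eq (x∈p∪q⁺ (inj₂ y∈))) (λ { refl → x∉ y∈ })
  bwd : X - x ⊆ wordSet w
  bwd {y} y∈ with x∈p∪q⁻ ⁅ x ⁆ (wordSet w) (subst (y ∈_) (sym eq) (p─q⊆p X ⁅ x ⁆ y∈))
  ... | inj₂ y∈w = y∈w
  ... | inj₁ y∈x with x∈⁅y⁆⇒x≡y x y∈x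
  ...   | refl = ⊥-elim (x∉p-x X x y∈)

count-spelling : ∀ {n} m (X : Subset n) → ∣ X ∣ ≡ m → count {n} {m} (spelling X) ≡ m !
count-spelling {n} zero X X≡0 = trans (+-identityʳ _)
  (cong 𝟙 (does-true (⊥ ≟ˢ X) (sym (Empty-unique (∣p∣≡0⇒Empty X≡0)))))
count-spelling {n} (suc m) X X≡ = begin
  count {n} {suc m} (spelling X)                                       ≡⟨ count-suc (spelling {n} {suc m} X) ⟩
  ∑ (allFin n) (λ x → count {n} {m} (λ w → spelling X (x ∷ w))) ≡⟨ ∑-cong (allFin n) each ⟩
  ∑ (allFin n) (λ x → m ! * 𝟙 (lookup X x))                ≡⟨ ∑-*ˡ (allFin n) (m !) _ ⟩
  m ! * ∑ (allFin n) (λ x → 𝟙 (lookup X x))                ≡⟨ cong (m ! *_) (trans (∑-lookup X) X≡) ⟩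
  m ! * suc m                                              ≡⟨ *-comm (m !) (suc m) ⟩
  suc m !                                                  ∎
  where
  open ≡-Reasoning
  each : ∀ x → count {n} {m} (λ w → spelling X (x ∷ w)) ≡ m ! * 𝟙 (lookup X x)
  each x with lookup X x in eq
  ... | true = trans (∑-cong (words n m) (λ w → cong 𝟙 (spelling-cons X≡ x∈ w)))
                 (trans (count-spelling m (X - x) (suc-injective (trans (sym (∣p-x∣ x∈)) X≡))) (sym (*-identityʳ (m !))))
    where x∈ = lookup⇒[]= x X eq
  ... | false = trans (∑-zero (words n m) none) (sym (*-zeroʳ (m !)))
    where
    none : ∀ (w : Word n m) → 𝟙 (spelling X (x ∷ w)) ≡ 0
    none w with ⁅ x ⁆ ∪ wordSet w ≟ˢ X
    ... | no _ = refl
    ... | yes X≡' with trans (sym eq) ([]=⇒lookup (subst (x ∈_) X≡' (x∈p∪q⁺ {p = ⁅ x ⁆} {q = wordSet w} (inj₁ (x∈⁅x⁆ x)))))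
    ...   | ()

module EdgeLists {n : ℕ} (es : List (Subset n)) (unique : Unique es) where

  open DecMem (_≟ˢ_ {n}) public using () renaming (_∈?_ to _∈ᵉ?_)

  isEdge : Subset n → Bool
  isEdge e = does (e ∈ᵉ? es)

  -- Double counting of edges and their orderings in `Y`: a word spells at most one edge.
  edge-counting : ∀ {m} M (P : Subset n → Bool) (Y : Family n m) →
    (∀ e → e ∈ˡ es → P e ≡ true → M ≤ count {n} {m} (λ w → Y w ∧ spelling e w)) →
    M * ∑ es (𝟙 ∘ P) ≤ count {n} {m} (λ w → Y w ∧ isEdge (wordSet w))
  edge-counting {m} M P Y each = begin
    M * ∑ es (𝟙 ∘ P)                                         ≡⟨ sym (∑-*ˡ es M _) ⟩
    ∑ es (λ e → M * 𝟙 (P e))                                 ≤⟨ ∑-mono-∈ es each' ⟩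
    ∑ es (λ e → ∑ (words n m) (λ w → 𝟙 (Y w ∧ spelling e w)))  ≡⟨ ∑-swap es (words n m) _ ⟩
    ∑ (words n m) (λ w → ∑ es (λ e → 𝟙 (Y w ∧ spelling e w)))  ≤⟨ ∑-mono (words n m) collapse ⟩
    count (λ w → Y w ∧ isEdge (wordSet w))                   ∎
    where
    open ≤-Reasoning
    each' : ∀ e → e ∈ˡ es → M * 𝟙 (P e) ≤ count {n} {m} (λ w → Y w ∧ spelling e w)
    each' e e∈ with P e in Pe
    ... | true  = ≤-trans (≤-reflexive (*-identityʳ M)) (each e e∈ Pe)
    ... | false = ≤-trans (≤-reflexive (*-zeroʳ M)) z≤n
    collapse : ∀ w → ∑ es (λ e → 𝟙 (Y w ∧ spelling e w)) ≤ 𝟙 (Y w ∧ isEdge (wordSet w))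
    collapse w with Y w
    ... | false = ≤-reflexive (∑-zero es (λ _ → refl))
    ... | true = ≤-trans (∑-mono-∈ es {g = λ e → 𝟙 (does (wordSet w ≟ˢ e) ∧ isEdge (wordSet w))} member)
        (∑-at-most-one unique (λ e → does (wordSet w ≟ˢ e) ∧ isEdge (wordSet w)) (isEdge (wordSet w))
          (λ e e' p p' → trans (sym (does-true⁻ (wordSet w ≟ˢ e) (proj₁ (∧-true⁻ p)))) (does-true⁻ (wordSet w ≟ˢ e') (proj₁ (∧-true⁻ p'))))
          (λ e p → proj₂ (∧-true⁻ {does (wordSet w ≟ˢ e)} p)))
      where
      member : ∀ e → e ∈ˡ es → 𝟙 (spelling e w) ≤ 𝟙 (does (wordSet w ≟ˢ e) ∧ isEdge (wordSet w))
      member e e∈ = 𝟙-mono λ p → ∧-true p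
        (does-true (wordSet w ∈ᵉ? es) (subst (_∈ˡ es) (sym (does-true⁻ (wordSet w ≟ˢ e) p)) e∈))

  words-of-edges : ∀ {m} → All (λ e → ∣ e ∣ ≡ m) es → count {n} {m} (λ w → isEdge (wordSet w)) ≤ m ! * length es
  words-of-edges {m} uniform = begin
    count {n} {m} (λ w → isEdge (wordSet w))                     ≤⟨ ∑-mono (words n m) spread ⟩
    ∑ (words n m) (λ w → ∑ es (λ e → 𝟙 (spelling e w)))          ≡⟨ ∑-swap (words n m) es _ ⟩
    ∑ es (λ e → count {n} {m} (spelling e))                      ≤⟨ ∑-bound es (λ e e∈ → ≤-reflexive (count-spelling m e (All.lookup uniform e∈))) ⟩
    length es * m !                                              ≡⟨ *-comm (length es) (m !) ⟩
    m ! * length es                                              ∎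
    where
    open ≤-Reasoning
    spread : ∀ w → 𝟙 (isEdge (wordSet w)) ≤ ∑ es (λ e → 𝟙 (spelling e w))
    spread w = 𝟙-cases (λ i → i ≤ ∑ es (λ e → 𝟙 (spelling e w))) (wordSet w ∈ᵉ? es)
      (λ e∈ → ≤-trans (𝟙-true (does-true (wordSet w ≟ˢ wordSet w) refl)) (∑-term {f = λ e → 𝟙 (spelling e w)} e∈))
      (λ _ → z≤n)

-- Functions that rarely change when one letter is replaced.

differ : ∀ {n} → Subset n → Subset n → ℕ
differ p q = 𝟙 (not (does (p ≟ˢ q)))

differ-refl : ∀ {n} (p : Subset n) → differ p p ≡ 0
differ-refl p = cong (λ b → 𝟙 (not b)) (does-true (p ≟ˢ p) refl)

differ-triangle : ∀ {n} (p q r : Subset n) → differ p r ≤ differ p q + differ q r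
differ-triangle p q r with p ≟ˢ q
... | yes refl = ≤-refl
... | no _ = ≤-trans (𝟙≤1 _) (m≤m+n 1 _)

changes : ∀ {n} k → (Subset n → Subset n) → ℕ
changes {n} k c = ∑ (words n (2 + k)) (λ w → differ (c (wordSet (choose true w))) (c (wordSet (choose false w))))

changes-expand : ∀ {n} k (c : Subset n → Subset n) → changes k c ≡
  ∑ (words n k) (λ w → ∑ (allFin n) (λ y → ∑ (allFin n) (λ y' → differ (c (⁅ y ⁆ ∪ wordSet w)) (c (⁅ y' ⁆ ∪ wordSet w)))))
changes-expand {n} k c = begin
  changes k c
    ≡⟨ ∑-tuples-suc (allFin n) (suc k) _ ⟩
  ∑ (allFin n) (λ y → ∑ (words n (suc k)) (λ w → differ (c (wordSet (choose true (y ∷ w)))) (c (wordSet (choose false (y ∷ w))))))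
    ≡⟨ ∑-cong (allFin n) (λ y → ∑-tuples-suc (allFin n) k _) ⟩
  ∑ (allFin n) (λ y → ∑ (allFin n) (λ y' → ∑ (words n k) (λ w → d y y' w)))
    ≡⟨ ∑-cong (allFin n) (λ y → ∑-swap (allFin n) (words n k) (d y)) ⟩
  ∑ (allFin n) (λ y → ∑ (words n k) (λ w → ∑ (allFin n) (λ y' → d y y' w)))
    ≡⟨ ∑-swap (allFin n) (words n k) (λ y w → ∑ (allFin n) (λ y' → d y y' w)) ⟩
  ∑ (words n k) (λ w → ∑ (allFin n) (λ y → ∑ (allFin n) (λ y' → d y y' w))) ∎
  where
  open ≡-Reasoning
  d : Fin n → Fin n → Word n k → ℕ
  d y y' w = differ (c (⁅ y ⁆ ∪ wordSet w)) (c (⁅ y' ⁆ ∪ wordSet w))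

∪-swap : ∀ {n} (p q r : Subset n) → p ∪ (q ∪ r) ≡ q ∪ (p ∪ r)
∪-swap p q r = trans (sym (∪-assoc p q r)) (trans (cong (_∪ r) (∪-comm p q)) (∪-assoc q p r))

-- Since `c` sees only the set of letters, the changed letter may be moved past the fixed letter
-- `x`.
changes-suc : ∀ {n} k (c : Subset n → Subset n) →
  ∑ (allFin n) (λ x → changes k (λ p → c (⁅ x ⁆ ∪ p))) ≡ changes (suc k) c
changes-suc {n} k c = sym (begin
  changes (suc k) c
    ≡⟨ changes-expand (suc k) c ⟩
  ∑ (words n (suc k)) (λ w → ∑ (allFin n) (λ y → ∑ (allFin n) (λ y' → differ (c (⁅ y ⁆ ∪ wordSet w)) (c (⁅ y' ⁆ ∪ wordSet w)))))
    ≡⟨ ∑-tuples-suc (allFin n) k _ ⟩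
  ∑ (allFin n) (λ x → ∑ (words n k) (λ w → ∑ (allFin n) (λ y → ∑ (allFin n) (λ y' → differ (c (⁅ y ⁆ ∪ (⁅ x ⁆ ∪ wordSet w))) (c (⁅ y' ⁆ ∪ (⁅ x ⁆ ∪ wordSet w)))))))
    ≡⟨ ∑-cong (allFin n) (λ x → trans (∑-cong (words n k) (λ w → ∑-cong (allFin n) (λ y → ∑-cong (allFin n) (λ y' →
         cong₂ (λ p q → differ (c p) (c q)) (∪-swap ⁅ y ⁆ ⁅ x ⁆ (wordSet w)) (∪-swap ⁅ y' ⁆ ⁅ x ⁆ (wordSet w))))))
         (sym (changes-expand k (λ p → c (⁅ x ⁆ ∪ p))))) ⟩
  ∑ (allFin n) (λ x → changes k (λ p → c (⁅ x ⁆ ∪ p))) ∎)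
  where open ≡-Reasoning

disagreements : ∀ {n} m → (Subset n → Subset n) → ℕ
disagreements {n} m c = ∑ (words n m) (λ w → ∑ (words n m) (λ w' → differ (c (wordSet w)) (c (wordSet w'))))

-- Replace the letters one at a time.
disagreements-step : ∀ {n} k (c : Subset n → Subset n) →
  disagreements (suc k) c ≤ n ^ k * changes k c + n * ∑ (allFin n) (λ x → disagreements k (λ p → c (⁅ x ⁆ ∪ p)))
disagreements-step {n} k c = begin
  disagreements (suc k) c
    ≡⟨ trans (∑-tuples-suc (allFin n) k _) (∑-cong (allFin n) (λ x → ∑-cong (words n k) (λ w → ∑-tuples-suc (allFin n) k _))) ⟩
  ∑ F (λ x → ∑ W (λ w → ∑ F (λ x' → ∑ W (λ w' → differ (f x w) (f x' w')))))
    ≤⟨ ∑-mono F (λ x → ∑-mono W (λ w → ∑-mono F (λ x' → ∑-mono W (λ w' → differ-triangle (f x w) (f x' w) (f x' w'))))) ⟩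
  ∑ F (λ x → ∑ W (λ w → ∑ F (λ x' → ∑ W (λ w' → differ (f x w) (f x' w) + differ (f x' w) (f x' w')))))
    ≡⟨ ∑-cong F (λ x → trans (∑-cong W (λ w → trans (∑-cong F (λ x' → ∑-+ W _ _)) (∑-+ F _ _))) (∑-+ W _ _)) ⟩
  ∑ F (λ x → ∑ W (λ w → ∑ F (λ x' → ∑ W (λ w' → differ (f x w) (f x' w)))) + second)
    ≡⟨ ∑-+ F _ _ ⟩
  ∑ F (λ x → ∑ W (λ w → ∑ F (λ x' → ∑ W (λ w' → differ (f x w) (f x' w))))) + ∑ F (λ x → second)
    ≡⟨ cong₂ _+_ first-eq second-eq ⟩
  n ^ k * changes k c + n * ∑ F (λ x → disagreements k (λ p → c (⁅ x ⁆ ∪ p))) ∎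
  where
  open ≤-Reasoning
  F = allFin n
  W = words n k
  f : Fin n → Word n k → Subset n
  f x w = c (⁅ x ⁆ ∪ wordSet w)
  second : ℕ
  second = ∑ W (λ w → ∑ F (λ x' → ∑ W (λ w' → differ (f x' w) (f x' w'))))
  second-eq : ∑ F (λ x → second) ≡ n * ∑ F (λ x → disagreements k (λ p → c (⁅ x ⁆ ∪ p)))
  second-eq = trans (∑-const F second) (cong₂ _*_ (length-allFin n)
    (∑-swap W F (λ w x' → ∑ W (λ w' → differ (f x' w) (f x' w')))))
  first-eq : ∑ F (λ x → ∑ W (λ w → ∑ F (λ x' → ∑ W (λ w' → differ (f x w) (f x' w))))) ≡ n ^ k * changes k c
  first-eq = trans
    (∑-cong F (λ x → trans (∑-cong W (λ w → trans (∑-cong F (λ x' →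
      trans (∑-const W _) (cong (_* differ (f x w) (f x' w)) (length-words n k)))) (∑-*ˡ F (n ^ k) _))) (∑-*ˡ W (n ^ k) _)))
    (trans (∑-*ˡ F (n ^ k) _) (cong (n ^ k *_)
      (trans (∑-swap F W (λ x w → ∑ F (λ x' → differ (f x w) (f x' w)))) (sym (changes-expand k c)))))

-- Each of the `suc k` single-letter replacements contributes at most `n ^ k * changes k c`: a
-- changed word (y, y', W) leaves k letters of the pair of words free.
disagreements-bound : ∀ {n} k (c : Subset n → Subset n) →
  disagreements (suc k) c ≤ suc k * n ^ k * changes k c
disagreements-bound {n} zero c = begin
  disagreements 1 c                     ≤⟨ disagreements-step 0 c ⟩
  1 * changes 0 c + n * ∑ (allFin n) (λ x → disagreements 0 (λ p → c (⁅ x ⁆ ∪ p)))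
    ≡⟨ cong (1 * changes 0 c +_) (trans (cong (n *_) (∑-zero (allFin n) (λ x → trans (+-identityʳ _) (trans (+-identityʳ _) (differ-refl (c (⁅ x ⁆ ∪ ⊥))))))) (*-zeroʳ n)) ⟩
  1 * changes 0 c + 0                   ≡⟨ +-identityʳ _ ⟩
  1 * changes 0 c                       ∎
  where open ≤-Reasoning
disagreements-bound {n} (suc k) c = begin
  disagreements (2 + k) c
    ≤⟨ disagreements-step (suc k) c ⟩
  n ^ suc k * changes (suc k) c + n * ∑ (allFin n) (λ x → disagreements (suc k) (λ p → c (⁅ x ⁆ ∪ p)))
    ≤⟨ +-monoʳ-≤ _ (*-monoʳ-≤ n (∑-mono (allFin n) (λ x → disagreements-bound k (λ p → c (⁅ x ⁆ ∪ p))))) ⟩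
  n ^ suc k * changes (suc k) c + n * ∑ (allFin n) (λ x → suc k * n ^ k * changes k (λ p → c (⁅ x ⁆ ∪ p)))
    ≡⟨ cong (λ z → n ^ suc k * changes (suc k) c + n * z) (trans (∑-*ˡ (allFin n) (suc k * n ^ k) _) (cong (suc k * n ^ k *_) (changes-suc k c))) ⟩
  n ^ suc k * changes (suc k) c + n * (suc k * n ^ k * changes (suc k) c)
    ≡⟨ rearr n (n ^ k) (suc k) (changes (suc k) c) ⟩
  (2 + k) * n ^ suc k * changes (suc k) c ∎
  where
  open ≤-Reasoning
  rearr : ∀ x y z d → x * y * d + x * (z * y * d) ≡ (suc z) * (x * y) * d
  rearr = solve-∀

-- Edge counts relative to the set L

p⊆q∧∣q∣≤∣p∣⇒p≡q : ∀ {n} {p q : Subset n} → p ⊆ q → ∣ q ∣ ≤ ∣ p ∣ → p ≡ q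
p⊆q∧∣q∣≤∣p∣⇒p≡q {p = p} {q} p⊆q q≤p = ⊆-antisym p⊆q λ {x} x∈ →
  decidable-stable (x ∈? p) (λ x∉ → <⇒≱ (p⊂q⇒∣p∣<∣q∣ (p⊆q , x , x∈ , x∉)) q≤p)

count-slice : ∀ {n m} (X : Family n (suc m)) x → count (λ w → X (x ∷ w)) ≤ count X
count-slice {n} X x = ≤-trans (∑-term {f = λ x → count (λ w → X (x ∷ w))} (∈-allFin x)) (≤-reflexive (sym (count-suc X)))

∑-minimal′ : ∀ {A : Set} (xs : List A) (f : A → ℕ) → 1 ≤ length xs → ∃[ x ] length xs * f x ≤ ∑ xs f
∑-minimal′ (x ∷ xs) f _ = ∑-minimal x xs f

∑-choose : ∀ {n k} b (f : Word n (1 + k) → ℕ) → ∑ (words n (2 + k)) (f ∘ choose b) ≡ n * ∑ (words n (1 + k)) f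
∑-choose {n} {k} b f = trans (∑-tuples-suc (allFin n) (suc k) (f ∘ choose b))
  (trans (∑-cong (allFin n) (λ y → ∑-tuples-suc (allFin n) k (λ w → f (choose b (y ∷ w))))) (go b))
  where
  slice : Fin n → ℕ
  slice y = ∑ (words n k) (λ w → f (y ∷ w))
  fold : n * ∑ (allFin n) slice ≡ n * ∑ (words n (1 + k)) f
  fold = cong (n *_) (sym (∑-tuples-suc (allFin n) k f))
  go : ∀ b → ∑ (allFin n) (λ y → ∑ (allFin n) (λ y' → ∑ (words n k) (λ w → f (choose b (y ∷ y' ∷ w))))) ≡ n * ∑ (words n (1 + k)) f
  go true  = trans (∑-cong (allFin n) (λ y → trans (∑-const (allFin n) (slice y)) (cong (_* slice y) (length-allFin n))))
                   (trans (∑-*ˡ (allFin n) n slice) fold)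
  go false = trans (∑-const (allFin n) (∑ (allFin n) slice)) (trans (cong (_* ∑ (allFin n) slice) (length-allFin n)) fold)

module Stability {s t' : ℕ} (T : BipGraph s (suc t')) (tree : IsTree T) (i₀ : Fin s) (a b k : ℕ)
  (a+b≡r : a + b ≡ 2 + k) (2≤b : 2 ≤ b) (b<a : b < a) (a≤k : a ≤ k)
  {n : ℕ} (es : List (Subset n)) (unique-es : Unique es) (uniform-es : All (λ e → ∣ e ∣ ≡ 2 + k) es) where

  open EdgeLists es unique-es

  m : ℕ
  m = suc k

  E : Subset n → Bool
  E = isEdge

  uni : Uniform (a + b) E
  uni e p = trans (All.lookup uniform-es (does-true⁻ (e ∈ᵉ? es) p)) (sym a+b≡r)

  module _ (h : ℕ) where

    degree : Fin n → ℕ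
    degree v = count {n} {m} (λ w → E (⁅ v ⁆ ∪ wordSet w))

    popular? : ∀ v → Dec (h ^ m ≤ degree v)
    popular? v = h ^ m ≤? degree v

    popular : Subset n
    popular = tabulate (λ v → does (popular? v))

    -- The degrees sum to the number of orderings of edges. For `h` proportional to n this bounds
    -- the number of popular vertices independently of n.
    few-popular : ∣ popular ∣ * h ^ m ≤ (2 + k) ! * length es
    few-popular = begin
      ∣ popular ∣ * h ^ m                                  ≡⟨ trans (cong (_* h ^ m) (∣tabulate∣ (λ v → does (popular? v)))) (*-comm _ (h ^ m)) ⟩
      h ^ m * ∑ (allFin n) (λ v → 𝟙 (does (popular? v)))    ≡⟨ sym (∑-*ˡ (allFin n) (h ^ m) _) ⟩
      ∑ (allFin n) (λ v → h ^ m * 𝟙 (does (popular? v)))    ≤⟨ ∑-mono (allFin n) (λ v → 𝟙-cases (λ i → h ^ m * i ≤ degree v) (popular? v)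
                                                               (≤-trans (≤-reflexive (*-identityʳ (h ^ m)))) (λ _ → ≤-trans (≤-reflexive (*-zeroʳ (h ^ m))) z≤n)) ⟩
      ∑ (allFin n) degree                                  ≡⟨ sym (count-suc {n} {m} (λ w → E (wordSet w))) ⟩
      count {n} {2 + k} (λ w → E (wordSet w))              ≤⟨ words-of-edges uniform-es ⟩
      (2 + k) ! * length es                                ∎
      where open ≤-Reasoning

  module _ (L : Subset n) where

    trace : Subset n → ℕ
    trace e = ∣ e ∩ L ∣

    avoids meetsOnce meetsTwice : Subset n → Bool
    avoids e     = does (trace e ≟ 0)
    meetsOnce e  = does (trace e ≟ 1)
    meetsTwice e = does (2 ≤? trace e)

    avoiding : Subset n → Bool
    avoiding e = avoids e ∧ E e

    edges-split : length es ≤ ∑ es (𝟙 ∘ avoids) + ∑ es (𝟙 ∘ meetsOnce) + ∑ es (𝟙 ∘ meetsTwice)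
    edges-split = ≤-trans (≤-reflexive (length≡∑ es)) (≤-trans (∑-mono es pointwise)
      (≤-reflexive (trans (∑-+ es _ _) (cong (_+ ∑ es (𝟙 ∘ meetsTwice)) (∑-+ es _ _)))))
      where
      cases : ∀ x → 1 ≤ 𝟙 (does (x ≟ 0)) + 𝟙 (does (x ≟ 1)) + 𝟙 (does (2 ≤? x))
      cases 0 = ≤-refl
      cases 1 = ≤-refl
      cases (suc (suc x)) = ≤-refl
      pointwise : ∀ e → 1 ≤ 𝟙 (avoids e) + 𝟙 (meetsOnce e) + 𝟙 (meetsTwice e)
      pointwise e = cases (trace e)

    avoiding-bound : ∑ es (𝟙 ∘ avoids) ≤ count {n} {2 + k} (λ w → avoiding (wordSet w))
    avoiding-bound = ≤-trans (≤-reflexive (sym (*-identityˡ _)))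
      (edge-counting {2 + k} 1 avoids (λ w → avoids (wordSet w)) λ e e∈ p →
        ≤-trans (1≤n! (2 + k)) (≤-trans (≤-reflexive (sym (count-spelling (2 + k) e (All.lookup uniform-es e∈))))
          (count-mono {n} {2 + k} {X = spelling e} (λ w q →
            ∧-true (trans (cong avoids (does-true⁻ (wordSet w ≟ˢ e) q)) p) q))))

    twiceMarked : Family n (2 + k)
    twiceMarked (v ∷ v' ∷ w) = lookup L v ∧ lookup L v'

    -- Such an edge has an ordering that starts with two letters of `L`.
    meetsTwice-bound : ∑ es (𝟙 ∘ meetsTwice) ≤ ∣ L ∣ * ∣ L ∣ * n ^ k
    meetsTwice-bound = begin
      ∑ es (𝟙 ∘ meetsTwice)                                  ≡⟨ sym (*-identityˡ _) ⟩
      1 * ∑ es (𝟙 ∘ meetsTwice)                              ≤⟨ edge-counting {2 + k} 1 meetsTwice twiceMarked each ⟩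
      count (λ w → twiceMarked w ∧ E (wordSet w))            ≤⟨ count-mono {Y = twiceMarked} (λ w p → proj₁ (∧-true⁻ p)) ⟩
      count twiceMarked                                      ≡⟨ trans (count-suc twiceMarked) (∑-cong (allFin n) (λ v → count-suc (λ w → twiceMarked (v ∷ w)))) ⟩
      ∑ (allFin n) (λ v → ∑ (allFin n) (λ v' → ∑ (words n k) (λ w → 𝟙 (lookup L v ∧ lookup L v'))))
                                                             ≡⟨ ∑-cong (allFin n) (λ v → trans (∑-cong (allFin n) (inner v)) (trans (∑-*ˡ (allFin n) (n ^ k * 𝟙 (lookup L v)) _) (cong (n ^ k * 𝟙 (lookup L v) *_) (∑-lookup L)))) ⟩
      ∑ (allFin n) (λ v → n ^ k * 𝟙 (lookup L v) * ∣ L ∣)     ≡⟨ ∑-cong (allFin n) (λ v → rearr (n ^ k) (𝟙 (lookup L v)) ∣ L ∣) ⟩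
      ∑ (allFin n) (λ v → ∣ L ∣ * n ^ k * 𝟙 (lookup L v))     ≡⟨ trans (∑-*ˡ (allFin n) (∣ L ∣ * n ^ k) _) (cong (∣ L ∣ * n ^ k *_) (∑-lookup L)) ⟩
      ∣ L ∣ * n ^ k * ∣ L ∣                                   ≡⟨ rearr' ∣ L ∣ (n ^ k) ⟩
      ∣ L ∣ * ∣ L ∣ * n ^ k                                   ∎
      where
      open ≤-Reasoning
      rearr : ∀ x y z → x * y * z ≡ z * x * y
      rearr = solve-∀
      rearr' : ∀ x y → x * y * x ≡ x * x * y
      rearr' = solve-∀
      inner : ∀ v v' → ∑ (words n k) (λ w → 𝟙 (lookup L v ∧ lookup L v')) ≡ n ^ k * 𝟙 (lookup L v) * 𝟙 (lookup L v')
      inner v v' = trans (∑-const (words n k) _) (trans (cong₂ _*_ (length-words n k) (𝟙-∧ (lookup L v) (lookup L v'))) (sym (*-assoc (n ^ k) _ _)))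
        where
        𝟙-∧ : ∀ b c → 𝟙 (b ∧ c) ≡ 𝟙 b * 𝟙 c
        𝟙-∧ true  c = sym (*-identityˡ (𝟙 c))
        𝟙-∧ false c = refl
      each : ∀ e → e ∈ˡ es → meetsTwice e ≡ true → 1 ≤ count (λ w → twiceMarked w ∧ spelling e w)
      each e e∈ p with does-true⁻ (2 ≤? trace e) p
      ... | two with ∣p∣≥1⇒∃ {p = e ∩ L} (≤-trans (s≤s z≤n) two)
      ... | v , v∈ with another (e ∩ L) v two
      ... | v' , v'∈ , v'≢v = begin
        1                                             ≤⟨ 1≤n! k ⟩
        k !                                           ≡⟨ sym (count-spelling k (e - v - v') size') ⟩
        count {n} {k} (spelling (e - v - v'))                 ≤⟨ count-mono {n} {k} {X = spelling (e - v - v')} {Y = λ w → twiceMarked (v ∷ v' ∷ w) ∧ spelling e (v ∷ v' ∷ w)} sub ⟩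
        count (λ w → twiceMarked (v ∷ v' ∷ w) ∧ spelling e (v ∷ v' ∷ w))
                                                      ≤⟨ count-slice (λ w → twiceMarked (v ∷ w) ∧ spelling e (v ∷ w)) v' ⟩
        count (λ w → twiceMarked (v ∷ w) ∧ spelling e (v ∷ w))
                                                      ≤⟨ count-slice (λ w → twiceMarked w ∧ spelling e w) v ⟩
        count (λ w → twiceMarked w ∧ spelling e w)    ∎
        where
        v∈e = proj₁ (x∈p∩q⁻ e L v∈)
        v'∈e-v = x∈p∧x≢y⇒x∈p-y (proj₁ (x∈p∩q⁻ e L v'∈)) v'≢v
        size' : ∣ e - v - v' ∣ ≡ k
        size' = suc-injective (trans (sym (∣p-x∣ v'∈e-v)) (suc-injective (trans (sym (∣p-x∣ v∈e)) (All.lookup uniform-es e∈))))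
        sub : ∀ (w : Word n k) → spelling (e - v - v') w ≡ true → twiceMarked (v ∷ v' ∷ w) ∧ spelling e (v ∷ v' ∷ w) ≡ true
        sub w q = ∧-true (∧-true ([]=⇒lookup (proj₂ (x∈p∩q⁻ e L v∈))) ([]=⇒lookup (proj₂ (x∈p∩q⁻ e L v'∈))))
          (does-true (⁅ v ⁆ ∪ (⁅ v' ⁆ ∪ wordSet w) ≟ˢ e)
            (trans (cong (λ z → ⁅ v ⁆ ∪ (⁅ v' ⁆ ∪ z)) (does-true⁻ (wordSet w ≟ˢ (e - v - v')) q))
              (trans (cong (⁅ v ⁆ ∪_) (⁅x⁆∪p-x v'∈e-v)) (⁅x⁆∪p-x v∈e))))

    c : Subset n → Subset n
    c = centres E L

    card : Word n m → ℕ
    card w = ∣ c (wordSet w) ∣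

    card≤ : ∀ w → card w ≤ ∣ L ∣
    card≤ w = p⊆q⇒∣p∣≤∣q∣ (λ v∈ → proj₁ (∈-centres⁻ E L (wordSet w) v∈))

    onceMarked : (Fin n → Bool) → Family n (suc m)
    onceMarked f (v ∷ w) = (f v ∧ does (v ∈? L)) ∧ not (does (nonempty? (wordSet w ∩ L)))

    -- With its vertex v of `L` in front, an edge that meets `L` once has m! orderings (v, w), and v
    -- is a centre of w in each. Constant `f` bounds the number of centres from below; `f` as the
    -- complement of S handles the edges that S misses.
    meetsOnce-bound : ∀ (f : Fin n → Bool) (P : Subset n → Bool) →
      (∀ e → P e ≡ true → trace e ≡ 1 × (∀ v → v ∈ e ∩ L → f v ≡ true)) →
      m ! * ∑ es (𝟙 ∘ P) ≤ ∑ (words n m) (λ w → ∑ (allFin n) (λ v → 𝟙 (f v ∧ isCentre E L (wordSet w) v)))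
    meetsOnce-bound f P good = begin
      m ! * ∑ es (𝟙 ∘ P)                                      ≤⟨ edge-counting {suc m} (m !) P (onceMarked f) each ⟩
      count (λ w → onceMarked f w ∧ E (wordSet w))            ≡⟨ count-suc (λ w → onceMarked f w ∧ E (wordSet w)) ⟩
      ∑ (allFin n) (λ v → ∑ (words n m) (λ w → 𝟙 (onceMarked f (v ∷ w) ∧ E (⁅ v ⁆ ∪ wordSet w))))
                                                              ≤⟨ ∑-mono (allFin n) (λ v → ∑-mono (words n m) (λ w → 𝟙-mono
                                                                   (regroup (f v) (does (v ∈? L)) (not (does (nonempty? (wordSet w ∩ L)))) (E (⁅ v ⁆ ∪ wordSet w))))) ⟩
      ∑ (allFin n) (λ v → ∑ (words n m) (λ w → 𝟙 (f v ∧ isCentre E L (wordSet w) v)))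
                                                              ≡⟨ ∑-swap (allFin n) (words n m) _ ⟩
      ∑ (words n m) (λ w → ∑ (allFin n) (λ v → 𝟙 (f v ∧ isCentre E L (wordSet w) v))) ∎
      where
      open ≤-Reasoning
      regroup : ∀ p q r s → ((p ∧ q) ∧ r) ∧ s ≡ true → p ∧ (q ∧ (s ∧ r)) ≡ true
      regroup true true true true _ = refl
      each : ∀ e → e ∈ˡ es → P e ≡ true → m ! ≤ count (λ w → onceMarked f w ∧ spelling e w)
      each e e∈ p with good e p
      ... | once , fv with ∣p∣≥1⇒∃ {p = e ∩ L} (≤-reflexive (sym once))
      ... | v , v∈ = begin
        m !                                               ≡⟨ sym (count-spelling m (e - v) size') ⟩
        count {n} {m} (spelling (e - v))                  ≤⟨ count-mono {n} {m} {X = spelling (e - v)} {Y = λ w → onceMarked f (v ∷ w) ∧ spelling e (v ∷ w)} sub ⟩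
        count (λ w → onceMarked f (v ∷ w) ∧ spelling e (v ∷ w)) ≤⟨ count-slice (λ w → onceMarked f w ∧ spelling e w) v ⟩
        count (λ w → onceMarked f w ∧ spelling e w)       ∎
        where
        v∈e = proj₁ (x∈p∩q⁻ e L v∈)
        v∈L = proj₂ (x∈p∩q⁻ e L v∈)
        size' : ∣ e - v ∣ ≡ m
        size' = suc-injective (trans (sym (∣p-x∣ v∈e)) (All.lookup uniform-es e∈))
        off : Empty ((e - v) ∩ L)
        off (u , u∈) with x∈p∩q⁻ (e - v) L u∈
        ... | u∈e-v , u∈L = ∣p∣≡0⇒Empty (suc-injective (trans (sym (∣p-x∣ v∈)) once))
              (u , x∈p∧x≢y⇒x∈p-y (x∈p∩q⁺ (p─q⊆p e ⁅ v ⁆ u∈e-v , u∈L)) (λ { refl → x∉p-x e v u∈e-v }))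
        sub : ∀ (w : Word n m) → spelling (e - v) w ≡ true → onceMarked f (v ∷ w) ∧ spelling e (v ∷ w) ≡ true
        sub w q with does-true⁻ (wordSet w ≟ˢ (e - v)) q
        ... | eq = ∧-true (∧-true (∧-true (fv v v∈) (does-true (v ∈? L) v∈L))
              (not-true (nonempty? (wordSet w ∩ L)) (subst (λ z → Empty (z ∩ L)) (sym eq) off)))
              (does-true (⁅ v ⁆ ∪ wordSet w ≟ˢ e) (trans (cong (⁅ v ⁆ ∪_) eq) (⁅x⁆∪p-x v∈e)))

    low? : ∀ w → Dec (suc (card w) ≤ t')
    low? w = suc (card w) ≤? t'
    high? : ∀ w → Dec (suc t' ≤ card w)
    high? w = suc t' ≤? card w

    low high : Word n m → ℕ
    low w  = 𝟙 (does (low? w))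
    high w = 𝟙 (does (high? w))

    totalCentres lowCount highCount : ℕ
    totalCentres = ∑ (words n m) card
    lowCount     = ∑ (words n m) low
    highCount    = ∑ (words n m) high

    centres-lower : m ! * ∑ es (𝟙 ∘ meetsOnce) ≤ totalCentres
    centres-lower = ≤-trans (meetsOnce-bound (λ _ → true) meetsOnce (λ e p → does-true⁻ (trace e ≟ 1) p , (λ _ _ → refl)))
      (≤-reflexive (∑-cong (words n m) (λ w → sym (∣tabulate∣ (isCentre E L (wordSet w))))))

    ∑-words-const : ∀ x → ∑ (words n m) (λ _ → x) ≡ x * n ^ m
    ∑-words-const x = trans (∑-const (words n m) x) (trans (cong (_* x) (length-words n m)) (*-comm (n ^ m) x))

    centres-upper : totalCentres + lowCount ≤ t' * n ^ m + ∣ L ∣ * highCount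
    centres-upper = begin
      totalCentres + lowCount                              ≡⟨ sym (∑-+ (words n m) card low) ⟩
      ∑ (words n m) (λ w → card w + low w)                 ≤⟨ ∑-mono (words n m) pointwise ⟩
      ∑ (words n m) (λ w → t' + ∣ L ∣ * high w)             ≡⟨ ∑-+ (words n m) (λ _ → t') _ ⟩
      ∑ (words n m) (λ _ → t') + ∑ (words n m) (λ w → ∣ L ∣ * high w)
                                                           ≡⟨ cong₂ _+_ (∑-words-const t') (∑-*ˡ (words n m) ∣ L ∣ high) ⟩
      t' * n ^ m + ∣ L ∣ * highCount                        ∎
      where
      open ≤-Reasoning
      pointwise : ∀ w → card w + low w ≤ t' + ∣ L ∣ * high w
      pointwise w = 𝟙-cases (λ i → card w + i ≤ t' + ∣ L ∣ * high w) (low? w)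
        (λ lo → ≤-trans (≤-reflexive (+-comm (card w) 1)) (≤-trans lo (m≤m+n t' _)))
        (λ _ → ≤-trans (≤-reflexive (+-identityʳ _)) (𝟙-cases (λ i → card w ≤ t' + ∣ L ∣ * i) (high? w)
          (λ _ → ≤-trans (card≤ w) (≤-trans (≤-reflexive (sym (*-identityʳ ∣ L ∣))) (m≤n+m _ t')))
          (λ ¬hi → ≤-trans (≤-pred (≰⇒> ¬hi)) (m≤m+n t' _))))

    -- A popular vertex of the edges avoiding L would belong to L.
    avoiding-few : ∀ h → 1 ≤ h ^ m → L ≡ popular h → ¬ Copy T a b E →
      ∑ es (𝟙 ∘ avoids) ≤ furediConstant (s + suc t') k * (n ^ k + h * (m * n ^ k))
    avoiding-few h h≥1 L≡ free
      with popular-vertex T tree i₀ zero a b k a+b≡r 2≤b b<a h avoiding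
             (λ e p → uni e (proj₂ (∧-true⁻ {avoids e} p))) ¬copy
      where
      ¬copy : ¬ Copy T a b avoiding
      ¬copy copy = free (record
        { Us = Us ; Vs = Vs ; Us-size = Us-size ; Vs-size = Vs-size ; UU-disj = UU-disj ; VV-disj = VV-disj
        ; UV-disj = UV-disj ; edge = λ i j ij → proj₂ (∧-true⁻ {avoids (Us i ∪ Vs j)} (edge i j ij)) })
        where open Copy copy
    ... | inj₂ le = ≤-trans avoiding-bound le
    ... | inj₁ (v , le) = ⊥-elim (∣p∣≡0⇒Empty (does-true⁻ (trace (⁅ v ⁆ ∪ wordSet w) ≟ 0) (proj₁ (∧-true⁻ w∈)))
            (v , x∈p∩q⁺ (x∈p∪q⁺ (inj₁ (x∈⁅x⁆ v)) , v∈L)))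
      where
      inh = inhabited-of-large {n} {m} (λ w → avoiding (⁅ v ⁆ ∪ wordSet w)) (≤-trans h≥1 le)
      w = proj₁ inh
      w∈ = proj₂ inh
      v∈L : v ∈ L
      v∈L = subst (v ∈_) (sym L≡) (∈-tabulate⁺ (λ v → does (popular? h v)) (does-true (popular? h v)
        (≤-trans le (count-mono {n} {m} {X = λ w → avoiding (⁅ v ⁆ ∪ wordSet w)} (λ w p → proj₂ (∧-true⁻ {avoids (⁅ v ⁆ ∪ wordSet w)} p))))))

    module _ (free : ¬ Copy T a b E) where

      crowdedCount : ℕ
      crowdedCount = count (crowded T tree i₀ zero a b k a+b≡r a≤k E uni L free)

      union? : ∀ (w : Word n (2 + k)) → Dec (suc t' ≤ ∣ c (wordSet (choose true w)) ∪ c (wordSet (choose false w)) ∣)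
      union? w = suc t' ≤? ∣ c (wordSet (choose true w)) ∪ c (wordSet (choose false w)) ∣

      -- A word with more than t' centres is crowded together with every second letter, and there
      -- are n second letters.
      high-few : n * highCount ≤ crowdedCount
      high-few = ≤-trans (≤-reflexive (sym (∑-choose true high))) (∑-mono (words n (2 + k)) λ w →
        𝟙-cases (λ i → i ≤ 𝟙 (does (union? w))) (high? (choose true w))
          (λ hi → 𝟙-true (does-true (union? w) (≤-trans hi (∣p∣≤∣p∪q∣ (c (wordSet (choose true w))) (c (wordSet (choose false w))))))) (λ _ → z≤n))

      -- If neither word is low and the union of the two centre sets has at most t' elements, both
      -- sets fill the union and are equal.
      changes-few : changes k c ≤ n * lowCount + n * lowCount + crowdedCount
      changes-few = ≤-trans (∑-mono (words n (2 + k)) pointwise) (≤-reflexive (trans (∑-+ (words n (2 + k)) _ _)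
        (cong (_+ crowdedCount) (trans (∑-+ (words n (2 + k)) (low ∘ choose true) (low ∘ choose false))
          (cong₂ _+_ (∑-choose true low) (∑-choose false low))))))
        where
        same : ∀ (p q : Subset n) → ¬ (suc ∣ p ∣ ≤ t') → ¬ (suc ∣ q ∣ ≤ t') → ¬ (suc t' ≤ ∣ p ∪ q ∣) → p ≡ q
        same p q lp lq u = trans (p⊆q∧∣q∣≤∣p∣⇒p≡q (λ x∈ → x∈p∪q⁺ (inj₁ x∈)) (≤-trans (≤-pred (≰⇒> u)) (≤-pred (≰⇒> lp))))
          (sym (p⊆q∧∣q∣≤∣p∣⇒p≡q (λ x∈ → x∈p∪q⁺ (inj₂ x∈)) (≤-trans (≤-pred (≰⇒> u)) (≤-pred (≰⇒> lq)))))
        pointwise : ∀ w → differ (c (wordSet (choose true w))) (c (wordSet (choose false w)))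
          ≤ low (choose true w) + low (choose false w) + 𝟙 (does (union? w))
        pointwise w = 𝟙-cases (λ i → d ≤ i + low (choose false w) + 𝟙 (does (union? w))) (low? (choose true w))
          (λ _ → ≤-trans (𝟙≤1 _) (m≤m+n 1 _))
          (λ lp → 𝟙-cases (λ i → d ≤ i + 𝟙 (does (union? w))) (low? (choose false w))
            (λ _ → ≤-trans (𝟙≤1 _) (m≤m+n 1 _))
            (λ lq → 𝟙-cases (λ i → d ≤ i) (union? w) (λ _ → 𝟙≤1 _)
              (λ u → ≤-reflexive (trans (cong (differ p) (sym (same p q lp lq u))) (differ-refl p)))))
          where
          p = c (wordSet (choose true w))
          q = c (wordSet (choose false w))
          d = differ p q

    deviation : Subset n → ℕ
    deviation S = ∑ (words n m) (λ w → differ S (c (wordSet w)))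

    -- Averaging the disagreements: some word has a centre set that differs from those of no more
    -- words than the average.
    typical-centres : 1 ≤ n ^ m → ∃[ S ] n ^ m * deviation S ≤ m * n ^ k * changes k c
    typical-centres pos with ∑-minimal′ (words n m) (λ w → deviation (c (wordSet w))) (≤-trans pos (≤-reflexive (sym (length-words n m))))
    ... | w , le = c (wordSet w) , ≤-trans (≤-reflexive (cong (_* deviation (c (wordSet w))) (sym (length-words n m))))
          (≤-trans le (disagreements-bound k c))

    -- If S has the wrong size, every word with centre set S is low or high, so every word is
    -- deviating, low or high.
    typical-size : ∀ S → ∣ S ∣ ≡ t' ⊎ n ^ m ≤ deviation S + lowCount + highCount
    typical-size S with ∣ S ∣ ≟ t'
    ... | yes eq = inj₁ eq
    ... | no ne = inj₂ (≤-trans (≤-reflexive (sym (trans (∑-words-const 1) (*-identityˡ _))))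
        (≤-trans (∑-mono (words n m) pointwise) (≤-reflexive (trans (∑-+ (words n m) _ high) (cong (_+ highCount) (∑-+ (words n m) _ low))))))
      where
      pointwise : ∀ w → 1 ≤ differ S (c (wordSet w)) + low w + high w
      pointwise w with S ≟ˢ c (wordSet w)
      ... | no _ = m≤m+n 1 _
      ... | yes S≡ = 𝟙-cases (λ i → 1 ≤ 0 + i + high w) (low? w) (λ _ → m≤m+n 1 _)
        (λ lo → 𝟙-cases (λ i → 1 ≤ i) (high? w) (λ _ → ≤-refl)
          (λ hi → ⊥-elim (ne (trans (cong ∣_∣ S≡) (≤-antisym (≤-pred (≰⇒> hi)) (≤-pred (≰⇒> lo)))))))

    -- An edge that misses S and meets `L` once does so in a centre outside S, so the centre set of
    -- the remaining word is not S. Such a word accounts for at most t' edges, or at most |L| if it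
    -- is high.
    disjoint-bound : ∀ S → ∑ es (λ e → 𝟙 (does (∣ e ∩ S ∣ ≟ 0))) ≤
      ∑ es (𝟙 ∘ avoids) + ∑ es (𝟙 ∘ meetsTwice) + (t' * deviation S + ∣ L ∣ * highCount)
    disjoint-bound S = begin
      ∑ es (λ e → 𝟙 (misses e))                                           ≤⟨ ∑-mono es pointwise ⟩
      ∑ es (λ e → 𝟙 (avoids e) + 𝟙 (meetsTwice e) + 𝟙 (off e))              ≡⟨ trans (∑-+ es _ _) (cong (_+ ∑ es (𝟙 ∘ off)) (∑-+ es _ _)) ⟩
      ∑ es (𝟙 ∘ avoids) + ∑ es (𝟙 ∘ meetsTwice) + ∑ es (𝟙 ∘ off)            ≤⟨ +-monoʳ-≤ _ off-bound ⟩
      ∑ es (𝟙 ∘ avoids) + ∑ es (𝟙 ∘ meetsTwice) + (t' * deviation S + ∣ L ∣ * highCount) ∎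
      where
      open ≤-Reasoning
      misses off : Subset n → Bool
      misses e = does (∣ e ∩ S ∣ ≟ 0)
      off e = meetsOnce e ∧ misses e
      cases : ∀ x b → 𝟙 b ≤ 𝟙 (does (x ≟ 0)) + 𝟙 (does (2 ≤? x)) + 𝟙 (does (x ≟ 1) ∧ b)
      cases 0 b = ≤-trans (𝟙≤1 b) (m≤m+n 1 _)
      cases 1 b = ≤-refl
      cases (suc (suc x)) b = ≤-trans (𝟙≤1 b) (m≤m+n 1 _)
      pointwise : ∀ e → 𝟙 (misses e) ≤ 𝟙 (avoids e) + 𝟙 (meetsTwice e) + 𝟙 (off e)
      pointwise e = cases (trace e) (misses e)
      notS : Fin n → Bool
      notS v = not (does (v ∈? S))
      off-bound : ∑ es (𝟙 ∘ off) ≤ t' * deviation S + ∣ L ∣ * highCount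
      off-bound = begin
        ∑ es (𝟙 ∘ off)                                                  ≤⟨ ≤-trans (≤-reflexive (sym (*-identityˡ _))) (*-monoˡ-≤ (∑ es (𝟙 ∘ off)) (1≤n! m)) ⟩
        m ! * ∑ es (𝟙 ∘ off)                                            ≤⟨ meetsOnce-bound notS off good ⟩
        ∑ (words n m) (λ w → ∑ (allFin n) (λ v → 𝟙 (notS v ∧ isCentre E L (wordSet w) v)))
                                                                        ≤⟨ ∑-mono (words n m) each ⟩
        ∑ (words n m) (λ w → t' * differ S (c (wordSet w)) + ∣ L ∣ * high w) ≡⟨ trans (∑-+ (words n m) _ _) (cong₂ _+_ (∑-*ˡ (words n m) t' _) (∑-*ˡ (words n m) ∣ L ∣ high)) ⟩
        t' * deviation S + ∣ L ∣ * highCount                             ∎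
        where
        good : ∀ e → off e ≡ true → trace e ≡ 1 × (∀ v → v ∈ e ∩ L → notS v ≡ true)
        good e p with ∧-true⁻ {meetsOnce e} p
        ... | once , miss = does-true⁻ (trace e ≟ 1) once , λ v v∈ → not-true (v ∈? S)
              (λ v∈S → ∣p∣≡0⇒Empty (does-true⁻ (∣ e ∩ S ∣ ≟ 0) miss) (v , x∈p∩q⁺ (proj₁ (x∈p∩q⁻ e L v∈) , v∈S)))
        stray : Word n m → ℕ
        stray w = ∑ (allFin n) (λ v → 𝟙 (notS v ∧ isCentre E L (wordSet w) v))
        stray≤ : ∀ w → stray w ≤ card w
        stray≤ w = ≤-trans (∑-mono (allFin n) (λ v → 𝟙-mono (λ p → proj₂ (∧-true⁻ {notS v} p))))
          (≤-reflexive (sym (∣tabulate∣ (isCentre E L (wordSet w)))))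
        each : ∀ w → stray w ≤ t' * differ S (c (wordSet w)) + ∣ L ∣ * high w
        each w with S ≟ˢ c (wordSet w)
        ... | yes S≡ = ≤-trans (≤-reflexive (∑-zero (allFin n) none)) z≤n
          where
          none : ∀ v → 𝟙 (notS v ∧ isCentre E L (wordSet w) v) ≡ 0
          none v with v ∈? S
          ... | yes _ = refl
          ... | no v∉ with isCentre E L (wordSet w) v in eq
          ...   | false = refl
          ...   | true  = ⊥-elim (v∉ (subst (v ∈_) (sym S≡) (∈-tabulate⁺ (isCentre E L (wordSet w)) eq)))
        ... | no _ = ≤-trans (stray≤ w) (𝟙-cases (λ i → card w ≤ t' * 1 + ∣ L ∣ * i) (high? w)
          (λ _ → ≤-trans (card≤ w) (≤-trans (≤-reflexive (sym (*-identityʳ ∣ L ∣))) (m≤n+m _ _)))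
          (λ hi → ≤-trans (≤-pred (≰⇒> hi)) (≤-trans (≤-reflexive (sym (*-identityʳ t'))) (m≤m+n _ _))))

-- Choice of constants

-- The identity (k + 1) C(n, k + 1) = (n - k) C(n, k) without subtraction.
absorption : ∀ n k → suc k * (n C suc k) + k * (n C k) ≡ n * (n C k)
absorption zero zero    = refl
absorption zero (suc k) = trans (cong₂ _+_ (cong (suc (suc k) *_) (k>n⇒nCk≡0 {0} {suc (suc k)} (s≤s z≤n))) (cong (suc k *_) (k>n⇒nCk≡0 {0} {suc k} (s≤s z≤n))))
  (trans (cong₂ _+_ (*-zeroʳ (suc (suc k))) (*-zeroʳ (suc k))) refl)
absorption (suc n) zero = trans (+-identityʳ _) (trans (*-identityˡ (suc n C 1)) (trans (nC1≡n (suc n)) (sym (*-identityʳ (suc n)))))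
absorption (suc n) (suc j) = begin
  (2 + j) * (suc n C (2 + j)) + suc j * (suc n C suc j)
    ≡⟨ cong₂ (λ x y → (2 + j) * x + suc j * y) (sym (nCk+nC[k+1]≡[n+1]C[k+1] n (suc j))) (sym (nCk+nC[k+1]≡[n+1]C[k+1] n j)) ⟩
  (2 + j) * (y + z) + suc j * (x + y)
    ≡⟨ regroup j x y z ⟩
  ((2 + j) * z + suc j * y) + y + (suc j * y + j * x) + x
    ≡⟨ cong₂ (λ u v → u + y + v + x) (absorption n (suc j)) (absorption n j) ⟩
  n * y + y + n * x + x
    ≡⟨ regroup' n x y ⟩
  suc n * (x + y)
    ≡⟨ cong (suc n *_) (nCk+nC[k+1]≡[n+1]C[k+1] n j) ⟩
  suc n * (suc n C suc j) ∎
  where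
  open ≡-Reasoning
  x = n C j
  y = n C suc j
  z = n C (2 + j)
  regroup : ∀ j x y z → (2 + j) * (y + z) + suc j * (x + y) ≡ ((2 + j) * z + suc j * y) + y + (suc j * y + j * x) + x
  regroup = solve-∀
  regroup' : ∀ n x y → n * y + y + n * x + x ≡ suc n * (x + y)
  regroup' = solve-∀

falling : ∀ n k → suc k ! * (n C suc k) + k * (k ! * (n C k)) ≡ n * (k ! * (n C k))
falling n k = begin
  suc k ! * (n C suc k) + k * (k ! * (n C k))            ≡⟨ regroup (k !) (suc k) k (n C suc k) (n C k) ⟩
  k ! * (suc k * (n C suc k) + k * (n C k))              ≡⟨ cong (k ! *_) (absorption n k) ⟩
  k ! * (n * (n C k))                                    ≡⟨ regroup' (k !) n (n C k) ⟩
  n * (k ! * (n C k))                                    ∎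
  where
  open ≡-Reasoning
  regroup : ∀ f s k x y → s * f * x + k * (f * y) ≡ f * (s * x + k * y)
  regroup = solve-∀
  regroup' : ∀ f n x → f * (n * x) ≡ n * (f * x)
  regroup' = solve-∀

falling≤^ : ∀ n k → k ! * (n C k) ≤ n ^ k
falling≤^ n zero    = ≤-refl
falling≤^ n (suc k) = ≤-trans (m≤m+n _ _) (≤-trans (≤-reflexive (falling n k)) (*-monoʳ-≤ n (falling≤^ n k)))

-- The induction needs (k + 1)² + (k + 1) for the next error coefficient; the slack k + 2 completes
-- the square (k + 2)².
^≤falling : ∀ n k → n ^ suc k ≤ suc k ! * (n C suc k) + suc k * suc k * n ^ k
^≤falling n zero = ≤-trans (≤-reflexive (trans (*-identityʳ n) (sym (trans (*-identityˡ (n C 1)) (nC1≡n n))))) (m≤m+n _ _)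
^≤falling n (suc k) = begin
  n * n ^ suc k                                               ≤⟨ *-monoʳ-≤ n (^≤falling n k) ⟩
  n * (F + suc k * suc k * n ^ k)                             ≡⟨ trans (*-distribˡ-+ n F _) (cong₂ _+_ (sym (falling n (suc k))) (regroup n (suc k) (n ^ k))) ⟩
  G + suc k * F + suc k * suc k * n ^ suc k                   ≤⟨ +-monoˡ-≤ _ (+-monoʳ-≤ G (*-monoʳ-≤ (suc k) (falling≤^ n (suc k)))) ⟩
  G + suc k * n ^ suc k + suc k * suc k * n ^ suc k           ≤⟨ m≤m+n _ ((2 + k) * n ^ suc k) ⟩
  G + suc k * n ^ suc k + suc k * suc k * n ^ suc k + (2 + k) * n ^ suc k ≡⟨ regroup' G k (n ^ suc k) ⟩
  G + (2 + k) * (2 + k) * n ^ suc k                           ∎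
  where
  open ≤-Reasoning
  F = suc k ! * (n C suc k)
  G = (2 + k) ! * (n C (2 + k))
  regroup : ∀ n s p → n * (s * s * p) ≡ s * s * (n * p)
  regroup = solve-∀
  regroup' : ∀ G k p → G + suc k * p + suc k * suc k * p + (2 + k) * p ≡ G + (2 + k) * (2 + k) * p
  regroup' = solve-∀

^-distribʳ-* : ∀ k x y → (x * y) ^ k ≡ x ^ k * y ^ k
^-distribʳ-* zero    x y = refl
^-distribʳ-* (suc k) x y = trans (cong (x * y *_) (^-distribʳ-* k x y)) (regroup x y (x ^ k) (y ^ k))
  where
  regroup : ∀ a b c d → a * b * (c * d) ≡ a * c * (b * d)
  regroup = solve-∀

-- In units of n^m, `C₁`, `CB` and `C₄` bound K times the number of edges avoiding L, of low words
-- and of deviating words. None of them depends on `K`, so `K` can be chosen from their combination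
-- `C₆`. The bounds `ℓ` for |L| and `C₃` for the crowded words depend on `K`, but they occur only in
-- lower-order terms, which `threshold` absorbs. The accuracy demanded of the edge count is `k₀`.
module Constants (k t' CF κ : ℕ) where

  m C₁ CB C₄ C₆ K ℓ C₃ k₀ threshold : ℕ
  m  = suc k
  C₁ = CF * (1 + m)
  CB = m ! * C₁ + 4
  C₄ = 2 * m * CB + 1
  C₆ = suc (C₁ + 1 + t' * C₄ + 1 + (C₄ + CB + 1))
  K  = κ * C₆
  ℓ  = (2 + k) ! * (2 * (t' * (2 * K) ^ m))
  C₃ = (ℓ * 2) ^ suc t' * CF
  k₀ = K * suc t'
  threshold = K + K * ℓ * C₃ + K * m ! * (ℓ * ℓ) + K * t' * (m * m) + m * K * C₃ + 1

-- f is the number of edges, ℓ₀ the size of L; X₁, P₁ and X₂ count the edges meeting L in none, one and at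
-- least two vertices; B₁ and B₂ count the words with fewer than t' and more than t' centres, c is the total
-- number of centres, Q counts the crowded words, and g the words whose set of centres is not the chosen set.
module Bookkeeping (k t' CF κ : ℕ) (κ≥1 : 1 ≤ κ) (n : ℕ) (large : Constants.threshold k t' CF κ ≤ n) where

  open Constants k t' CF κ

  p N : ℕ
  p = n ^ k
  N = n * p

  K≥1 : 1 ≤ K
  K≥1 = *-mono-≤ κ≥1 (s≤s z≤n)

  instance
    K≢0 : NonZero K
    K≢0 = >-nonZero K≥1

  n≥K : K ≤ n
  n≥K = ≤-trans (≤-trans (m≤m+n K _) (≤-trans (m≤m+n _ _) (≤-trans (m≤m+n _ _) (≤-trans (m≤m+n _ _) (m≤m+n _ _))))) large

  n≥₂ : K * ℓ * C₃ ≤ n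
  n≥₂ = ≤-trans (≤-trans (m≤n+m _ K) (≤-trans (m≤m+n _ _) (≤-trans (m≤m+n _ _) (≤-trans (m≤m+n _ _) (m≤m+n _ _))))) large

  n≥₃ : K * m ! * (ℓ * ℓ) ≤ n
  n≥₃ = ≤-trans (≤-trans (m≤n+m _ (K + K * ℓ * C₃)) (≤-trans (m≤m+n _ _) (≤-trans (m≤m+n _ _) (m≤m+n _ _)))) large

  n≥₄ : K * t' * (m * m) ≤ n
  n≥₄ = ≤-trans (≤-trans (m≤n+m _ (K + K * ℓ * C₃ + K * m ! * (ℓ * ℓ))) (≤-trans (m≤m+n _ _) (m≤m+n _ _))) large

  n≥₅ : m * K * C₃ ≤ n
  n≥₅ = ≤-trans (≤-trans (m≤n+m _ (K + K * ℓ * C₃ + K * m ! * (ℓ * ℓ) + K * t' * (m * m))) (m≤m+n _ _)) large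

  n≥1 : 1 ≤ n
  n≥1 = ≤-trans (m≤n+m 1 _) large

  instance
    n≢0 : NonZero n
    n≢0 = >-nonZero n≥1

  p≥1 : 1 ≤ p
  p≥1 = ≤-trans (≤-reflexive (sym (^-zeroˡ k))) (^-monoˡ-≤ k n≥1)

  instance
    p≢0 : NonZero p
    p≢0 = >-nonZero p≥1

  N≥1 : 1 ≤ N
  N≥1 = *-mono-≤ n≥1 p≥1

  h : ℕ
  h = n / K

  hK≤n : h * K ≤ n
  hK≤n = m/n*n≤m n K

  h≥1 : 1 ≤ h
  h≥1 = m≥n⇒m/n>0 n≥K

  h^m≥1 : 1 ≤ h ^ m
  h^m≥1 = ≤-trans (≤-reflexive (sym (^-zeroˡ m))) (^-monoˡ-≤ m h≥1)

  -- Rounding in `n / K` costs at most a factor two because h ≥ 1; this is the `2 * K` in `ℓ`.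
  n≤2Kh : n ≤ 2 * K * h
  n≤2Kh = begin
    n                     ≡⟨ m≡m%n+[m/n]*n n K ⟩
    n % K + h * K         ≤⟨ +-monoˡ-≤ (h * K) (<⇒≤ (m%n<n n K)) ⟩
    K + h * K             ≤⟨ +-monoˡ-≤ (h * K) (≤-trans (≤-reflexive (sym (*-identityˡ K))) (*-monoˡ-≤ K h≥1)) ⟩
    h * K + h * K         ≡⟨ regroup h K ⟩
    2 * K * h             ∎
    where
    open ≤-Reasoning
    regroup : ∀ h K → h * K + h * K ≡ 2 * K * h
    regroup = solve-∀

  module Estimates (f ℓ₀ X₁ X₂ P₁ Q B₁ B₂ c g : ℕ)
    (f≤    : f ≤ 2 * (t' * (n C m)))
    (f≥    : k₀ * (t' * (n C m)) ≤ k₀ * f + t' * (n C m))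
    (L≤    : ℓ₀ * h ^ m ≤ (2 + k) ! * f)
    (X₁≤   : X₁ ≤ CF * (p + h * (m * p)))
    (X₂≤   : X₂ ≤ ℓ₀ * ℓ₀ * p)
    (Q≤    : Q ≤ (ℓ₀ * 2) ^ suc t' * (CF * N))
    (B₂≤   : n * B₂ ≤ Q)
    (split : f ≤ X₁ + P₁ + X₂)
    (c≥    : m ! * P₁ ≤ c)
    (c≤    : c + B₁ ≤ t' * N + ℓ₀ * B₂)
    (g≤    : N * g ≤ m * p * (n * B₁ + n * B₁ + Q)) where

    open ≤-Reasoning

    ℓ₀≤ℓ : ℓ₀ ≤ ℓ
    ℓ₀≤ℓ = *-cancelʳ-≤ ℓ₀ ℓ (h ^ m) {{>-nonZero h^m≥1}} (begin
      ℓ₀ * h ^ m                                            ≤⟨ L≤ ⟩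
      (2 + k) ! * f                                         ≤⟨ *-monoʳ-≤ ((2 + k) !) f≤ ⟩
      (2 + k) ! * (2 * (t' * (n C m)))                      ≤⟨ *-monoʳ-≤ ((2 + k) !) (*-monoʳ-≤ 2 (*-monoʳ-≤ t' C≤)) ⟩
      (2 + k) ! * (2 * (t' * ((2 * K) ^ m * h ^ m)))        ≡⟨ regroup ((2 + k) !) t' ((2 * K) ^ m) (h ^ m) ⟩
      ℓ * h ^ m                                             ∎)
      where
      regroup : ∀ r t a b → r * (2 * (t * (a * b))) ≡ r * (2 * (t * a)) * b
      regroup = solve-∀
      C≤ : n C m ≤ (2 * K) ^ m * h ^ m
      C≤ = begin
        n C m                       ≤⟨ ≤-trans (≤-reflexive (sym (*-identityˡ (n C m)))) (*-monoˡ-≤ (n C m) (1≤n! m)) ⟩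
        m ! * (n C m)               ≤⟨ falling≤^ n m ⟩
        n ^ m                       ≤⟨ ^-monoˡ-≤ m n≤2Kh ⟩
        (2 * K * h) ^ m             ≡⟨ ^-distribʳ-* m (2 * K) h ⟩
        (2 * K) ^ m * h ^ m         ∎

    KX₁ : K * X₁ ≤ C₁ * N
    KX₁ = begin
      K * X₁                              ≤⟨ *-monoʳ-≤ K X₁≤ ⟩
      K * (CF * (p + h * (m * p)))        ≡⟨ regroup K CF p h m ⟩
      CF * (K * p + h * K * (m * p))      ≤⟨ *-monoʳ-≤ CF (+-mono-≤ (*-monoˡ-≤ p n≥K) (*-monoˡ-≤ (m * p) hK≤n)) ⟩
      CF * (n * p + n * (m * p))          ≡⟨ regroup' CF n p m ⟩
      C₁ * N                              ∎
      where
      regroup : ∀ K C p h m → K * (C * (p + h * (m * p))) ≡ C * (K * p + h * K * (m * p))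
      regroup = solve-∀
      regroup' : ∀ C n p m → C * (n * p + n * (m * p)) ≡ C * (1 + m) * (n * p)
      regroup' = solve-∀

    KX₂ : K * m ! * X₂ ≤ N
    KX₂ = begin
      K * m ! * X₂                 ≤⟨ *-monoʳ-≤ (K * m !) (≤-trans X₂≤ (*-monoˡ-≤ p (*-mono-≤ ℓ₀≤ℓ ℓ₀≤ℓ))) ⟩
      K * m ! * (ℓ * ℓ * p)        ≡⟨ sym (*-assoc (K * m !) (ℓ * ℓ) p) ⟩
      K * m ! * (ℓ * ℓ) * p        ≤⟨ *-monoˡ-≤ p n≥₃ ⟩
      N                            ∎

    KX₂' : K * X₂ ≤ N
    KX₂' = ≤-trans (*-monoˡ-≤ X₂ (≤-trans (≤-reflexive (sym (*-identityʳ K))) (*-monoʳ-≤ K (1≤n! m)))) KX₂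

    Q≤C₃N : Q ≤ C₃ * N
    Q≤C₃N = ≤-trans Q≤ (≤-trans (*-monoˡ-≤ (CF * N) (^-monoˡ-≤ (suc t') (*-monoˡ-≤ 2 ℓ₀≤ℓ)))
      (≤-reflexive (sym (*-assoc ((ℓ * 2) ^ suc t') CF N))))

    KℓB₂ : K * (ℓ₀ * B₂) ≤ N
    KℓB₂ = *-cancelˡ-≤ n (begin
      n * (K * (ℓ₀ * B₂))          ≤⟨ *-monoʳ-≤ n (*-monoʳ-≤ K (*-monoˡ-≤ B₂ ℓ₀≤ℓ)) ⟩
      n * (K * (ℓ * B₂))           ≡⟨ regroup n K ℓ B₂ ⟩
      K * ℓ * (n * B₂)             ≤⟨ *-monoʳ-≤ (K * ℓ) (≤-trans B₂≤ Q≤C₃N) ⟩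
      K * ℓ * (C₃ * N)             ≡⟨ sym (*-assoc (K * ℓ) C₃ N) ⟩
      K * ℓ * C₃ * N               ≤⟨ *-monoˡ-≤ N n≥₂ ⟩
      n * N                        ∎)
      where
      regroup : ∀ n K l B → n * (K * (l * B)) ≡ K * l * (n * B)
      regroup = solve-∀

    mKQ : m * K * Q ≤ n * N
    mKQ = begin
      m * K * Q                    ≤⟨ *-monoʳ-≤ (m * K) Q≤C₃N ⟩
      m * K * (C₃ * N)             ≡⟨ sym (*-assoc (m * K) C₃ N) ⟩
      m * K * C₃ * N               ≤⟨ *-monoˡ-≤ N n≥₅ ⟩
      n * N                        ∎

    KB₂ : K * B₂ ≤ N
    KB₂ = *-cancelˡ-≤ n (begin
      n * (K * B₂)                 ≡⟨ regroup n K B₂ ⟩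
      K * (n * B₂)                 ≤⟨ *-monoʳ-≤ K B₂≤ ⟩
      K * Q                        ≤⟨ *-monoˡ-≤ Q (m≤m+n K (k * K)) ⟩
      m * K * Q                    ≤⟨ mKQ ⟩
      n * N                        ∎)
      where
      regroup : ∀ n K B → n * (K * B) ≡ K * (n * B)
      regroup = solve-∀

    -- The factor `suc t'` of `k₀` pays for the t' in the error term, bounded by t' N, and unlike t'
    -- it can always be cancelled.
    density : K * (m ! * (t' * (n C m))) ≤ K * (m ! * f) + N
    density = *-cancelˡ-≤ (suc t') (begin
      suc t' * (K * (m ! * G))                     ≡⟨ regroup (suc t') K (m !) G ⟩
      m ! * (k₀ * G)                               ≤⟨ *-monoʳ-≤ (m !) f≥ ⟩
      m ! * (k₀ * f + G)                           ≡⟨ regroup' (m !) K (suc t') f t' (n C m) ⟩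
      suc t' * (K * (m ! * f)) + t' * (m ! * (n C m)) ≤⟨ +-monoʳ-≤ (suc t' * (K * (m ! * f))) (*-mono-≤ (n≤1+n t') (falling≤^ n m)) ⟩
      suc t' * (K * (m ! * f)) + suc t' * N        ≡⟨ sym (*-distribˡ-+ (suc t') (K * (m ! * f)) N) ⟩
      suc t' * (K * (m ! * f) + N)                 ∎)
      where
      G = t' * (n C m)
      regroup : ∀ t K M G → t * (K * (M * G)) ≡ M * (K * t * G)
      regroup = solve-∀
      regroup' : ∀ M K s f t C → M * (K * s * f + t * C) ≡ s * (K * (M * f)) + t * (M * C)
      regroup' = solve-∀

    -- Counting edges through their centres bounds m! f by t' N - B₁ plus errors, while t' N is at
    -- most m! f plus errors. The main terms cancel and B₁ is bounded by the errors. The 4 in `CB`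
    -- counts those of size N: from `X₂`, from `B₂`, from the falling factorial and from `density`.
    KB₁ : K * B₁ ≤ CB * N
    KB₁ = +-cancelˡ-≤ (K * (m ! * f)) _ _ (begin
      K * (m ! * f) + K * B₁
        ≤⟨ +-monoˡ-≤ (K * B₁) (*-monoʳ-≤ K (*-monoʳ-≤ (m !) split)) ⟩
      K * (m ! * (X₁ + P₁ + X₂)) + K * B₁
        ≡⟨ regroup K (m !) X₁ P₁ X₂ B₁ ⟩
      m ! * (K * X₁) + K * m ! * X₂ + K * (m ! * P₁ + B₁)
        ≤⟨ +-mono-≤ (+-mono-≤ (*-monoʳ-≤ (m !) KX₁) KX₂) (*-monoʳ-≤ K (≤-trans (+-monoˡ-≤ B₁ c≥) c≤)) ⟩
      m ! * (C₁ * N) + N + K * (t' * N + ℓ₀ * B₂)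
        ≡⟨ cong (m ! * (C₁ * N) + N +_) (*-distribˡ-+ K (t' * N) (ℓ₀ * B₂)) ⟩
      m ! * (C₁ * N) + N + (K * (t' * N) + K * (ℓ₀ * B₂))
        ≤⟨ +-monoʳ-≤ (m ! * (C₁ * N) + N) (+-mono-≤ (*-monoʳ-≤ K (*-monoʳ-≤ t' (^≤falling n k))) KℓB₂) ⟩
      m ! * (C₁ * N) + N + (K * (t' * (m ! * (n C m) + m * m * p)) + N)
        ≡⟨ cong (λ z → m ! * (C₁ * N) + N + (z + N)) (regroup₂ K t' (m !) (n C m) (m * m) p) ⟩
      m ! * (C₁ * N) + N + (K * (m ! * (t' * (n C m))) + K * t' * (m * m) * p + N)
        ≤⟨ +-monoʳ-≤ (m ! * (C₁ * N) + N) (+-monoˡ-≤ N (+-mono-≤ density (*-monoˡ-≤ p n≥₄))) ⟩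
      m ! * (C₁ * N) + N + (K * (m ! * f) + N + N + N)
        ≡⟨ regroup₃ (m !) C₁ N (K * (m ! * f)) ⟩
      K * (m ! * f) + CB * N ∎)
      where
      regroup : ∀ K M x p y b → K * (M * (x + p + y)) + K * b ≡ M * (K * x) + K * M * y + K * (M * p + b)
      regroup = solve-∀
      regroup₂ : ∀ K t M C s p → K * (t * (M * C + s * p)) ≡ K * (M * (t * C)) + K * t * s * p
      regroup₂ = solve-∀
      regroup₃ : ∀ M C N z → M * (C * N) + N + (z + N + N + N) ≡ z + (M * C + 4) * N
      regroup₃ = solve-∀

    Kg : K * g ≤ C₄ * N
    Kg = *-cancelˡ-≤ n (*-cancelˡ-≤ p (begin
      p * (n * (K * g))                              ≡⟨ regroup p n K g ⟩
      K * (N * g)                                    ≤⟨ *-monoʳ-≤ K g≤ ⟩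
      K * (m * p * (n * B₁ + n * B₁ + Q))            ≡⟨ regroup₂ K m p n B₁ Q ⟩
      p * (2 * m * n * (K * B₁) + m * K * Q)         ≤⟨ *-monoʳ-≤ p (+-mono-≤ (*-monoʳ-≤ (2 * m * n) KB₁) mKQ) ⟩
      p * (2 * m * n * (CB * N) + n * N)             ≡⟨ cong (p *_) (regroup₃ m n CB N) ⟩
      p * (n * (C₄ * N))                             ∎))
      where
      regroup : ∀ p n K g → p * (n * (K * g)) ≡ K * (n * p * g)
      regroup = solve-∀
      regroup₂ : ∀ K m p n B Q → K * (m * p * (n * B + n * B + Q)) ≡ p * (2 * m * n * (K * B) + m * K * Q)
      regroup₂ = solve-∀
      regroup₃ : ∀ m n C N → 2 * m * n * (C * N) + n * N ≡ n * ((2 * m * C + 1) * N)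
      regroup₃ = solve-∀

    -- This excludes a typical set of the wrong size. The `suc` in `C₆` makes `K` strictly larger
    -- than `C₄ + CB + 1`.
    deviation-small : ¬ (N ≤ g + B₁ + B₂)
    deviation-small N≤ = <⇒≱ beaten (begin
      K * N                              ≤⟨ *-monoʳ-≤ K N≤ ⟩
      K * (g + B₁ + B₂)                  ≡⟨ regroup K g B₁ B₂ ⟩
      K * g + K * B₁ + K * B₂            ≤⟨ +-mono-≤ (+-mono-≤ Kg KB₁) KB₂ ⟩
      C₄ * N + CB * N + N                ≡⟨ regroup₂ C₄ CB N ⟩
      (C₄ + CB + 1) * N                  ∎)
      where
      regroup : ∀ K g b c → K * (g + b + c) ≡ K * g + K * b + K * c
      regroup = solve-∀
      regroup₂ : ∀ c d N → c * N + d * N + N ≡ (c + d + 1) * N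
      regroup₂ = solve-∀
      beaten : (C₄ + CB + 1) * N < K * N
      beaten = *-monoˡ-< N {{>-nonZero N≥1}} (≤-trans (s≤s (m≤n+m (C₄ + CB + 1) (C₁ + 1 + t' * C₄ + 1)))
        (≤-trans (≤-reflexive (sym (*-identityˡ C₆))) (*-monoˡ-≤ C₆ κ≥1)))

    few-disjoint : ∀ {d} → d ≤ X₁ + X₂ + (t' * g + ℓ₀ * B₂) → κ * d ≤ N
    few-disjoint {d} d≤ = *-cancelˡ-≤ C₆ (begin
      C₆ * (κ * d)                                          ≡⟨ trans (sym (*-assoc C₆ κ d)) (cong (_* d) (*-comm C₆ κ)) ⟩
      K * d                                                 ≤⟨ *-monoʳ-≤ K d≤ ⟩
      K * (X₁ + X₂ + (t' * g + ℓ₀ * B₂))                    ≡⟨ regroup K X₁ X₂ t' g (ℓ₀ * B₂) ⟩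
      K * X₁ + K * X₂ + t' * (K * g) + K * (ℓ₀ * B₂)        ≤⟨ +-mono-≤ (+-mono-≤ (+-mono-≤ KX₁ KX₂') (*-monoʳ-≤ t' Kg)) KℓB₂ ⟩
      C₁ * N + N + t' * (C₄ * N) + N                        ≡⟨ regroup₂ C₁ t' C₄ N ⟩
      (C₁ + 1 + t' * C₄ + 1) * N                            ≤⟨ *-monoˡ-≤ N {C₁ + 1 + t' * C₄ + 1} {C₆} (≤-trans (m≤m+n _ (C₄ + CB + 1)) (n≤1+n _)) ⟩
      C₆ * N                                                ∎)
      where
      regroup : ∀ K x y t g z → K * (x + y + (t * g + z)) ≡ K * x + K * y + t * (K * g) + K * z
      regroup = solve-∀
      regroup₂ : ∀ c t d N → c * N + N + t * (d * N) + N ≡ (c + 1 + t * d + 1) * N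
      regroup₂ = solve-∀

-- Assembly for a single n, and passage to the sequence.

near-extremal : ∀ {s t'} (T : BipGraph s (suc t')) → IsTree T → Fin s → ∀ a b k →
  a + b ≡ 2 + k → 2 ≤ b → b < a → a ≤ k → ∀ κ → 1 ≤ κ → ∀ {n} →
  let open Constants k t' (furediConstant (s + suc t') k) κ in threshold ≤ n →
  (es : List (Subset n)) (unique-es : Unique es) → All (λ e → ∣ e ∣ ≡ 2 + k) es →
  ¬ Copy T a b (EdgeLists.isEdge es unique-es) →
  length es ≤ 2 * (t' * (n C suc k)) →
  k₀ * (t' * (n C suc k)) ≤ k₀ * length es + t' * (n C suc k) →
  ∃[ S ] ∣ S ∣ ≡ t' × κ * ∑ es (λ e → 𝟙 (does (∣ e ∩ S ∣ ≟ 0))) ≤ n ^ suc k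
near-extremal {s} {t'} T tree i₀ a b k a+b≡r 2≤b b<a a≤k κ κ≥1 {n} large es unique-es uniform-es free f≤ f≥ =
  S , size-S (typical-size L S) , few-disjoint (disjoint-bound L S)
  where
  CF = furediConstant (s + suc t') k
  open Stability T tree i₀ a b k a+b≡r 2≤b b<a a≤k es unique-es uniform-es
  open Bookkeeping k t' CF κ κ≥1 n large using (h; h^m≥1; N≥1; module Estimates)
  L : Subset n
  L = popular h
  typical = typical-centres L N≥1
  S = proj₁ typical
  g≤ : n ^ suc k * deviation L S ≤ suc k * n ^ k * (n * lowCount L + n * lowCount L + crowdedCount L free)
  g≤ = ≤-trans (proj₂ typical) (*-monoʳ-≤ (suc k * n ^ k) (changes-few L free))
  crowded≤ : crowdedCount L free ≤ (∣ L ∣ * 2) ^ suc t' * (CF * n ^ suc k)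
  crowded≤ = few-crowded T tree i₀ zero a b k a+b≡r a≤k E uni L free
  open Estimates (length es) ∣ L ∣ (∑ es (𝟙 ∘ avoids L)) (∑ es (𝟙 ∘ meetsTwice L))
    (∑ es (𝟙 ∘ meetsOnce L)) (crowdedCount L free) (lowCount L) (highCount L) (totalCentres L) (deviation L S)
    f≤ f≥ (few-popular h) (avoiding-few L h h^m≥1 refl free) (meetsTwice-bound L) crowded≤ (high-few L free)
    (edges-split L) (centres-lower L) (centres-upper L) g≤
  size-S : ∣ S ∣ ≡ t' ⊎ n ^ suc k ≤ deviation L S + lowCount L + highCount L → ∣ S ∣ ≡ t'
  size-S (inj₁ eq) = eq
  size-S (inj₂ le) = ⊥-elim (deviation-small le)

length-filter≡∑ : ∀ {A : Set} {P : A → Set} (P? : ∀ x → Dec (P x)) xs → length (filter P? xs) ≡ ∑ xs (λ x → 𝟙 (does (P? x)))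
length-filter≡∑ P? []       = refl
length-filter≡∑ P? (x ∷ xs) with does (P? x)
... | true  = cong suc (length-filter≡∑ P? xs)
... | false = length-filter≡∑ P? xs

-- S_n may not depend on the accuracy κ, so it is chosen to minimise the number of edges it misses.
module Minimiser {r n : ℕ} (H : RGraph r n) (t' : ℕ) where

  candidates : List (Subset n)
  candidates = filter (λ S → ∣ S ∣ ≟ t') (tuples (true ∷ false ∷ []) n)

  default : Subset n
  default with t' ≤? ∣ ⊤ {n} ∣
  ... | yes le = proj₁ (subset-of-size ⊤ t' le)
  -- Reached only for n < t', where no set of t' vertices exists and no size is claimed.
  ... | no _   = ⊥

  minimiser : Subset n
  minimiser = argmin (disjointEdges H) default candidates

  default-size : t' ≤ n → ∣ default ∣ ≡ t'
  default-size t'≤n with t' ≤? ∣ ⊤ {n} ∣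
  ... | yes le = proj₂ (proj₂ (subset-of-size ⊤ t' le))
  ... | no ¬le = ⊥-elim (¬le (≤-trans t'≤n (≤-reflexive (sym (∣⊤∣≡n n)))))

  minimiser-size : t' ≤ n → ∣ minimiser ∣ ≡ t'
  minimiser-size t'≤n = argmin-all (disjointEdges H) (default-size t'≤n)
    (All.tabulate (λ S∈ → proj₂ (∈-filter⁻ (λ S → ∣ S ∣ ≟ t') {xs = tuples (true ∷ false ∷ []) n} S∈)))

  minimiser-minimal : ∀ S → ∣ S ∣ ≡ t' → disjointEdges H minimiser ≤ disjointEdges H S
  minimiser-minimal S S≡ = f[argmin]≤v⁺ default candidates
    (inj₂ (Mem.lose (∈-filter⁺ (λ S → ∣ S ∣ ≟ t') (∈-tuples S (λ i → ∈-bools (lookup S i))) S≡) ≤-refl))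

theorem4 : (a b s t : ℕ) → 1 ≤ a → 1 ≤ b → 1 ≤ s → 1 ≤ t →
    b < a → a < (a + b) ∸ 1 → t ≤ s →
    (T : BipGraph s t) → IsTree T → HasCriticalLeaf T →
    (H : (n : ℕ) → RGraph (a + b) n) →
    (∀ n → BlowupFree T a b (H n)) →
    AsympEq (λ n → size (H n)) (λ n → (t ∸ 1) * (n C ((a + b) ∸ 1))) →
    Σ ((n : ℕ) → Subset n) (λ S →
    (∀ n → t ∸ 1 ≤ n → ∣ S n ∣ ≡ t ∸ 1) ×
    LittleO (λ n → disjointEdges (H n) (S n)) (λ n → n ^ ((a + b) ∸ 1)))
theorem4 a b (suc s') (suc t') 1≤a 1≤b (s≤s _) (s≤s _) b<a a<r-1 _ T tree _ H free asymp =
  (λ n → Minimiser.minimiser (H n) t') , (λ n → Minimiser.minimiser-size (H n) t') , small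
  where
  k : ℕ
  k = a + b ∸ 2
  r-1≡ : a + b ∸ 1 ≡ suc k
  r-1≡ = +-∸-assoc 1 {a + b} {2} (+-mono-≤ 1≤a 1≤b)
  a+b≡r : a + b ≡ 2 + k
  a+b≡r = sym (m+[n∸m]≡n (+-mono-≤ 1≤a 1≤b))
  -- The hypothesis a < r - 1 enters twice: as a ≤ r - 2, which gives U_i its room among the letters
  -- of W, and as b ≥ 2, which the kernel types require.
  a≤k : a ≤ k
  a≤k = ≤-pred (≤-trans a<r-1 (≤-reflexive r-1≡))
  2≤b : 2 ≤ b
  2≤b = +-cancelˡ-≤ a 2 b (≤-trans (≤-reflexive (+-comm a 2)) (≤-trans (s≤s (s≤s a≤k)) (≤-reflexive (sym a+b≡r))))
  small : LittleO (λ n → disjointEdges (H n) (Minimiser.minimiser (H n) t')) (λ n → n ^ ((a + b) ∸ 1))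
  small κ κ≥1 = threshold + (N₁ + N₂) , bound
    where
    open Constants k t' (furediConstant (suc s' + suc t') k) κ
    k₀≥1 : 1 ≤ k₀
    k₀≥1 = *-mono-≤ {1} {K} {1} {suc t'} (*-mono-≤ {1} {κ} {1} {C₆} κ≥1 (s≤s z≤n)) (s≤s z≤n)
    -- Accuracy 1 gives the crude bound f ≤ 2 G, which keeps L bounded. Accuracy `k₀` gives the
    -- sharp lower bound on f that makes low words rare.
    N₁ = proj₁ (asymp 1 ≤-refl)
    N₂ = proj₁ (asymp k₀ k₀≥1)
    bound : ∀ n → threshold + (N₁ + N₂) ≤ n → κ * disjointEdges (H n) (Minimiser.minimiser (H n) t') ≤ n ^ ((a + b) ∸ 1)
    bound n n≥ = ≤-trans (*-monoʳ-≤ κ (≤-trans (Minimiser.minimiser-minimal (H n) t' S S≡)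
        (≤-reflexive (length-filter≡∑ (λ e → ∣ e ∩ S ∣ ≟ 0) (edges (H n))))))
      (≤-trans S-few (≤-reflexive (cong (n ^_) (sym r-1≡))))
      where
      f = size (H n)
      G = t' * (n C suc k)
      asymp₁ : 1 * dist f G ≤ G
      asymp₁ = subst (λ z → 1 * dist f (t' * (n C z)) ≤ t' * (n C z)) r-1≡
        (proj₂ (asymp 1 ≤-refl) n (≤-trans (≤-trans (m≤m+n N₁ N₂) (m≤n+m _ threshold)) n≥))
      asymp₂ : k₀ * dist f G ≤ G
      asymp₂ = subst (λ z → k₀ * dist f (t' * (n C z)) ≤ t' * (n C z)) r-1≡
        (proj₂ (asymp k₀ k₀≥1) n (≤-trans (≤-trans (m≤n+m N₂ N₁) (m≤n+m _ threshold)) n≥))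
      f≤ : f ≤ 2 * G
      f≤ = ≤-trans (m≤n+∣m-n∣ f G) (+-monoʳ-≤ G (≤-trans (≤-reflexive (sym (*-identityˡ (dist f G))))
        (≤-trans asymp₁ (≤-reflexive (sym (+-identityʳ G))))))
      f≥ : k₀ * G ≤ k₀ * f + G
      f≥ = ≤-trans (*-monoʳ-≤ k₀ (m≤n+∣n-m∣ G f)) (≤-trans (≤-reflexive (*-distribˡ-+ k₀ f (dist f G))) (+-monoʳ-≤ (k₀ * f) asymp₂))
      copy⇒blowup : Copy T a b (EdgeLists.isEdge (edges (H n)) (unique (H n))) → BlowupCopy T a b (H n)
      copy⇒blowup copy = record
        { Us = Us ; Vs = Vs ; Us-size = Us-size ; Vs-size = Vs-size ; UU-disj = UU-disj ; VV-disj = VV-disj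
        ; UV-disj = UV-disj
        ; edge = λ i j ij → does-true⁻ (EdgeLists._∈ᵉ?_ (edges (H n)) (unique (H n)) (Us i ∪ Vs j) (edges (H n))) (edge i j ij) }
        where open Copy copy
      found = near-extremal T tree zero a b k a+b≡r 2≤b b<a a≤k κ κ≥1 (≤-trans (m≤m+n threshold _) n≥)
        (edges (H n)) (unique (H n)) (All.map (λ eq → trans eq a+b≡r) (uniform (H n)))
        (free n ∘ copy⇒blowup) f≤ f≥
      S = proj₁ found
      S≡ = proj₁ (proj₂ found)
      S-few = proj₂ (proj₂ found)
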